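{- Fix a signed triangle $T$. In the dense signed graph model there exists a one-sided tester for the property of being signed triangle free (with respect to $T$) with query complexity $\widetilde{O}(\mathrm{tower}(\log(1/\epsilon)))$.
   Context: A signed graph is $G=(V,E,\sigma)$ with node set $V=[N]$, a simple undirected edge set $E$, and a sign $\sigma:E\to\{+,-\}$ on each edge. A signed triangle is a triangle with a fixed assignment of signs to its edges. For a given signed triangle $T$, a signed graph is signed triangle free if $T$ does not occur in it (no three nodes form a triangle whose edge signs agree with $T$ up to isomorphism). Dense signed graph model: the algorithm knows $N$ and may query pairs $(v,w)\in[N]\times[N]$; the answer is $0$ if $v,w$ are not adjacent, and otherwise the sign $+$ or $-$ of the edge. A signed graph is $\epsilon$-far from a property $\mathcal P$ if at least $\epsilon N^2$ edge modifications (addition, removal or sign switch) have to be made to obtain a signed graph on $[N]$ satisfying $\mathcal P$. A tester for $\mathcal P$ is a randomized algorithm that, given query access to $G$ and an error parameter $\epsilon>0$, accepts with probability at least $2/3$ if $G$ has $\mathcal P$, and rejects with probability at least $2/3$ if $G$ is $\epsilon$-far from having $\mathcal P$. It is one-sided if it always accepts graphs having $\mathcal P$. The query complexity is the number of queries made. $\mathrm{tower}(\log(1/\epsilon))$ denotes a power tower of $2$'s of height $O(\log(1/\epsilon))$. $\widetilde{O}(\cdot)$ hides factors polylogarithmic in its argument and in $N$. -}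

module Defs where

open import Algebra.Definitions.RawMonoid using (sum)
open import Data.Bool using (Bool; true; false; if_then_else_)
open import Data.Bool.Properties using () renaming (_≟_ to _≟ᵇ_)
open import Data.Fin using (Fin)
open import Data.Integer using (∣_∣; +_)
open import Data.Maybe using (Maybe; just; nothing)
open import Data.Nat using (ℕ; zero; suc; _⊔_; NonZero)
  renaming (_+_ to _+ⁿ_; _*_ to _*ⁿ_; _^_ to _^ⁿ_; _≤_ to _≤ⁿ_)
open import Data.Nat.Logarithm using (⌈log₂_⌉)
open import Data.Product using (_×_; _,_; ∃-syntax)
open import Data.Rational using (ℚ; 0ℚ; 1ℚ; Positive; _≤_; _*_; _/_; 1/_; ceiling; +-0-rawMonoid)
open import Data.Rational.Properties using (pos⇒nonZero)
open import Data.Sign using (Sign)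
open import Data.Sum using (_⊎_)
open import Data.Vec.Functional using (foldr)
open import Relation.Binary.PropositionalEquality using (_≡_; _≢_)
open import Relation.Nullary using (¬_; does)

-- The node set, written [N] informally, is Fin N.  `label v w` is `nothing`
-- for a non-adjacent pair and `just s` for an edge of sign s, so it is also
-- the answer to the query (v , w).
record SignedGraph (N : ℕ) : Set where
  field
    label    : Fin N → Fin N → Maybe Sign
    symm     : ∀ v w → label v w ≡ label w v
    loopless : ∀ v → label v v ≡ nothing

open SignedGraph public

Property : Set₁
Property = ∀ {N} → SignedGraph N → Set

record SignedTriangle : Set where
  field
    sign₁₂ sign₂₃ sign₁₃ : Sign

open SignedTriangle public

-- (u , v , w) ranges over all ordered triples, which accounts for "up to
-- isomorphism"; the three nodes are distinct because graphs are loopless.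
_OccursIn_ : SignedTriangle → ∀ {N} → SignedGraph N → Set
T OccursIn G = ∃[ u ] ∃[ v ] ∃[ w ]
    label G u v ≡ just (sign₁₂ T)
  × label G v w ≡ just (sign₂₃ T)
  × label G u w ≡ just (sign₁₃ T)

TriangleFree : SignedTriangle → Property
TriangleFree T G = ¬ (T OccursIn G)

-- H arises from G by adding, removing or switching the sign of exactly the
-- edge {v , w}.
record EdgeModification {N} (G H : SignedGraph N) : Set where
  field
    v w       : Fin N
    modified  : label G v w ≢ label H v w
    unchanged : ∀ x y → ¬ ((x ≡ v × y ≡ w) ⊎ (x ≡ w × y ≡ v)) →
                label G x y ≡ label H x y

infix 4 _⟶[_]_

-- G ⟶[ k ] H : H arises from G by k successive edge modifications.
data _⟶[_]_ {N} (G : SignedGraph N) : ℕ → SignedGraph N → Set where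
  done : G ⟶[ zero ] G
  step : ∀ {k H K} → EdgeModification G H → H ⟶[ k ] K → G ⟶[ suc k ] K

Far : ℚ → Property → Property
Far ε P {N} G = ∀ {k H} → G ⟶[ k ] H → P H → ε * (+ (N *ⁿ N) / 1) ≤ (+ k / 1)

-- A run on graphs with N nodes, adaptive and with access to uniformly random
-- elements of finite sets; it halts with `true` to accept and with `false`
-- to reject.
data Algorithm (N : ℕ) : Set where
  halt   : Bool → Algorithm N
  query  : (v w : Fin N) → (Maybe Sign → Algorithm N) → Algorithm N
  random : (m : ℕ) .{{_ : NonZero m}} → (Fin m → Algorithm N) → Algorithm N

module _ {N} (G : SignedGraph N) where

  Pr[_halts_] : Algorithm N → Bool → ℚ
  Pr[ halt b′     halts b ] = if does (b′ ≟ᵇ b) then 1ℚ else 0ℚ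
  Pr[ query v w f halts b ] = Pr[ f (label G v w) halts b ]
  Pr[ random m f  halts b ] =
    (+ 1 / m) * sum +-0-rawMonoid (λ i → Pr[ f i halts b ])

  -- The largest number of queries made on G, over all random choices.
  queries : Algorithm N → ℕ
  queries (halt _)      = 0
  queries (query v w f) = suc (queries (f (label G v w)))
  queries (random m f)  = foldr _⊔_ 0 (λ i → queries (f i))

  Pr[_accepts] Pr[_rejects] : Algorithm N → ℚ
  Pr[ A accepts] = Pr[ A halts true ]
  Pr[ A rejects] = Pr[ A halts false ]

-- N ≥ 1, since the empty graph is ε-far from every property.
record Tester (P : Property) : Set where
  field
    algorithm : (N : ℕ) .{{_ : NonZero N}} (ε : ℚ) .{{_ : Positive ε}} → Algorithm N
    complete  : ∀ N .{{_ : NonZero N}} ε .{{_ : Positive ε}} (G : SignedGraph N) →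
                P G → (+ 2 / 3) ≤ Pr[_accepts] G (algorithm N ε)
    sound     : ∀ N .{{_ : NonZero N}} ε .{{_ : Positive ε}} (G : SignedGraph N) →
                Far ε P G → (+ 2 / 3) ≤ Pr[_rejects] G (algorithm N ε)

open Tester public

OneSided : ∀ {P : Property} → Tester P → Set
OneSided {P} A = ∀ N .{{_ : NonZero N}} ε .{{_ : Positive ε}} (G : SignedGraph N) →
                 P G → Pr[_accepts] G (algorithm A N ε) ≡ 1ℚ

-- Õ(f) is read as C · f · polylog f · polylog N, uniformly in N and ε.  The
-- summands 1 keep the logarithmic factors positive.
QueryComplexityÕ : ∀ {P : Property} → Tester P →
                   ((ε : ℚ) .{{_ : Positive ε}} → ℕ) → Set
QueryComplexityÕ A f = ∃[ C ] ∃[ k ]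
  (∀ N .{{_ : NonZero N}} ε .{{_ : Positive ε}} (G : SignedGraph N) →
     queries G (algorithm A N ε)
       ≤ⁿ C *ⁿ f ε *ⁿ (1 +ⁿ ⌈log₂ f ε ⌉) ^ⁿ k *ⁿ (1 +ⁿ ⌈log₂ N ⌉) ^ⁿ k)

tower : ℕ → ℕ
tower zero    = 1
tower (suc h) = 2 ^ⁿ tower h

-- The ceiling of log₂ (1/ε), truncated to 0 for ε ≥ 1: rounding 1/ε up first
-- does not change the ceiling of the logarithm.
⌈log₂-1/_⌉ : (ε : ℚ) .{{_ : Positive ε}} → ℕ
⌈log₂-1/ ε ⌉ = ⌈log₂ ∣ ceiling ((1/ ε) {{pos⇒nonZero ε}}) ∣ ⌉

{-# OPTIONS --safe #-}
-- Sampling random triples reduces the tester to triangle removal: a graph that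
-- is ε-far from being T-free contains N³ / tower(O(log 1/ε)) copies of T.  Fox's
-- argument applies.  Deleting triangles greedily gives an edge-disjoint family
-- of M ≥ ε N² / 3 copies; discard all other edges.  If there are few triangles,
-- then in every triple of non-negligible parts of a partition some pair is
-- shattered: a bounded union U of rectangles fills a constant fraction of the
-- pair, but has much smaller density.  Refining by the sides of all these
-- rectangles increases a d log d potential by a constant fraction of M, as each
-- triangle of the family lies in a negligible or in a shattered pair.  The
-- potential stays below O(M log 1/ε), so O(log 1/ε) refinements, each of them
-- exponential in the number of parts, lead to a contradiction.
module Submission where

open import Data.Empty using (⊥-elim)
open import Data.Fin using (Fin; zero; suc)
open import Data.Maybe using (Maybe; just; nothing)
open import Data.Product using (_×_; _,_; proj₁; proj₂; ∃-syntax; Σ-syntax; uncurry)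
open import Data.Sign using (Sign)
open import Data.Sum using (_⊎_; inj₁; inj₂)
open import Defs
open import Function using (_∘_; id)
open import Relation.Binary.PropositionalEquality hiding ([_])
open import Relation.Nullary using (yes; no; ¬_; does)

-- With the usual mean-square potential a refinement gains only a power of ε, so the number of
-- rounds is polynomial in 1/ε. Here everything is measured in triangles of the disjoint family: an
-- edge lies in exactly one of them, so a pair of parts meets as many triangles as it has edges, and
-- a dense pair that shatters raises the potential in proportion to its own edges. The signs
-- disappear with the family: what remains are three relations `P`, `Q`, `R` on one vertex set, one
-- for each side of T. Convexity of d log d is needed only at dyadic scales between 1 and 1/ε, which
-- is why cross-multiplied inequalities in ℕ are enough, with `m = 2 ^ L` of order 1/ε. The parts of
-- a partition may have any sizes; pairs with very small parts are absorbed into the negligible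
-- ones.

module Counting where

  open import Data.Bool using (Bool; true; false; not; _∧_; _∨_; T; if_then_else_)
  open import Data.Bool.ListAction using (any)
  open import Data.Bool.Properties using (∧-comm; ∨-comm)
  open import Data.List using (List; []; _∷_; _++_; length; map; concatMap; filterᵇ; cartesianProduct; allFin)
  open import Data.List.Membership.Propositional using (_∈_)
  open import Data.List.Membership.Propositional.Properties
    using (∈-cartesianProduct⁺; ∈-cartesianProduct⁻; ∈-++⁻; ∈-++⁺ˡ; ∈-++⁺ʳ; ∈-allFin)
  open import Data.List.Properties using (length-map; length-++; length-tabulate; map-tabulate)
  open import Data.List.Relation.Unary.Any using (here; there)
  import Data.Fin as Fin
  import Data.Maybe.Properties as Maybe
  open import Data.Nat
  open import Data.Nat.ListAction using (sum)
  open import Data.Nat.Properties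
  open import Data.Nat.Tactic.RingSolver using (solve-∀)
  import Data.Sign.Properties as Sign

  -- Finite sums and counting over lists.

  private variable
    V X Y Z : Set

  -- Linear arithmetic by certificate: `p ≤ q` collects scaled hypotheses, `s` is the slack, and the
  -- subtraction-free equation that remains is left to the ring solver.
  ≤-linear : ∀ {l r p q} s → p ≤ q → l + q + s ≡ r + p → l ≤ r
  ≤-linear {l} {r} {p} {q} s p≤q eq = +-cancelʳ-≤ q l r (begin
    l + q      ≤⟨ m≤m+n (l + q) s ⟩
    l + q + s  ≡⟨ eq ⟩
    r + p      ≤⟨ +-monoʳ-≤ r p≤q ⟩
    r + q      ∎)
    where open ≤-Reasoning

  𝟙 : Bool → ℕ
  𝟙 true  = 1
  𝟙 false = 0

  𝟙≤1 : ∀ b → 𝟙 b ≤ 1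
  𝟙≤1 true  = ≤-refl
  𝟙≤1 false = z≤n

  𝟙-not : ∀ b → 𝟙 b + 𝟙 (not b) ≡ 1
  𝟙-not true  = refl
  𝟙-not false = refl

  𝟙-∧ : ∀ b c → 𝟙 (b ∧ c) ≡ 𝟙 b * 𝟙 c
  𝟙-∧ true  c = sym (+-identityʳ (𝟙 c))
  𝟙-∧ false c = refl

  𝟙-mono : ∀ {b c} → (b ≡ true → c ≡ true) → 𝟙 b ≤ 𝟙 c
  𝟙-mono {true}  h rewrite h refl = ≤-refl
  𝟙-mono {false} h = z≤n

  𝟙*≤ : ∀ b {m n} → (b ≡ true → m ≤ n) → 𝟙 b * m ≤ n
  𝟙*≤ true  h = ≤-trans (≤-reflexive (+-identityʳ _)) (h refl)
  𝟙*≤ false h = z≤n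

  ≤ᵇ-true : ∀ {m n} → (m ≤ᵇ n) ≡ true → m ≤ n
  ≤ᵇ-true eq = ≤ᵇ⇒≤ _ _ (subst T (sym eq) _)

  ≤ᵇ-false : ∀ {m n} → (m ≤ᵇ n) ≡ false → n < m
  ≤ᵇ-false eq = ≰⇒> λ m≤n → subst T eq (≤⇒≤ᵇ m≤n)

  not-true : ∀ {b} → not b ≡ true → b ≡ false
  not-true {false} _ = refl

  ∧-trueˡ : ∀ {b c} → (b ∧ c) ≡ true → b ≡ true
  ∧-trueˡ {true} _ = refl

  ∧-trueʳ : ∀ {b c} → (b ∧ c) ≡ true → c ≡ true
  ∧-trueʳ {true} h = h

  ∑ : List X → (X → ℕ) → ℕ
  ∑ xs f = sum (map f xs)

  infix 8 ∑
  syntax ∑ xs (λ x → e) = ∑[ x ∈ xs ] e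

  ∑-mono : ∀ (xs : List X) {f g} → (∀ {x} → x ∈ xs → f x ≤ g x) → ∑ xs f ≤ ∑ xs g
  ∑-mono []       f≤g = z≤n
  ∑-mono (x ∷ xs) f≤g = +-mono-≤ (f≤g (here refl)) (∑-mono xs (f≤g ∘ there))

  ∑-cong : ∀ (xs : List X) {f g} → (∀ {x} → x ∈ xs → f x ≡ g x) → ∑ xs f ≡ ∑ xs g
  ∑-cong []       f≡g = refl
  ∑-cong (x ∷ xs) f≡g = cong₂ _+_ (f≡g (here refl)) (∑-cong xs (f≡g ∘ there))

  ∑-mono₂ : ∀ (xs : List X) (ys : List Y) {f g : X → Y → ℕ} →
            (∀ {x y} → x ∈ xs → y ∈ ys → f x y ≤ g x y) →
            ∑[ x ∈ xs ] ∑[ y ∈ ys ] f x y ≤ ∑[ x ∈ xs ] ∑[ y ∈ ys ] g x y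
  ∑-mono₂ xs ys f≤g = ∑-mono xs λ x∈ → ∑-mono ys (f≤g x∈)

  ∑-cong₂ : ∀ (xs : List X) (ys : List Y) {f g : X → Y → ℕ} →
            (∀ {x y} → x ∈ xs → y ∈ ys → f x y ≡ g x y) →
            ∑[ x ∈ xs ] ∑[ y ∈ ys ] f x y ≡ ∑[ x ∈ xs ] ∑[ y ∈ ys ] g x y
  ∑-cong₂ xs ys f≡g = ∑-cong xs λ x∈ → ∑-cong ys (f≡g x∈)

  ∑-+ : ∀ (xs : List X) f g → ∑[ x ∈ xs ] (f x + g x) ≡ ∑ xs f + ∑ xs g
  ∑-+ []       f g = refl
  ∑-+ (x ∷ xs) f g rewrite ∑-+ xs f g = interchange (f x) (g x) (∑ xs f) (∑ xs g)
    where
    interchange : ∀ a b c d → a + b + (c + d) ≡ a + c + (b + d)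
    interchange = solve-∀

  ∑-*ˡ : ∀ (xs : List X) c f → ∑[ x ∈ xs ] (c * f x) ≡ c * ∑ xs f
  ∑-*ˡ []       c f = sym (*-zeroʳ c)
  ∑-*ˡ (x ∷ xs) c f rewrite ∑-*ˡ xs c f = sym (*-distribˡ-+ c (f x) (∑ xs f))

  ∑-*ʳ : ∀ (xs : List X) f c → ∑[ x ∈ xs ] (f x * c) ≡ ∑ xs f * c
  ∑-*ʳ []       f c = refl
  ∑-*ʳ (x ∷ xs) f c rewrite ∑-*ʳ xs f c = sym (*-distribʳ-+ c (f x) (∑ xs f))

  ∑-const : ∀ (xs : List X) c → ∑[ x ∈ xs ] c ≡ length xs * c
  ∑-const []       c = refl
  ∑-const (x ∷ xs) c = cong (c +_) (∑-const xs c)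

  ∑-1 : ∀ (xs : List X) → ∑[ x ∈ xs ] 1 ≡ length xs
  ∑-1 xs = trans (∑-const xs 1) (*-identityʳ _)

  ∑-0 : ∀ (xs : List X) → ∑[ x ∈ xs ] 0 ≡ 0
  ∑-0 xs = trans (∑-const xs 0) (*-zeroʳ (length xs))

  ∑-comm : ∀ (xs : List X) (ys : List Y) (f : X → Y → ℕ) →
           ∑[ x ∈ xs ] ∑[ y ∈ ys ] f x y ≡ ∑[ y ∈ ys ] ∑[ x ∈ xs ] f x y
  ∑-comm []       ys f = sym (∑-0 ys)
  ∑-comm (x ∷ xs) ys f rewrite ∑-comm xs ys f = sym (∑-+ ys (f x) (λ y → ∑[ x ∈ xs ] f x y))

  ∑-++ : ∀ (xs ys : List X) f → ∑ (xs ++ ys) f ≡ ∑ xs f + ∑ ys f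
  ∑-++ []       ys f = refl
  ∑-++ (x ∷ xs) ys f rewrite ∑-++ xs ys f = sym (+-assoc (f x) (∑ xs f) (∑ ys f))

  ∑-map : ∀ (g : X → Y) (xs : List X) f → ∑ (map g xs) f ≡ ∑ xs (f ∘ g)
  ∑-map g []       f = refl
  ∑-map g (x ∷ xs) f = cong (f (g x) +_) (∑-map g xs f)

  ∑-concatMap : ∀ (g : X → List Y) (xs : List X) f →
                ∑ (concatMap g xs) f ≡ ∑[ x ∈ xs ] ∑ (g x) f
  ∑-concatMap g []       f = refl
  ∑-concatMap g (x ∷ xs) f
    rewrite ∑-++ (g x) (concatMap g xs) f = cong (∑ (g x) f +_) (∑-concatMap g xs f)

  ∑-cartesianProduct : ∀ (xs : List X) (ys : List Y) f →
                       ∑ (cartesianProduct xs ys) f ≡ ∑[ x ∈ xs ] ∑[ y ∈ ys ] f (x , y)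
  ∑-cartesianProduct []       ys f = refl
  ∑-cartesianProduct (x ∷ xs) ys f = trans (∑-++ (map (x ,_) ys) (cartesianProduct xs ys) f)
    (cong₂ _+_ (∑-map (x ,_) ys f) (∑-cartesianProduct xs ys f))

  ∑-filter : ∀ (p : X → Bool) xs f → ∑ (filterᵇ p xs) f ≡ ∑[ x ∈ xs ] (𝟙 (p x) * f x)
  ∑-filter p []       f = refl
  ∑-filter p (x ∷ xs) f with p x
  ... | true  = cong₂ _+_ (sym (+-identityʳ (f x))) (∑-filter p xs f)
  ... | false = ∑-filter p xs f

  f≤∑f : ∀ {xs : List X} f {x} → x ∈ xs → f x ≤ ∑ xs f
  f≤∑f f (here refl) = m≤m+n _ _
  f≤∑f f (there x∈)  = ≤-trans (f≤∑f f x∈) (m≤n+m _ _)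

  ∑-bound : ∀ (xs : List X) {f c} → (∀ {x} → x ∈ xs → f x ≤ c) → ∑ xs f ≤ length xs * c
  ∑-bound xs f≤c = ≤-trans (∑-mono xs f≤c) (≤-reflexive (∑-const xs _))

  count : List X → (X → Bool) → ℕ
  count xs p = ∑ xs (𝟙 ∘ p)

  count-not : ∀ (xs : List X) p → count xs p + count xs (not ∘ p) ≡ length xs
  count-not xs p = trans (sym (∑-+ xs (𝟙 ∘ p) (𝟙 ∘ not ∘ p)))
                         (trans (∑-cong xs (λ {x} _ → 𝟙-not (p x))) (∑-1 xs))

  count≤length : ∀ (xs : List X) p → count xs p ≤ length xs
  count≤length xs p = ≤-trans (m≤m+n _ _) (≤-reflexive (count-not xs p))

  length-filter : ∀ (p : X → Bool) xs → length (filterᵇ p xs) ≡ count xs p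
  length-filter p xs = trans (sym (∑-1 (filterᵇ p xs)))
    (trans (∑-filter p xs (λ _ → 1)) (∑-cong xs (λ _ → *-identityʳ _)))

  ∈-filter : ∀ (p : X → Bool) xs {x} → x ∈ filterᵇ p xs → x ∈ xs × p x ≡ true
  ∈-filter p (y ∷ xs) x∈ with p y in eq
  ∈-filter p (y ∷ xs) (here refl) | true = here refl , eq
  ∈-filter p (y ∷ xs) (there x∈)  | true with ∈-filter p xs x∈
  ... | x∈xs , px = there x∈xs , px
  ∈-filter p (y ∷ xs) x∈ | false with ∈-filter p xs x∈
  ... | x∈xs , px = there x∈xs , px

  majority : ∀ (xs : List X) p → length xs ≤ 2 * count xs p ⊎ length xs ≤ 2 * count xs (not ∘ p)
  majority xs p with ≤-total (count xs p) (count xs (not ∘ p))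
  ... | inj₁ h = inj₂ (subst (_≤ 2 * count xs (not ∘ p)) (count-not xs p)
                   (+-mono-≤ h (≤-reflexive (sym (+-identityʳ _)))))
  ... | inj₂ h = inj₁ (subst (_≤ 2 * count xs p) (count-not xs p)
                   (+-monoʳ-≤ (count xs p) (≤-trans h (≤-reflexive (sym (+-identityʳ _))))))

  any-intro : ∀ (p : X → Bool) {xs x} → x ∈ xs → p x ≡ true → any p xs ≡ true
  any-intro p (here refl) px rewrite px = refl
  any-intro p {y ∷ _} (there x∈) px with p y
  ... | true  = refl
  ... | false = any-intro p x∈ px

  any-elim : ∀ (p : X → Bool) xs → any p xs ≡ true → ∃[ x ] (x ∈ xs × p x ≡ true)
  any-elim p (x ∷ xs) h with p x in eq
  ... | true  = x , here refl , eq
  ... | false with any-elim p xs h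
  ...   | y , y∈ , py = y , there y∈ , py

  any-map : ∀ (p : Y → Bool) (f : X → Y) xs → any p (map f xs) ≡ any (p ∘ f) xs
  any-map p f []       = refl
  any-map p f (x ∷ xs) = cong (p (f x) ∨_) (any-map p f xs)

  𝟙-any-∧ : ∀ (p : X → Bool) b xs → 𝟙 (any p xs ∧ b) ≤ ∑[ x ∈ xs ] 𝟙 (p x ∧ b)
  𝟙-any-∧ p b []       = z≤n
  𝟙-any-∧ p b (x ∷ xs) with p x | 𝟙-any-∧ p b xs
  ... | true  | _  = m≤m+n (𝟙 b) _
  ... | false | ih = ih

  ∑-pigeonhole : ∀ (ys : List Y) {f c} → 0 < length ys → length ys * c ≤ ∑ ys f →
                 ∃[ y ] (y ∈ ys × c ≤ f y)
  ∑-pigeonhole (y ∷ ys) {f} {c} _ h with c ≤? f y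
  ... | yes c≤ = y , here refl , c≤

  ∑-pigeonhole (y ∷ []) {f} {c} _ h | no c≰ = ⊥-elim (c≰ (subst₂ _≤_ (+-identityʳ c) (+-identityʳ (f y)) h))
  ∑-pigeonhole (y ∷ y′ ∷ ys) {f} {c} _ h | no c≰
    with ∑-pigeonhole (y′ ∷ ys) {f} {c} (s≤s z≤n)
           (+-cancelˡ-≤ (f y) _ _ (≤-trans (+-monoˡ-≤ _ (<⇒≤ (≰⇒> c≰))) h))
  ... | z , z∈ , c≤ = z , there z∈ , c≤

  -- Choosing selectors greedily keeps (k + i) · uncovered ≤ k · total after i steps.
  greedy-cover : ∀ (H : X → Y → Bool) k xs ys → 0 < k → 0 < length ys →
          (∀ {x} → x ∈ xs → length ys ≤ k * count ys (H x)) →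
          ∃[ sel ] (length sel ≡ k × (∀ {y} → y ∈ sel → y ∈ ys) ×
                    length xs ≤ 2 * count xs (λ x → any (H x) sel))
  greedy-cover {X} {Y} H k xs ys 0<k 0<ys hits = half (go k)
    where
    covered uncovered : List Y → ℕ
    covered   sel = count xs (λ x → any (H x) sel)
    uncovered sel = count xs (λ x → not (any (H x) sel))

    new : List Y → Y → ℕ
    new sel y = ∑[ x ∈ xs ] (𝟙 (not (any (H x) sel)) * 𝟙 (H x y))

    uncovered-∷ : ∀ y sel → uncovered (y ∷ sel) + new sel y ≡ uncovered sel
    uncovered-∷ y sel = trans (sym (∑-+ xs _ _))
      (∑-cong xs λ {x} _ → split (H x y) (any (H x) sel))
      where
      split : ∀ h a → 𝟙 (not (h ∨ a)) + 𝟙 (not a) * 𝟙 h ≡ 𝟙 (not a)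
      split true  true  = refl
      split true  false = refl
      split false true  = refl
      split false false = refl

    -- Double counting: each uncovered x is hit by at least a 1/k fraction of `ys`, so an average y
    -- covers a 1/k fraction of what is uncovered.
    new-large : ∀ sel → length ys * uncovered sel ≤ ∑[ y ∈ ys ] (k * new sel y)
    new-large sel = begin
      length ys * uncovered sel
        ≡⟨ *-comm (length ys) _ ⟩
      uncovered sel * length ys
        ≡⟨ ∑-*ʳ xs _ _ ⟨
      ∑[ x ∈ xs ] (𝟙 (not (any (H x) sel)) * length ys)
        ≤⟨ ∑-mono xs (λ {x} x∈ → *-monoʳ-≤ (𝟙 (not (any (H x) sel))) (hits x∈)) ⟩
      ∑[ x ∈ xs ] (𝟙 (not (any (H x) sel)) * (k * count ys (H x)))
        ≡⟨ ∑-cong xs (λ {x} _ → exchange (𝟙 (not (any (H x) sel))) k (count ys (H x))) ⟩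
      ∑[ x ∈ xs ] (k * (𝟙 (not (any (H x) sel)) * count ys (H x)))
        ≡⟨ ∑-*ˡ xs k _ ⟩
      k * ∑[ x ∈ xs ] (𝟙 (not (any (H x) sel)) * count ys (H x))
        ≡⟨ cong (k *_) (∑-cong xs λ {x} _ → sym (∑-*ˡ ys (𝟙 (not (any (H x) sel))) (𝟙 ∘ H x))) ⟩
      k * ∑[ x ∈ xs ] ∑[ y ∈ ys ] (𝟙 (not (any (H x) sel)) * 𝟙 (H x y))
        ≡⟨ cong (k *_) (∑-comm xs ys _) ⟩
      k * ∑[ y ∈ ys ] new sel y
        ≡⟨ ∑-*ˡ ys k _ ⟨
      ∑[ y ∈ ys ] (k * new sel y) ∎
      where
      open ≤-Reasoning
      exchange : ∀ a b c → a * (b * c) ≡ b * (a * c)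
      exchange = solve-∀

    Progress : ℕ → Set
    Progress i = ∃[ sel ] (length sel ≡ i × (∀ {y} → y ∈ sel → y ∈ ys) ×
                           (k + i) * uncovered sel ≤ k * length xs)

    go : ∀ i → Progress i
    go zero = [] , refl , (λ ()) , ≤-reflexive (cong₂ _*_ (+-identityʳ k) (∑-1 xs))
    go (suc i) with go i
    ... | sel , len , sel⊆ys , few with ∑-pigeonhole ys 0<ys (new-large sel)
    ...   | y , y∈ys , large = y ∷ sel , cong suc len , sel⊆ , ≤-trans fewer few
      where
      sel⊆ : ∀ {z} → z ∈ y ∷ sel → z ∈ ys
      sel⊆ (here refl) = y∈ys
      sel⊆ (there z∈)  = sel⊆ys z∈

      decrease : ∀ k i c′ c h → c′ + h ≡ c → c ≤ k * h → (k + suc i) * c′ ≤ (k + i) * c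
      decrease k i c′ c h refl c≤kh = ≤-linear (h + i * h) c≤kh (identity k i c′ h)
        where
        identity : ∀ k i c′ h → (k + suc i) * c′ + k * h + (h + i * h) ≡ (k + i) * (c′ + h) + (c′ + h)
        identity = solve-∀

      fewer : (k + suc i) * uncovered (y ∷ sel) ≤ (k + i) * uncovered sel
      fewer = decrease k i (uncovered (y ∷ sel)) (uncovered sel) _ (uncovered-∷ y sel) large

    half : Progress k → ∃[ sel ] (length sel ≡ k × (∀ {y} → y ∈ sel → y ∈ ys) ×
                                  length xs ≤ 2 * covered sel)
    half (sel , len , sel⊆ , few) = sel , len , sel⊆ ,
      ≤-linear 0 2uncovered≤ (identity (length xs) (uncovered sel) (covered sel) (count-not xs _))
      where
      instance _ = >-nonZero 0<k
      double : ∀ k u → k * (2 * u) ≡ (k + k) * u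
      double = solve-∀
      -- At i = k the invariant reads 2k · uncovered ≤ k · total.
      2uncovered≤ : 2 * uncovered sel ≤ length xs
      2uncovered≤ = *-cancelˡ-≤ k (≤-trans (≤-reflexive (double k (uncovered sel))) few)
      identity : ∀ n u c → c + u ≡ n → n + n + 0 ≡ 2 * c + 2 * u
      identity _ u c refl = identity′ c u
        where
        identity′ : ∀ c u → c + u + (c + u) + 0 ≡ 2 * c + 2 * u
        identity′ = solve-∀

  -- Unions of rectangles and shattered pairs.

  Rectangles : Set → Set → Set
  Rectangles X Y = List ((X → Bool) × (Y → Bool))

  ⋃ : Rectangles X Y → X → Y → Bool
  ⋃ rs x y = any (λ r → proj₁ r x ∧ proj₂ r y) rs

  ⋃-intro : ∀ {I : Set} (S : I → X → Bool) (T : I → Y → Bool) {is i} {x y} → i ∈ is →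
            S i x ≡ true → T i y ≡ true → ⋃ (map (λ i → S i , T i) is) x y ≡ true
  ⋃-intro S T {is} {i} {x} {y} i∈ sx ty =
    trans (any-map _ _ is) (any-intro (λ i → S i x ∧ T i y) i∈ (cong₂ _∧_ sx ty))

  edges : (X → Y → Bool) → List X → List Y → ℕ
  edges E xs ys = ∑[ x ∈ xs ] ∑[ y ∈ ys ] 𝟙 (E x y)

  edges≤ : ∀ (E : X → Y → Bool) xs ys → edges E xs ys ≤ length xs * length ys
  edges≤ E xs ys = ∑-bound xs λ {x} _ → count≤length ys (E x)

  -- A union of few rectangles covers a constant fraction of xs × ys, but E is
  -- much sparser on it than on xs × ys.
  record Shatter (E : X → Y → Bool) (xs : List X) (ys : List Y) (k : ℕ) : Set where
    field
      rects  : Rectangles X Y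
      few    : length rects ≤ k
      large  : length xs * length ys ≤ 8 * edges (⋃ rects) xs ys
      sparse : 32 * edges (λ x y → ⋃ rects x y ∧ E x y) xs ys ≤ edges E xs ys

  edges-⋃≤ : ∀ {I : Set} (S : I → X → Bool) (T : I → Y → Bool) (E : X → Y → Bool) is xs ys →
    edges (λ x y → ⋃ (map (λ i → S i , T i) is) x y ∧ E x y) xs ys
      ≤ ∑[ i ∈ is ] edges (λ x y → (S i x ∧ T i y) ∧ E x y) xs ys
  edges-⋃≤ S T E is xs ys = begin
    edges (λ x y → ⋃ (map (λ i → S i , T i) is) x y ∧ E x y) xs ys
      ≤⟨ ∑-mono₂ xs ys (λ {x} {y} _ _ → subst (λ b → 𝟙 (b ∧ E x y) ≤ _) (sym (any-map _ _ is)) (𝟙-any-∧ _ _ is)) ⟩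
    ∑[ x ∈ xs ] ∑[ y ∈ ys ] ∑[ i ∈ is ] 𝟙 ((S i x ∧ T i y) ∧ E x y)
      ≡⟨ ∑-cong xs (λ _ → ∑-comm ys is _) ⟩
    ∑[ x ∈ xs ] ∑[ i ∈ is ] ∑[ y ∈ ys ] 𝟙 ((S i x ∧ T i y) ∧ E x y)
      ≡⟨ ∑-comm xs is _ ⟩
    ∑[ i ∈ is ] edges (λ x y → (S i x ∧ T i y) ∧ E x y) xs ys ∎
    where open ≤-Reasoning

  -- Few triangles force a shattered pair.

  triangles : (X → Y → Bool) → (Y → Z → Bool) → (X → Z → Bool) → List X → List Y → List Z → ℕ
  triangles P Q R as bs cs =
    ∑[ x ∈ as ] ∑[ y ∈ bs ] ∑[ z ∈ cs ] 𝟙 ((P x y ∧ R x z) ∧ Q y z)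

  -- With `c` rectangles, sparseness is first obtained relative to the area `n`; density at least 1
  -- / m turns it into sparseness relative to the edges. This is where the factor `m` in the
  -- constants is spent.
  sparse-scale : ∀ m c k e E n .{{_ : NonZero m}} .{{_ : NonZero c}} →
    k * m * c * e ≤ c * n → n ≤ m * E → k * e ≤ E
  sparse-scale m c k e E n h n≤ = *-cancelˡ-≤ m (*-cancelˡ-≤ c (begin
    c * (m * (k * e)) ≡⟨ eq m c k e ⟩
    k * m * c * e     ≤⟨ h ⟩
    c * n             ≤⟨ *-monoʳ-≤ c n≤ ⟩
    c * (m * E)       ∎))
    where
    open ≤-Reasoning
    eq : ∀ m c k e → c * (m * (k * e)) ≡ k * m * c * e
    eq = solve-∀

  -- For pairs of density at least 1 / m: k₁ selectors suffice in the first cover,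
  -- codegrees are large from 1 / k₂ of a part on, and links are small up to the
  -- density 1 / k₃.
  module Constants (m : ℕ) where

    k₁ k₂ k₃ : ℕ
    k₁ = 32 * m
    k₂ = 32 * m * k₁
    k₃ = 64 * m * k₂

  -- If half of the z are isolated, i.e. unlinked from at least half of bs, then either
  -- half of the x have many isolated neighbours, and the products of the neighbourhood of
  -- z with the y unlinked from z shatter P, or R is sparse on (other x) × (isolated
  -- z).  Otherwise a quarter of the pairs (y , z) are heavy, and the links of a few good x,
  -- which contain almost no edges of Q, cover half of them.
  module Triple
    {X Y Z : Set} (P : X → Y → Bool) (Q : Y → Z → Bool) (R : X → Z → Bool)
    (m : ℕ) (as : List X) (bs : List Y) (cs : List Z) where

    open Constants m

    a b c : ℕ
    a  = length as
    b  = length bs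
    c  = length cs

    codegree : Y → Z → ℕ
    codegree y z = count as (λ x → P x y ∧ R x z)

    link : X → ℕ
    link x = ∑[ y ∈ bs ] ∑[ z ∈ cs ] 𝟙 ((P x y ∧ R x z) ∧ Q y z)

    heavy : Y → Z → Bool
    heavy y z = a ≤ᵇ k₂ * codegree y z

    unlinked : Z → Y → Bool
    unlinked z y = not (heavy y z)

    isolated : Z → Bool
    isolated z = b ≤ᵇ 2 * count bs (unlinked z)

    degree : X → ℕ
    degree x = ∑[ z ∈ cs ] 𝟙 (isolated z ∧ R x z)

    rich : X → Bool
    rich x = c ≤ᵇ k₁ * degree x

    module _ .{{_ : NonZero m}} (0<a : 0 < a) (0<b : 0 < b) (0<c : 0 < c) where

      instance
        k₁≢0 : NonZero k₁
        k₁≢0 = m*n≢0 32 m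
        k₂≢0 : NonZero k₂
        k₂≢0 = m*n≢0 (32 * m) k₁ {{m*n≢0 32 m}}

      shatter-R : a * c ≤ m * edges R as cs → c ≤ 2 * count cs isolated →
                  a ≤ 2 * count as (not ∘ rich) → Shatter R as cs 1
      shatter-R dense c≤ a≤ = record
        { rects  = (not ∘ rich , isolated) ∷ []
        ; few    = ≤-refl
        ; large  = large
        ; sparse = sparse-scale m 1 32 _ _ (a * c) sparse′ dense
        }
        where
        open ≤-Reasoning
        S = not ∘ rich
        large : a * c ≤ 8 * edges (⋃ ((S , isolated) ∷ [])) as cs
        large = begin
          a * c                                        ≤⟨ *-mono-≤ a≤ c≤ ⟩
          2 * count as S * (2 * count cs isolated)     ≡⟨ four (count as S) _ ⟩
          4 * (count as S * count cs isolated)         ≤⟨ *-monoˡ-≤ (count as S * count cs isolated) {4} {8} (≤ᵇ⇒≤ 4 8 _) ⟩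
          8 * (count as S * count cs isolated)         ≡⟨ cong (8 *_) (∑-*ʳ as _ _) ⟨
          8 * ∑[ x ∈ as ] (𝟙 (S x) * count cs isolated)
            ≡⟨ cong (8 *_) (∑-cong as λ {x} _ → sym (∑-*ˡ cs (𝟙 (S x)) (𝟙 ∘ isolated))) ⟩
          8 * ∑[ x ∈ as ] ∑[ z ∈ cs ] (𝟙 (S x) * 𝟙 (isolated z))
            ≡⟨ cong (8 *_) (∑-cong₂ as cs λ {x} {z} _ _ → single (S x) (isolated z)) ⟩
          8 * edges (⋃ ((S , isolated) ∷ [])) as cs    ∎
          where
          four : ∀ x y → 2 * x * (2 * y) ≡ 4 * (x * y)
          four = solve-∀
          single : ∀ s t → 𝟙 s * 𝟙 t ≡ 𝟙 ((s ∧ t) ∨ false)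
          single true  true  = refl
          single true  false = refl
          single false t     = refl
        e = edges (λ x z → ⋃ ((S , isolated) ∷ []) x z ∧ R x z) as cs
        e≡ : e ≡ ∑[ x ∈ as ] (𝟙 (S x) * degree x)
        e≡ = trans (∑-cong₂ as cs λ {x} {z} _ _ → single (S x) (isolated z) (R x z))
                   (∑-cong as λ {x} _ → ∑-*ˡ cs (𝟙 (S x)) (λ z → 𝟙 (isolated z ∧ R x z)))
          where
          single : ∀ s t r → 𝟙 (((s ∧ t) ∨ false) ∧ r) ≡ 𝟙 s * 𝟙 (t ∧ r)
          single true  true  true  = refl
          single true  true  false = refl
          single true  false r     = refl
          single false t     r     = refl
        -- An x that is not rich has fewer than c / k₁ isolated neighbours, and k₁ = 32 m.
        sparse′ : 32 * m * 1 * e ≤ 1 * (a * c)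
        sparse′ = begin
          32 * m * 1 * e                             ≡⟨ cong₂ _*_ (*-identityʳ k₁) e≡ ⟩
          k₁ * ∑[ x ∈ as ] (𝟙 (S x) * degree x)      ≡⟨ ∑-*ˡ as k₁ _ ⟨
          ∑[ x ∈ as ] (k₁ * (𝟙 (S x) * degree x))
            ≡⟨ ∑-cong as (λ {x} _ → exchange k₁ (𝟙 (S x)) (degree x)) ⟩
          ∑[ x ∈ as ] (𝟙 (S x) * (k₁ * degree x))
            ≤⟨ ∑-bound as (λ {x} _ → 𝟙*≤ (S x) (λ sx → <⇒≤ (≤ᵇ-false (not-true sx)))) ⟩
          a * c                                      ≡⟨ *-identityˡ _ ⟨
          1 * (a * c) ∎
          where
          exchange : ∀ a b c → a * (b * c) ≡ b * (a * c)
          exchange = solve-∀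

      shatter-P : a * b ≤ m * edges P as bs → c ≤ 2 * count cs isolated →
                  a ≤ 2 * count as rich → Shatter P as bs k₁
      shatter-P dense c≤ a≤ = record
        { rects  = map rect sel
        ; few    = ≤-reflexive (trans (length-map rect sel) len)
        ; large  = large
        ; sparse = sparse-scale m k₁ 32 _ _ (a * b) sparse′ dense
        }
        where
        open ≤-Reasoning
        xs = filterᵇ rich as
        ys = filterᵇ isolated cs
        N : Z → X → Bool
        N z x = R x z
        rect : Z → (X → Bool) × (Y → Bool)
        rect z = N z , unlinked z

        0<ys : 0 < length ys
        0<ys = subst (0 <_) (sym (length-filter isolated cs))
          (*-cancelˡ-< 2 0 _ (<-≤-trans 0<c c≤))

        -- `degree x` counts only isolated neighbours, so the hits within `ys` already reach c / k₁,
        -- and `ys` has at most c members.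
        hits : ∀ {x} → x ∈ xs → length ys ≤ k₁ * count ys (R x)
        hits {x} x∈ = begin
          length ys              ≡⟨ length-filter isolated cs ⟩
          count cs isolated      ≤⟨ count≤length cs isolated ⟩
          c                      ≤⟨ ≤ᵇ-true (proj₂ (∈-filter rich as x∈)) ⟩
          k₁ * degree x          ≡⟨ cong (k₁ *_) (∑-cong cs λ _ → 𝟙-∧ (isolated _) _) ⟩
          k₁ * ∑[ z ∈ cs ] (𝟙 (isolated z) * 𝟙 (R x z))
                                 ≡⟨ cong (k₁ *_) (∑-filter isolated cs _) ⟨
          k₁ * count ys (R x)    ∎

        selection = greedy-cover R k₁ xs ys (>-nonZero⁻¹ k₁) 0<ys hits
        sel = proj₁ selection
        len = proj₁ (proj₂ selection)
        sel⊆ : ∀ {z} → z ∈ sel → z ∈ ys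
        sel⊆ = proj₁ (proj₂ (proj₂ selection))
        covers : length xs ≤ 2 * count xs (λ x → any (R x) sel)
        covers = proj₂ (proj₂ (proj₂ selection))

        row : ∀ x → 𝟙 (any (R x) sel) * b ≤ 2 * count bs (⋃ (map rect sel) x)
        row x = 𝟙*≤ (any (R x) sel) λ covered → let (z , z∈ , rxz) = any-elim (R x) sel covered in begin
          b                            ≤⟨ ≤ᵇ-true (proj₂ (∈-filter isolated cs (sel⊆ z∈))) ⟩
          2 * count bs (unlinked z)    ≤⟨ *-monoʳ-≤ 2 (∑-mono bs λ {y} _ → 𝟙-mono (⋃-intro N unlinked z∈ rxz)) ⟩
          2 * count bs (⋃ (map rect sel) x) ∎

        -- The factor 8 is 2 · 2 · 2: half of `as` is rich, half of the rich x are covered, and a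
        -- covered x has half of its row in the rectangle of a single isolated z.
        large : a * b ≤ 8 * edges (⋃ (map rect sel)) as bs
        large = begin
          a * b                                      ≤⟨ *-monoˡ-≤ b a≤ ⟩
          2 * count as rich * b                      ≡⟨ cong (λ n → 2 * n * b) (length-filter rich as) ⟨
          2 * length xs * b                          ≤⟨ *-monoˡ-≤ b (*-monoʳ-≤ 2 covers) ⟩
          2 * (2 * count xs covered) * b             ≤⟨ *-monoˡ-≤ b (*-monoʳ-≤ 2 (*-monoʳ-≤ 2 xs≤as)) ⟩
          2 * (2 * count as covered) * b             ≡⟨ four (count as covered) b ⟩
          4 * (count as covered * b)                 ≡⟨ cong (4 *_) (∑-*ʳ as _ _) ⟨
          4 * ∑[ x ∈ as ] (𝟙 (covered x) * b)        ≤⟨ *-monoʳ-≤ 4 (∑-mono as λ {x} _ → row x) ⟩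
          4 * ∑[ x ∈ as ] (2 * count bs (⋃ (map rect sel) x))
                                                     ≡⟨ cong (4 *_) (∑-*ˡ as 2 _) ⟩
          4 * (2 * edges (⋃ (map rect sel)) as bs)   ≡⟨ *-assoc 4 2 (edges (⋃ (map rect sel)) as bs) ⟨
          8 * edges (⋃ (map rect sel)) as bs         ∎
          where
          covered : X → Bool
          covered x = any (R x) sel
          xs≤as : count xs covered ≤ count as covered
          xs≤as = ≤-trans (≤-reflexive (∑-filter rich as _))
            (∑-mono as λ {x} _ → 𝟙*≤ (rich x) λ _ → ≤-refl)
          four : ∀ x y → 2 * (2 * x) * y ≡ 4 * (x * y)
          four = solve-∀

        e = edges (λ x y → ⋃ (map rect sel) x y ∧ P x y) as bs
        -- The edges of `P` between the neighbours of z and the y unlinked from z are counted by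
        -- codegrees, each below a / k₂ because these pairs are not heavy. The union over k₁
        -- rectangles costs a factor k₁, which k₂ = 32 m k₁ absorbs.
        column : ∀ z → k₂ * edges (λ x y → (N z x ∧ unlinked z y) ∧ P x y) as bs ≤ b * a
        column z = begin
          k₂ * edges (λ x y → (N z x ∧ unlinked z y) ∧ P x y) as bs
            ≡⟨ cong (k₂ *_) (∑-comm as bs _) ⟩
          k₂ * ∑[ y ∈ bs ] ∑[ x ∈ as ] 𝟙 ((N z x ∧ unlinked z y) ∧ P x y)
            ≡⟨ cong (k₂ *_) (∑-cong bs λ {y} _ → trans (∑-cong as λ {x} _ → reorder (R x z) (unlinked z y) (P x y)) (∑-*ˡ as (𝟙 (unlinked z y)) (λ x → 𝟙 (P x y ∧ R x z)))) ⟩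
          k₂ * ∑[ y ∈ bs ] (𝟙 (unlinked z y) * codegree y z)
            ≡⟨ ∑-*ˡ bs k₂ _ ⟨
          ∑[ y ∈ bs ] (k₂ * (𝟙 (unlinked z y) * codegree y z))
            ≡⟨ ∑-cong bs (λ {y} _ → exchange k₂ (𝟙 (unlinked z y)) (codegree y z)) ⟩
          ∑[ y ∈ bs ] (𝟙 (unlinked z y) * (k₂ * codegree y z))
            ≤⟨ ∑-bound bs (λ {y} _ → 𝟙*≤ (unlinked z y) λ u → <⇒≤ (≤ᵇ-false (not-true u))) ⟩
          b * a ∎
          where
          exchange : ∀ a b c → a * (b * c) ≡ b * (a * c)
          exchange = solve-∀
          reorder : ∀ r u p → 𝟙 ((r ∧ u) ∧ p) ≡ 𝟙 u * 𝟙 (p ∧ r)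
          reorder true  true  true  = refl
          reorder true  true  false = refl
          reorder true  false p     = refl
          reorder false true  true  = refl
          reorder false true  false = refl
          reorder false false p     = refl
        sparse′ : 32 * m * k₁ * e ≤ k₁ * (a * b)
        sparse′ = begin
          k₂ * e               ≤⟨ *-monoʳ-≤ k₂ (edges-⋃≤ N unlinked P sel as bs) ⟩
          k₂ * ∑[ z ∈ sel ] edges (λ x y → (N z x ∧ unlinked z y) ∧ P x y) as bs
                               ≡⟨ ∑-*ˡ sel k₂ _ ⟨
          ∑[ z ∈ sel ] (k₂ * edges (λ x y → (N z x ∧ unlinked z y) ∧ P x y) as bs)
                               ≤⟨ ∑-bound sel (λ {z} _ → column z) ⟩
          length sel * (b * a) ≡⟨ cong₂ _*_ len (*-comm b a) ⟩
          k₁ * (a * b)         ∎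

      shatter-Q : b * c ≤ m * edges Q bs cs → 2 * k₂ * k₃ * triangles P Q R as bs cs ≤ a * (b * c) →
                  c ≤ 2 * count cs (not ∘ isolated) → Shatter Q bs cs (2 * k₂)
      shatter-Q dense few c≤ = record
        { rects  = map rect sel
        ; few    = ≤-reflexive (trans (length-map rect sel) len)
        ; large  = large
        ; sparse = sparse-scale m (2 * k₂) 32 _ _ (b * c) sparse′ dense
        }
        where
        open ≤-Reasoning
        t = triangles P Q R as bs cs
        instance
          bc≢0 : NonZero (b * c)
          bc≢0 = m*n≢0 b c {{>-nonZero 0<b}} {{>-nonZero 0<c}}
          2k₂≢0 : NonZero (2 * k₂)
          2k₂≢0 = m*n≢0 2 k₂
        good : X → Bool
        good x = k₃ * link x ≤ᵇ b * c
        bad = count as (not ∘ good)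
        -- Markov's inequality: the links of all x sum to the number of triangles.
        bad-few : 2 * k₂ * bad ≤ a
        bad-few = *-cancelʳ-≤ _ _ (b * c) (begin
          2 * k₂ * bad * (b * c)      ≡⟨ *-assoc (2 * k₂) bad (b * c) ⟩
          2 * k₂ * (bad * (b * c))    ≡⟨ cong (2 * k₂ *_) (∑-*ʳ as _ _) ⟨
          2 * k₂ * ∑[ x ∈ as ] (𝟙 (not (good x)) * (b * c))
            ≤⟨ *-monoʳ-≤ (2 * k₂) (∑-mono as λ {x} _ → 𝟙*≤ (not (good x)) λ g → <⇒≤ (≤ᵇ-false (not-true g))) ⟩
          2 * k₂ * ∑[ x ∈ as ] (k₃ * link x) ≡⟨ cong (2 * k₂ *_) (∑-*ˡ as k₃ link) ⟩
          2 * k₂ * (k₃ * t)           ≡⟨ *-assoc (2 * k₂) k₃ t ⟨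
          2 * k₂ * k₃ * t             ≤⟨ few ⟩
          a * (b * c)                 ∎)

        ps = cartesianProduct bs cs
        hv : Y × Z → Bool
        hv = uncurry heavy
        xs = filterᵇ hv ps
        ys = filterᵇ good as
        H : Y × Z → X → Bool
        H (y , z) x = P x y ∧ R x z
        rect : X → (Y → Bool) × (Z → Bool)
        rect x = P x , R x

        0<ys : 0 < length ys
        0<ys = subst (0 <_) (sym (length-filter good as)) (positive _ (count-not as good))
          where
          bad<a : bad < a
          bad<a = *-cancelˡ-< 2 _ _ (begin-strict
            2 * bad        ≡⟨ *-identityʳ _ ⟨
            2 * bad * 1    ≤⟨ *-monoʳ-≤ (2 * bad) (>-nonZero⁻¹ k₂) ⟩
            2 * bad * k₂   ≡⟨ swap bad k₂ ⟩
            2 * k₂ * bad   ≤⟨ bad-few ⟩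
            a              <⟨ m<m+n a (<-≤-trans 0<a (m≤m+n a 0)) ⟩
            2 * a          ∎)
            where
            swap : ∀ x y → 2 * x * y ≡ 2 * y * x
            swap = solve-∀
          positive : ∀ g → g + bad ≡ a → 0 < g
          positive zero    eq = ⊥-elim (<-irrefl eq bad<a)
          positive (suc g) eq = s≤s z≤n

        -- A heavy pair has at least a / k₂ common neighbours, and at most a / (2 k₂) vertices are
        -- bad; this margin is why 2 k₂ selectors are taken.
        hits : ∀ {p} → p ∈ xs → length ys ≤ 2 * k₂ * count ys (H p)
        hits {y , z} p∈ = begin
          length ys                   ≡⟨ length-filter good as ⟩
          count as good               ≤⟨ count≤length as good ⟩
          a                           ≤⟨ ≤-linear 0 (+-mono-≤ (*-monoʳ-≤ 2 a≤) (+-mono-≤ (*-monoʳ-≤ (2 * k₂) split) bad-few)) (identity a k₂ (codegree y z) gd bad) ⟩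
          2 * k₂ * gd                 ≡⟨ cong (2 * k₂ *_) (∑-filter good as _) ⟨
          2 * k₂ * count ys (H (y , z)) ∎
          where
          gd = ∑[ x ∈ as ] (𝟙 (good x) * 𝟙 (H (y , z) x))
          a≤ : a ≤ k₂ * codegree y z
          a≤ = ≤ᵇ-true (proj₂ (∈-filter hv ps p∈))
          split : codegree y z ≤ gd + bad
          split = ≤-trans (∑-mono as λ {x} _ → pointwise (good x) (H (y , z) x)) (≤-reflexive (∑-+ as _ _))
            where
            pointwise : ∀ g h → 𝟙 h ≤ 𝟙 g * 𝟙 h + 𝟙 (not g)
            pointwise true  h = ≤-trans (m≤m+n (𝟙 h) 0) (m≤m+n _ 0)
            pointwise false h = 𝟙≤1 h
          identity : ∀ a k c g d → a + (2 * (k * c) + (2 * k * (g + d) + a)) + 0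
                     ≡ 2 * k * g + (2 * a + (2 * k * c + 2 * k * d))
          identity = solve-∀

        selection = greedy-cover H (2 * k₂) xs ys (>-nonZero⁻¹ (2 * k₂)) 0<ys hits
        sel = proj₁ selection
        len = proj₁ (proj₂ selection)
        sel⊆ : ∀ {x} → x ∈ sel → x ∈ ys
        sel⊆ = proj₁ (proj₂ (proj₂ selection))
        covers : length xs ≤ 2 * count xs (λ p → any (H p) sel)
        covers = proj₂ (proj₂ (proj₂ selection))

        -- Less than half of the y are unlinked from a z that is not isolated, so at least half form
        -- a heavy pair with it.
        column : ∀ z → 𝟙 (not (isolated z)) * b ≤ 2 * count bs (λ y → heavy y z)
        column z = 𝟙*≤ (not (isolated z)) λ h →
          ≤-linear 0 (<⇒≤ (≤ᵇ-false (not-true h))) (identity (count bs (λ y → heavy y z)) (count bs (unlinked z)) b (count-not bs (λ y → heavy y z)))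
          where
          identity : ∀ h u b → h + u ≡ b → b + b + 0 ≡ 2 * h + 2 * u
          identity h u _ refl = identity′ h u
            where
            identity′ : ∀ h u → h + u + (h + u) + 0 ≡ 2 * h + 2 * u
            identity′ = solve-∀

        cb≤ : c * b ≤ 4 * length xs
        cb≤ = begin
          c * b                                          ≤⟨ *-monoˡ-≤ b c≤ ⟩
          2 * count cs (not ∘ isolated) * b              ≡⟨ *-assoc 2 (count cs (not ∘ isolated)) b ⟩
          2 * (count cs (not ∘ isolated) * b)            ≡⟨ cong (2 *_) (∑-*ʳ cs _ _) ⟨
          2 * ∑[ z ∈ cs ] (𝟙 (not (isolated z)) * b)     ≤⟨ *-monoʳ-≤ 2 (∑-mono cs λ {z} _ → column z) ⟩
          2 * ∑[ z ∈ cs ] (2 * count bs (λ y → heavy y z)) ≡⟨ cong (2 *_) (∑-*ˡ cs 2 _) ⟩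
          2 * (2 * ∑[ z ∈ cs ] count bs (λ y → heavy y z)) ≡⟨ *-assoc 2 2 (∑[ z ∈ cs ] count bs (λ y → heavy y z)) ⟨
          4 * ∑[ z ∈ cs ] count bs (λ y → heavy y z)     ≡⟨ cong (4 *_) (∑-comm bs cs _) ⟨
          4 * ∑[ y ∈ bs ] ∑[ z ∈ cs ] 𝟙 (heavy y z)      ≡⟨ cong (4 *_) (∑-cartesianProduct bs cs _) ⟨
          4 * count ps hv                                ≡⟨ cong (4 *_) (length-filter hv ps) ⟨
          4 * length xs                                  ∎

        large : b * c ≤ 8 * edges (⋃ (map rect sel)) bs cs
        large = begin
          b * c                        ≡⟨ *-comm b c ⟩
          c * b                        ≤⟨ cb≤ ⟩
          4 * length xs                ≤⟨ *-monoʳ-≤ 4 covers ⟩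
          4 * (2 * count xs covered)   ≡⟨ *-assoc 4 2 (count xs covered) ⟨
          8 * count xs covered         ≤⟨ *-monoʳ-≤ 8 (≤-trans (≤-reflexive (∑-filter hv ps _)) (∑-mono ps λ {p} _ → 𝟙*≤ (hv p) λ _ → ≤-refl)) ⟩
          8 * count ps covered         ≡⟨ cong (8 *_) (∑-cartesianProduct bs cs _) ⟩
          8 * ∑[ y ∈ bs ] ∑[ z ∈ cs ] 𝟙 (covered (y , z))
            ≡⟨ cong (8 *_) (∑-cong₂ bs cs λ {y} {z} _ _ → cong 𝟙 (sym (any-map (λ r → proj₁ r y ∧ proj₂ r z) rect sel))) ⟩
          8 * edges (⋃ (map rect sel)) bs cs ∎
          where
          covered : Y × Z → Bool
          covered p = any (H p) sel

        e = edges (λ y z → ⋃ (map rect sel) y z ∧ Q y z) bs cs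
        -- The rectangle of a good x contains exactly `link x` edges of `Q`; k₃ = 32 m · 2 k₂ pays
        -- for the union over 2 k₂ rectangles.
        sparse′ : 32 * m * (2 * k₂) * e ≤ 2 * k₂ * (b * c)
        sparse′ = begin
          32 * m * (2 * k₂) * e           ≡⟨ cong (_* e) (sixtyfour m k₂) ⟩
          k₃ * e                          ≤⟨ *-monoʳ-≤ k₃ (edges-⋃≤ P R Q sel bs cs) ⟩
          k₃ * ∑[ x ∈ sel ] link x        ≡⟨ ∑-*ˡ sel k₃ link ⟨
          ∑[ x ∈ sel ] (k₃ * link x)      ≤⟨ ∑-bound sel (λ {x} x∈ → ≤ᵇ-true (proj₂ (∈-filter good as (sel⊆ x∈)))) ⟩
          length sel * (b * c)            ≡⟨ cong (_* (b * c)) len ⟩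
          2 * k₂ * (b * c)                ∎
          where
          sixtyfour : ∀ m k → 32 * m * (2 * k) ≡ 64 * m * k
          sixtyfour = solve-∀

  -- Partitions generated by families of sets.

  -- Empty cells are kept, so that the number of cells depends only on `Ss`.
  cells : List (V → Bool) → List V → List (List V)
  cells []       xs = xs ∷ []
  cells (S ∷ Ss) xs = cells Ss (filterᵇ S xs) ++ cells Ss (filterᵇ (not ∘ S) xs)

  length-cells : ∀ (Ss : List (V → Bool)) xs → length (cells Ss xs) ≡ 2 ^ length Ss
  length-cells []       xs = refl
  length-cells (S ∷ Ss) xs = trans (length-++ (cells Ss (filterᵇ S xs)))
    (cong₂ _+_ (length-cells Ss _) (trans (length-cells Ss _) (sym (+-identityʳ _))))

  ∑-cells : ∀ (Ss : List (V → Bool)) xs f → ∑[ A ∈ cells Ss xs ] ∑ A f ≡ ∑ xs f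
  ∑-cells []       xs f = +-identityʳ _
  ∑-cells (S ∷ Ss) xs f = begin
    ∑[ A ∈ cells (S ∷ Ss) xs ] ∑ A f
      ≡⟨ ∑-++ (cells Ss (filterᵇ S xs)) _ _ ⟩
    ∑[ A ∈ cells Ss (filterᵇ S xs) ] ∑ A f + ∑[ A ∈ cells Ss (filterᵇ (not ∘ S) xs) ] ∑ A f
      ≡⟨ cong₂ _+_ (∑-cells Ss _ f) (∑-cells Ss _ f) ⟩
    ∑ (filterᵇ S xs) f + ∑ (filterᵇ (not ∘ S) xs) f
      ≡⟨ cong₂ _+_ (∑-filter S xs f) (∑-filter (not ∘ S) xs f) ⟩
    ∑[ x ∈ xs ] (𝟙 (S x) * f x) + ∑[ x ∈ xs ] (𝟙 (not (S x)) * f x)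
      ≡⟨ ∑-+ xs _ _ ⟨
    ∑[ x ∈ xs ] (𝟙 (S x) * f x + 𝟙 (not (S x)) * f x)
      ≡⟨ ∑-cong xs (λ {x} _ → split (S x) (f x)) ⟩
    ∑ xs f ∎
    where
    open ≡-Reasoning
    split : ∀ b n → 𝟙 b * n + 𝟙 (not b) * n ≡ n
    split true  n = trans (+-identityʳ _) (+-identityʳ n)
    split false n = +-identityʳ n

  cells-⊆ : ∀ (Ss : List (V → Bool)) xs {A x} → A ∈ cells Ss xs → x ∈ A → x ∈ xs
  cells-⊆ []       xs (here refl) x∈ = x∈
  cells-⊆ (S ∷ Ss) xs A∈ x∈ with ∈-++⁻ (cells Ss (filterᵇ S xs)) A∈
  ... | inj₁ A∈ˡ = proj₁ (∈-filter S xs (cells-⊆ Ss _ A∈ˡ x∈))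
  ... | inj₂ A∈ʳ = proj₁ (∈-filter (not ∘ S) xs (cells-⊆ Ss _ A∈ʳ x∈))

  cells-constant : ∀ (Ss : List (V → Bool)) xs {S A} → S ∈ Ss → A ∈ cells Ss xs →
                   ∃[ b ] (∀ {x} → x ∈ A → S x ≡ b)
  cells-constant (S ∷ Ss) xs S∈ A∈ with ∈-++⁻ (cells Ss (filterᵇ S xs)) A∈
  cells-constant (S ∷ Ss) xs (here refl) A∈ | inj₁ A∈ˡ = true ,
    λ x∈ → proj₂ (∈-filter S xs (cells-⊆ Ss _ A∈ˡ x∈))
  cells-constant (S ∷ Ss) xs (here refl) A∈ | inj₂ A∈ʳ = false ,
    λ x∈ → not-true (proj₂ (∈-filter (not ∘ S) xs (cells-⊆ Ss _ A∈ʳ x∈)))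
  cells-constant (S ∷ Ss) xs (there S∈) A∈ | inj₁ A∈ˡ = cells-constant Ss _ S∈ A∈ˡ
  cells-constant (S ∷ Ss) xs (there S∈) A∈ | inj₂ A∈ʳ = cells-constant Ss _ S∈ A∈ʳ

  sides : Rectangles V V → List (V → Bool)
  sides = concatMap (λ r → proj₁ r ∷ proj₂ r ∷ [])

  length-sides : ∀ (rs : Rectangles V V) → length (sides rs) ≡ 2 * length rs
  length-sides []       = refl
  length-sides (r ∷ rs) = trans (cong (2 +_) (length-sides rs)) (sym (*-suc 2 (length rs)))

  -- Every pair of cells lies inside the union or outside it, the dichotomy on which the potential
  -- increment rests. Rows and columns are cut by the same `Ss`, so it has to contain both sides of
  -- each rectangle.
  ⋃-constant : ∀ (rs : Rectangles V V) Ss xs ys {A B} → (∀ {S} → S ∈ sides rs → S ∈ Ss) →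
               A ∈ cells Ss xs → B ∈ cells Ss ys →
               ∃[ b ] (∀ {x y} → x ∈ A → y ∈ B → ⋃ rs x y ≡ b)
  ⋃-constant []             Ss xs ys ⊆Ss A∈ B∈ = false , λ _ _ → refl
  ⋃-constant ((S , T) ∷ rs) Ss xs ys ⊆Ss A∈ B∈
    with cells-constant Ss xs (⊆Ss (here refl)) A∈
       | cells-constant Ss ys (⊆Ss (there (here refl))) B∈
       | ⋃-constant rs Ss xs ys (⊆Ss ∘ there ∘ there) A∈ B∈
  ... | s , S≡ | t , T≡ | u , ⋃≡ =
    (s ∧ t) ∨ u , λ x∈ y∈ → cong₂ _∨_ (cong₂ _∧_ (S≡ x∈) (T≡ y∈)) (⋃≡ x∈ y∈)

  -- The potential and its increment.

  -- A scaled, piecewise linear substitute for n · (d log d), where d = e / n is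
  -- the density of a pair: the sum over j ≤ L of 2^(L − j) · max(0, 2^j e − n).
  pot : ℕ → ℕ → ℕ → ℕ
  pot zero    e n = 1 * e ∸ n
  pot (suc L) e n = 2 * pot L e n + (2 ^ suc L * e ∸ n)

  -- Each of the L + 1 scales contributes at most 2^L e.
  pot≤ : ∀ L e n → pot L e n ≤ suc L * (2 ^ L * e)
  pot≤ zero    e n = ≤-trans (m∸n≤m (1 * e) n) (m≤m+n (1 * e) 0)
  pot≤ (suc L) e n = ≤-trans (+-mono-≤ (*-monoʳ-≤ 2 (pot≤ L e n)) (m∸n≤m (2 ^ suc L * e) n))
    (≤-reflexive (identity L (2 ^ L) e))
    where
    identity : ∀ L x e → 2 * (suc L * (x * e)) + 2 * x * e ≡ suc (suc L) * (2 * x * e)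
    identity = solve-∀

  -- The z stand for the pairs of cells inside one pair of parts, `e` and `n` for edges and area,
  -- and the superscript for the portion inside a union U of rectangles.
  module Increment
    {Z : Set} (zs : List Z) (e n eᵁ nᵁ : Z → ℕ)
    (split : ∀ {z} → z ∈ zs → (eᵁ z ≡ e z × nᵁ z ≡ n z) ⊎ (eᵁ z ≡ 0 × nᵁ z ≡ 0)) where

    private
      E N Eᵁ Nᵁ : ℕ
      E  = ∑ zs e
      N  = ∑ zs n
      Eᵁ = ∑ zs eᵁ
      Nᵁ = ∑ zs nᵁ

      Φ : ℕ → ℕ
      Φ x = ∑[ z ∈ zs ] (x * e z ∸ n z)

    -- Φ x is at least the contribution x (E − Eᵁ) − (N − Nᵁ) of the z outside U;
    -- the terms are moved so that no subtraction occurs.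
    scale : ∀ x → x * E + Nᵁ ≤ (Φ x + N) + x * Eᵁ
    scale x = begin
      x * E + Nᵁ                                       ≡⟨ cong (_+ Nᵁ) (∑-*ˡ zs x e) ⟨
      ∑[ z ∈ zs ] (x * e z) + Nᵁ                       ≡⟨ ∑-+ zs (λ z → x * e z) nᵁ ⟨
      ∑[ z ∈ zs ] (x * e z + nᵁ z)                     ≤⟨ ∑-mono zs pointwise ⟩
      ∑[ z ∈ zs ] ((x * e z ∸ n z) + n z + x * eᵁ z)   ≡⟨ ∑-+ zs (λ z → (x * e z ∸ n z) + n z) (λ z → x * eᵁ z) ⟩
      ∑[ z ∈ zs ] ((x * e z ∸ n z) + n z) + ∑[ z ∈ zs ] (x * eᵁ z)
                                                       ≡⟨ cong₂ _+_ (∑-+ zs (λ z → x * e z ∸ n z) n) (∑-*ˡ zs x eᵁ) ⟩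
      (Φ x + N) + x * Eᵁ                               ∎
      where
      open ≤-Reasoning
      pointwise : ∀ {z} → z ∈ zs → x * e z + nᵁ z ≤ (x * e z ∸ n z) + n z + x * eᵁ z
      pointwise {z} z∈ with split z∈
      ... | inj₁ (eq₁ , eq₂) rewrite eq₁ | eq₂ = ≤-trans (≤-reflexive (+-comm (x * e z) (n z)))
              (+-monoˡ-≤ (x * e z) (m≤n+m (n z) (x * e z ∸ n z)))
      ... | inj₂ (eq₁ , eq₂) rewrite eq₁ | eq₂ | *-zeroʳ x | +-identityʳ (x * e z)
                                   | +-identityʳ ((x * e z ∸ n z) + n z) =
              ≤-trans (m≤n+m∸n (x * e z) (n z)) (≤-reflexive (+-comm (n z) _))

    module _ (large : N ≤ 8 * Nᵁ) (sparse : 32 * Eᵁ ≤ E) where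

      -- The cells outside U alone contribute x E - N + Nᵁ - x Eᵁ. Since N ≥ x E / 2, the missing
      -- area Nᵁ ≥ N / 8 is worth at least x E / 16, while the missing edges cost at most x E / 32;
      -- the surplus is x E / 32. This is the origin of the constants 8 and 32 in `Shatter`.
      gain-scale : ∀ x → N ≤ x * E → x * E ≤ 2 * N → 32 * (x * E ∸ N) + x * E ≤ 32 * Φ x
      gain-scale x N≤ ≤2N = ≤-linear 0
        (+-mono-≤ (*-monoʳ-≤ 32 (scale x)) (+-mono-≤ (*-monoʳ-≤ 4 large) (+-mono-≤ sparse′ (*-monoʳ-≤ 2 ≤2N))))
        (identity (x * E) N (x * E ∸ N) (Φ x) (x * Eᵁ) Nᵁ (m∸n+n≡m N≤))
        where
        sparse′ : 32 * (x * Eᵁ) ≤ x * E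
        sparse′ = ≤-trans (≤-reflexive (exchange 32 x Eᵁ)) (*-monoʳ-≤ x sparse)
          where
          exchange : ∀ a b c → a * (b * c) ≡ b * (a * c)
          exchange = solve-∀
        identity : ∀ y n d φ w u → d + n ≡ y →
          32 * d + y + (32 * (φ + n + w) + (4 * (8 * u) + (y + 2 * (2 * n)))) + 0
          ≡ 32 * φ + (32 * (y + u) + (4 * n + (32 * w + 2 * y)))
        identity _ n d φ w u refl = identity′ n d φ w u
          where
          identity′ : ∀ n d φ w u →
            32 * d + (d + n) + (32 * (φ + n + w) + (4 * (8 * u) + ((d + n) + 2 * (2 * n)))) + 0
            ≡ 32 * φ + (32 * ((d + n) + u) + (4 * n + (32 * w + 2 * (d + n))))
          identity′ = solve-∀

  -- The instance of `scale` in which U is empty.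
  ∸-superadditive : ∀ (zs : List Z) (e n : Z → ℕ) x →
                    x * ∑ zs e ∸ ∑ zs n ≤ ∑[ z ∈ zs ] (x * e z ∸ n z)
  ∸-superadditive zs e n x = m≤n+o⇒m∸n≤o (x * ∑ zs e) (∑ zs n) (begin
    x * ∑ zs e                              ≡⟨ +-identityʳ _ ⟨
    x * ∑ zs e + 0                          ≡⟨ cong (x * ∑ zs e +_) (∑-0 zs) ⟨
    x * ∑ zs e + ∑[ z ∈ zs ] 0              ≤⟨ Increment.scale zs e n (λ _ → 0) (λ _ → 0) (λ _ → inj₂ (refl , refl)) x ⟩
    (Φ + ∑ zs n) + x * ∑[ z ∈ zs ] 0        ≡⟨ cong (λ k → (Φ + ∑ zs n) + x * k) (∑-0 zs) ⟩
    (Φ + ∑ zs n) + x * 0                    ≡⟨ cong ((Φ + ∑ zs n) +_) (*-zeroʳ x) ⟩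
    (Φ + ∑ zs n) + 0                        ≡⟨ +-identityʳ _ ⟩
    Φ + ∑ zs n                              ≡⟨ +-comm Φ _ ⟩
    ∑ zs n + Φ                              ∎)
    where
    open ≤-Reasoning
    Φ = ∑[ z ∈ zs ] (x * e z ∸ n z)

  ∑-pot-suc : ∀ (zs : List Z) (e n : Z → ℕ) L →
    ∑[ z ∈ zs ] pot (suc L) (e z) (n z)
      ≡ 2 * ∑[ z ∈ zs ] pot L (e z) (n z) + ∑[ z ∈ zs ] (2 ^ suc L * e z ∸ n z)
  ∑-pot-suc zs e n L = trans (∑-+ zs (λ z → 2 * pot L (e z) (n z)) _)
    (cong (_+ ∑[ z ∈ zs ] (2 ^ suc L * e z ∸ n z)) (∑-*ˡ zs 2 (λ z → pot L (e z) (n z))))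

  -- Each scale is a convex, positively homogeneous function of edges and area, so this is Jensen's
  -- inequality for the substitute of d log d.
  pot-superadditive : ∀ (zs : List Z) (e n : Z → ℕ) L →
                      pot L (∑ zs e) (∑ zs n) ≤ ∑[ z ∈ zs ] pot L (e z) (n z)
  pot-superadditive zs e n zero    = ∸-superadditive zs e n 1
  pot-superadditive zs e n (suc L) = ≤-trans
    (+-mono-≤ (*-monoʳ-≤ 2 (pot-superadditive zs e n L)) (∸-superadditive zs e n (2 ^ suc L)))
    (≤-reflexive (sym (∑-pot-suc zs e n L)))

  -- Only the scale j with 2^j E between N and 2 N is used.
  pot-gain : ∀ (zs : List Z) (e n eᵁ nᵁ : Z → ℕ) →
    (∀ {z} → z ∈ zs → (eᵁ z ≡ e z × nᵁ z ≡ n z) ⊎ (eᵁ z ≡ 0 × nᵁ z ≡ 0)) →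
    ∑ zs n ≤ 8 * ∑ zs nᵁ → 32 * ∑ zs eᵁ ≤ ∑ zs e → ∑ zs e ≤ ∑ zs n →
    ∀ L → ∑ zs n ≤ 2 ^ L * ∑ zs e →
    32 * pot L (∑ zs e) (∑ zs n) + 2 ^ L * ∑ zs e ≤ 32 * ∑[ z ∈ zs ] pot L (e z) (n z)
  pot-gain zs e n eᵁ nᵁ split large sparse e≤n zero dense =
    Increment.gain-scale zs e n eᵁ nᵁ split large sparse 1 dense
      (≤-trans (≤-reflexive (*-identityˡ (∑ zs e))) (≤-trans e≤n (m≤m+n (∑ zs n) _)))
  pot-gain zs e n eᵁ nᵁ split large sparse e≤n (suc L) dense with ∑ zs n ≤? 2 ^ L * ∑ zs e
  -- The gain at a smaller scale is doubled along with the weight of that scale, so that in the end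
  -- the gain is the same whichever scale produces it.
  ... | yes dense′ = ≤-trans
          (≤-linear 0 (+-mono-≤ (*-monoʳ-≤ 2 (pot-gain zs e n eᵁ nᵁ split large sparse e≤n L dense′))
                                (*-monoʳ-≤ 32 (∸-superadditive zs e n (2 ^ suc L))))
            (identity (pot L (∑ zs e) (∑ zs n)) (2 ^ suc L * ∑ zs e ∸ ∑ zs n) (2 ^ L) (∑ zs e)
                      (∑[ z ∈ zs ] pot L (e z) (n z)) (∑[ z ∈ zs ] (2 ^ suc L * e z ∸ n z))))
          (≤-reflexive (cong (32 *_) (sym (∑-pot-suc zs e n L))))
    where
    identity : ∀ p q x e p′ q′ →
      32 * (2 * p + q) + 2 * x * e + (2 * (32 * p′) + 32 * q′) + 0
      ≡ 32 * (2 * p′ + q′) + (2 * (32 * p + x * e) + 32 * q)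
    identity = solve-∀
  -- Failure at 2^L bounds 2^(L + 1) E by 2 N, so the top scale yields the gain; the lower scales at
  -- least do not decrease.
  ... | no sparse′ = ≤-trans
          (≤-linear 0 (+-mono-≤ (*-monoʳ-≤ 64 (pot-superadditive zs e n L))
                                (Increment.gain-scale zs e n eᵁ nᵁ split large sparse (2 ^ suc L) dense
                                  (≤-trans (≤-reflexive (*-assoc 2 (2 ^ L) (∑ zs e)))
                                           (*-monoʳ-≤ 2 (<⇒≤ (≰⇒> sparse′))))))
            (identity (pot L (∑ zs e) (∑ zs n)) (2 ^ suc L * ∑ zs e ∸ ∑ zs n) (2 ^ suc L * ∑ zs e)
                      (∑[ z ∈ zs ] pot L (e z) (n z)) (∑[ z ∈ zs ] (2 ^ suc L * e z ∸ n z))))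
          (≤-reflexive (cong (32 *_) (sym (∑-pot-suc zs e n L))))
    where
    identity : ∀ p q y p′ q′ →
      32 * (2 * p + q) + y + (64 * p′ + 32 * q′) + 0
      ≡ 32 * (2 * p′ + q′) + (64 * p + (32 * q + y))
    identity = solve-∀

  potential : ℕ → (V → V → Bool) → List (List V) → List (List V) → ℕ
  potential L E 𝒜 ℬ = ∑[ A ∈ 𝒜 ] ∑[ B ∈ ℬ ] pot L (edges E A B) (length A * length B)

  ∑-cells² : ∀ (Ss : List (V → Bool)) xs ys (f : V → V → ℕ) →
    ∑[ p ∈ cartesianProduct (cells Ss xs) (cells Ss ys) ] ∑[ x ∈ proj₁ p ] ∑[ y ∈ proj₂ p ] f x y
      ≡ ∑[ x ∈ xs ] ∑[ y ∈ ys ] f x y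
  ∑-cells² Ss xs ys f = begin
    ∑[ p ∈ cartesianProduct (cells Ss xs) (cells Ss ys) ] ∑[ x ∈ proj₁ p ] ∑[ y ∈ proj₂ p ] f x y
      ≡⟨ ∑-cartesianProduct (cells Ss xs) (cells Ss ys) _ ⟩
    ∑[ A ∈ cells Ss xs ] ∑[ B ∈ cells Ss ys ] ∑[ x ∈ A ] ∑[ y ∈ B ] f x y
      ≡⟨ ∑-cong (cells Ss xs) (λ {A} _ → ∑-comm (cells Ss ys) A (λ B x → ∑ B (f x))) ⟩
    ∑[ A ∈ cells Ss xs ] ∑[ x ∈ A ] ∑[ B ∈ cells Ss ys ] ∑[ y ∈ B ] f x y
      ≡⟨ ∑-cong (cells Ss xs) (λ {A} _ → ∑-cong A (λ {x} _ → ∑-cells Ss ys (f x))) ⟩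
    ∑[ A ∈ cells Ss xs ] ∑[ x ∈ A ] ∑[ y ∈ ys ] f x y
      ≡⟨ ∑-cells Ss xs _ ⟩
    ∑[ x ∈ xs ] ∑[ y ∈ ys ] f x y ∎
    where open ≡-Reasoning

  ∑²-1 : ∀ (xs : List X) (ys : List Y) → ∑[ x ∈ xs ] ∑[ y ∈ ys ] 1 ≡ length xs * length ys
  ∑²-1 xs ys = trans (∑-cong xs (λ _ → ∑-1 ys)) (∑-const xs (length ys))

  module Refine {V : Set} (L : ℕ) (E : V → V → Bool) (Ss : List (V → Bool)) (A B : List V) where

    private
      ps : List (List V × List V)
      ps = cartesianProduct (cells Ss A) (cells Ss B)
      e n : List V × List V → ℕ
      e p = edges E (proj₁ p) (proj₂ p)
      n p = length (proj₁ p) * length (proj₂ p)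

      ∑e : ∑ ps e ≡ edges E A B
      ∑e = ∑-cells² Ss A B (λ x y → 𝟙 (E x y))

      ∑n : ∑ ps n ≡ length A * length B
      ∑n = trans (∑-cong ps (λ {p} _ → sym (∑²-1 (proj₁ p) (proj₂ p))))
                 (trans (∑-cells² Ss A B (λ _ _ → 1)) (∑²-1 A B))

      ∑pot : ∑[ p ∈ ps ] pot L (e p) (n p) ≡ potential L E (cells Ss A) (cells Ss B)
      ∑pot = ∑-cartesianProduct (cells Ss A) (cells Ss B) _

    potential-mono : pot L (edges E A B) (length A * length B) ≤ potential L E (cells Ss A) (cells Ss B)
    potential-mono = subst₂ _≤_ (cong₂ (pot L) ∑e ∑n) ∑pot (pot-superadditive ps e n L)

    potential-gain : ∀ {k} (s : Shatter E A B k) → (∀ {S} → S ∈ sides (Shatter.rects s) → S ∈ Ss) →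
      length A * length B ≤ 2 ^ L * edges E A B →
      32 * pot L (edges E A B) (length A * length B) + 2 ^ L * edges E A B
        ≤ 32 * potential L E (cells Ss A) (cells Ss B)
    potential-gain s ⊆Ss dense =
      subst₂ (λ a b → 32 * pot L a b + 2 ^ L * a ≤ 32 * potential L E (cells Ss A) (cells Ss B)) ∑e ∑n
        (subst (λ q → 32 * pot L (∑ ps e) (∑ ps n) + 2 ^ L * ∑ ps e ≤ 32 * q) ∑pot
          (pot-gain ps e n eᵁ nᵁ split
            (subst₂ (λ a b → a ≤ 8 * b) (sym ∑n) (sym ∑nᵁ) large)
            (subst₂ (λ a b → 32 * a ≤ b) (sym ∑eᵁ) (sym ∑e) sparse)
            (subst₂ _≤_ (sym ∑e) (sym ∑n) (edges≤ E A B))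
            L (subst₂ (λ a b → a ≤ 2 ^ L * b) (sym ∑n) (sym ∑e) dense)))
      where
      open Shatter s
      U : V → V → Bool
      U = ⋃ rects
      eᵁ nᵁ : List V × List V → ℕ
      eᵁ p = edges (λ x y → U x y ∧ E x y) (proj₁ p) (proj₂ p)
      nᵁ p = edges U (proj₁ p) (proj₂ p)
      ∑eᵁ : ∑ ps eᵁ ≡ edges (λ x y → U x y ∧ E x y) A B
      ∑eᵁ = ∑-cells² Ss A B (λ x y → 𝟙 (U x y ∧ E x y))
      ∑nᵁ : ∑ ps nᵁ ≡ edges U A B
      ∑nᵁ = ∑-cells² Ss A B (λ x y → 𝟙 (U x y))
      ∑²-0 : ∀ (xs ys : List V) → ∑[ x ∈ xs ] ∑[ y ∈ ys ] 0 ≡ 0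
      ∑²-0 xs ys = trans (∑-cong xs (λ _ → ∑-0 ys)) (∑-0 xs)
      split : ∀ {p} → p ∈ ps → (eᵁ p ≡ e p × nᵁ p ≡ n p) ⊎ (eᵁ p ≡ 0 × nᵁ p ≡ 0)
      split {A′ , B′} p∈ with ∈-cartesianProduct⁻ (cells Ss A) (cells Ss B) p∈
      ... | A′∈ , B′∈ with ⋃-constant rects Ss A B ⊆Ss A′∈ B′∈
      ...   | true , U≡ = inj₁
              ( ∑-cong₂ A′ B′ (λ {x} {y} x∈ y∈ → cong (λ u → 𝟙 (u ∧ E x y)) (U≡ x∈ y∈))
              , trans (∑-cong₂ A′ B′ (λ x∈ y∈ → cong 𝟙 (U≡ x∈ y∈))) (∑²-1 A′ B′))
      ...   | false , U≡ = inj₂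
              ( trans (∑-cong₂ A′ B′ (λ {x} {y} x∈ y∈ → cong (λ u → 𝟙 (u ∧ E x y)) (U≡ x∈ y∈))) (∑²-0 A′ B′)
              , trans (∑-cong₂ A′ B′ (λ x∈ y∈ → cong 𝟙 (U≡ x∈ y∈))) (∑²-0 A′ B′))

  -- Partitions of the vertex set and their refinement.

  -- A partition is encoded by its effect on sums, the only way in which it is used: disjointness
  -- and exhaustiveness come in one equation, which passes to refinements by regrouping.
  record Covers (𝒜 : List (List V)) (xs : List V) : Set where
    constructor covers
    field
      ∑-covers : ∀ f → ∑[ A ∈ 𝒜 ] ∑ A f ≡ ∑ xs f

  open Covers

  refine : List (V → Bool) → List (List V) → List (List V)
  refine Ss = concatMap (cells Ss)

  refine-covers : ∀ {Ss : List (V → Bool)} {𝒜 xs} → Covers 𝒜 xs → Covers (refine Ss 𝒜) xs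
  refine-covers {Ss = Ss} {𝒜} (covers cov) = covers λ f →
    trans (∑-concatMap (cells Ss) 𝒜 (λ A → ∑ A f))
          (trans (∑-cong 𝒜 λ {A} _ → ∑-cells Ss A f) (cov f))

  length-refine : ∀ (Ss : List (V → Bool)) 𝒜 → length (refine Ss 𝒜) ≡ length 𝒜 * 2 ^ length Ss
  length-refine Ss 𝒜 = trans (sym (∑-1 (refine Ss 𝒜)))
    (trans (∑-concatMap (cells Ss) 𝒜 (λ _ → 1))
    (trans (∑-cong 𝒜 λ {A} _ → trans (∑-1 (cells Ss A)) (length-cells Ss A)) (∑-const 𝒜 _)))

  potential-refine : ∀ L (E : V → V → Bool) Ss 𝒜 →
    potential L E (refine Ss 𝒜) (refine Ss 𝒜) ≡ ∑[ A ∈ 𝒜 ] ∑[ B ∈ 𝒜 ] potential L E (cells Ss A) (cells Ss B)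
  potential-refine L E Ss 𝒜 = trans (∑-concatMap (cells Ss) 𝒜 _) (∑-cong 𝒜 λ {A} _ →
    trans (∑-cong (cells Ss A) λ _ → ∑-concatMap (cells Ss) 𝒜 _) (∑-comm (cells Ss A) 𝒜 _))

  module _ {𝒜 : List (List V)} {xs : List V} (cov : Covers 𝒜 xs) where

    covers-≤ : ∀ f {A} → A ∈ 𝒜 → ∑ A f ≤ ∑ xs f
    covers-≤ f A∈ = ≤-trans (f≤∑f (λ A → ∑ A f) A∈) (≤-reflexive (∑-covers cov f))

    covers-length : ∀ {A} → A ∈ 𝒜 → length A ≤ length xs
    covers-length {A} A∈ = subst₂ _≤_ (∑-1 A) (∑-1 xs) (covers-≤ (λ _ → 1) A∈)

    covers-edges : ∀ (f : V → V → ℕ) →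
      ∑[ A ∈ 𝒜 ] ∑[ B ∈ 𝒜 ] ∑[ x ∈ A ] ∑[ y ∈ B ] f x y ≡ ∑[ x ∈ xs ] ∑[ y ∈ xs ] f x y
    covers-edges f = trans (∑-cong 𝒜 λ {A} _ → ∑-comm 𝒜 A (λ B x → ∑ B (f x)))
      (trans (∑-cong 𝒜 λ {A} _ → ∑-cong A λ {x} _ → ∑-covers cov (f x)) (∑-covers cov _))

  -- Triangle removal for an edge-disjoint family.

  -- F is the indicator of an edge-disjoint family of triangles, and P, Q and R are
  -- the relations formed by its edges.
  module Removal
    {V : Set} (vs : List V) (P Q R : V → V → Bool) (F : V → V → V → ℕ)
    (F-P : ∀ u v → ∑ vs (λ w → F u v w) ≡ 𝟙 (P u v))
    (F-Q : ∀ v w → ∑ vs (λ u → F u v w) ≡ 𝟙 (Q v w))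
    (F-R : ∀ u w → ∑ vs (λ v → F u v w) ≡ 𝟙 (R u w))
    (L : ℕ) where

    m N M t : ℕ
    m = 2 ^ L
    N = length vs
    M = ∑[ u ∈ vs ] ∑[ v ∈ vs ] ∑[ w ∈ vs ] F u v w
    t = triangles P Q R vs vs vs

    open Constants m

    -- The loss in the triangle count: each part of the triple found has at least N / (m K²)
    -- vertices, and its triangle density is at least 1 / (2 k₂ k₃).
    D : ℕ → ℕ
    D K = (m * (K * K)) ^ 3 * (2 * k₂ * k₃)

    instance
      m≢0 : NonZero m
      m≢0 = m^n≢0 2 L

    mass : (V → V → Bool) → (List V → List V → Bool) → List (List V) → ℕ
    mass E p 𝒜 = ∑[ A ∈ 𝒜 ] ∑[ B ∈ 𝒜 ] (𝟙 (p A B) * edges E A B)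

    weight : List V → List V → List V → ℕ
    weight A B C = ∑[ u ∈ A ] ∑[ v ∈ B ] ∑[ w ∈ C ] F u v w

    module _ {𝒜 : List (List V)} (cov : Covers 𝒜 vs) where

      -- An edge of `P` lies in exactly one triangle of the family, and the third vertex of that
      -- triangle lies in exactly one part.
      weight-P : ∀ A B → ∑[ C ∈ 𝒜 ] weight A B C ≡ edges P A B
      weight-P A B = begin
        ∑[ C ∈ 𝒜 ] ∑[ u ∈ A ] ∑[ v ∈ B ] ∑[ w ∈ C ] F u v w
          ≡⟨ ∑-comm 𝒜 A (λ C u → ∑[ v ∈ B ] ∑[ w ∈ C ] F u v w) ⟩
        ∑[ u ∈ A ] ∑[ C ∈ 𝒜 ] ∑[ v ∈ B ] ∑[ w ∈ C ] F u v w
          ≡⟨ ∑-cong A (λ {u} _ → ∑-comm 𝒜 B (λ C v → ∑[ w ∈ C ] F u v w)) ⟩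
        ∑[ u ∈ A ] ∑[ v ∈ B ] ∑[ C ∈ 𝒜 ] ∑[ w ∈ C ] F u v w
          ≡⟨ ∑-cong₂ A B (λ {u} {v} _ _ → trans (∑-covers cov (F u v)) (F-P u v)) ⟩
        edges P A B ∎
        where open ≡-Reasoning

      weight-R : ∀ A C → ∑[ B ∈ 𝒜 ] weight A B C ≡ edges R A C
      weight-R A C = begin
        ∑[ B ∈ 𝒜 ] ∑[ u ∈ A ] ∑[ v ∈ B ] ∑[ w ∈ C ] F u v w
          ≡⟨ ∑-comm 𝒜 A (λ B u → ∑[ v ∈ B ] ∑[ w ∈ C ] F u v w) ⟩
        ∑[ u ∈ A ] ∑[ B ∈ 𝒜 ] ∑[ v ∈ B ] ∑[ w ∈ C ] F u v w
          ≡⟨ ∑-cong A (λ {u} _ → ∑-covers cov (λ v → ∑[ w ∈ C ] F u v w)) ⟩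
        ∑[ u ∈ A ] ∑[ v ∈ vs ] ∑[ w ∈ C ] F u v w
          ≡⟨ ∑-cong A (λ {u} _ → ∑-comm vs C (λ v w → F u v w)) ⟩
        ∑[ u ∈ A ] ∑[ w ∈ C ] ∑[ v ∈ vs ] F u v w
          ≡⟨ ∑-cong₂ A C (λ {u} {w} _ _ → F-R u w) ⟩
        edges R A C ∎
        where open ≡-Reasoning

      weight-Q : ∀ B C → ∑[ A ∈ 𝒜 ] weight A B C ≡ edges Q B C
      weight-Q B C = begin
        ∑[ A ∈ 𝒜 ] ∑[ u ∈ A ] ∑[ v ∈ B ] ∑[ w ∈ C ] F u v w
          ≡⟨ ∑-covers cov (λ u → ∑[ v ∈ B ] ∑[ w ∈ C ] F u v w) ⟩
        ∑[ u ∈ vs ] ∑[ v ∈ B ] ∑[ w ∈ C ] F u v w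
          ≡⟨ ∑-comm vs B (λ u v → ∑[ w ∈ C ] F u v w) ⟩
        ∑[ v ∈ B ] ∑[ u ∈ vs ] ∑[ w ∈ C ] F u v w
          ≡⟨ ∑-cong B (λ {v} _ → ∑-comm vs C (λ u w → F u v w)) ⟩
        ∑[ v ∈ B ] ∑[ w ∈ C ] ∑[ u ∈ vs ] F u v w
          ≡⟨ ∑-cong₂ B C (λ {v} {w} _ _ → F-Q v w) ⟩
        edges Q B C ∎
        where open ≡-Reasoning

      mass-P : ∀ p → ∑[ A ∈ 𝒜 ] ∑[ B ∈ 𝒜 ] ∑[ C ∈ 𝒜 ] (𝟙 (p A B) * weight A B C) ≡ mass P p 𝒜
      mass-P p = ∑-cong₂ 𝒜 𝒜 λ {A} {B} _ _ →
        trans (∑-*ˡ 𝒜 (𝟙 (p A B)) (λ C → weight A B C)) (cong (𝟙 (p A B) *_) (weight-P A B))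

      mass-R : ∀ p → ∑[ A ∈ 𝒜 ] ∑[ B ∈ 𝒜 ] ∑[ C ∈ 𝒜 ] (𝟙 (p A C) * weight A B C) ≡ mass R p 𝒜
      mass-R p = ∑-cong 𝒜 λ {A} _ → trans (∑-comm 𝒜 𝒜 (λ B C → 𝟙 (p A C) * weight A B C))
        (∑-cong 𝒜 λ {C} _ →
          trans (∑-*ˡ 𝒜 (𝟙 (p A C)) (λ B → weight A B C)) (cong (𝟙 (p A C) *_) (weight-R A C)))

      mass-Q : ∀ p → ∑[ A ∈ 𝒜 ] ∑[ B ∈ 𝒜 ] ∑[ C ∈ 𝒜 ] (𝟙 (p B C) * weight A B C) ≡ mass Q p 𝒜
      mass-Q p = trans (∑-comm 𝒜 𝒜 (λ A B → ∑[ C ∈ 𝒜 ] (𝟙 (p B C) * weight A B C)))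
        (∑-cong 𝒜 λ {B} _ → trans (∑-comm 𝒜 𝒜 (λ A C → 𝟙 (p B C) * weight A B C))
          (∑-cong 𝒜 λ {C} _ →
            trans (∑-*ˡ 𝒜 (𝟙 (p B C)) (λ A → weight A B C)) (cong (𝟙 (p B C) *_) (weight-Q B C))))

      weight-total : ∑[ A ∈ 𝒜 ] ∑[ B ∈ 𝒜 ] ∑[ C ∈ 𝒜 ] weight A B C ≡ M
      weight-total = begin
        ∑[ A ∈ 𝒜 ] ∑[ B ∈ 𝒜 ] ∑[ C ∈ 𝒜 ] weight A B C   ≡⟨ ∑-cong₂ 𝒜 𝒜 (λ {A} {B} _ _ → weight-P A B) ⟩
        ∑[ A ∈ 𝒜 ] ∑[ B ∈ 𝒜 ] edges P A B               ≡⟨ covers-edges cov (λ u v → 𝟙 (P u v)) ⟩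
        edges P vs vs                                   ≡⟨ ∑-cong₂ vs vs (λ {u} {v} _ _ → F-P u v) ⟨
        M ∎
        where open ≡-Reasoning

    edges-Q : edges Q vs vs ≡ M
    edges-Q = begin
      edges Q vs vs                                    ≡⟨ ∑-cong₂ vs vs (λ {v} {w} _ _ → F-Q v w) ⟨
      ∑[ v ∈ vs ] ∑[ w ∈ vs ] ∑[ u ∈ vs ] F u v w      ≡⟨ ∑-cong vs (λ {v} _ → ∑-comm vs vs (λ w u → F u v w)) ⟩
      ∑[ v ∈ vs ] ∑[ u ∈ vs ] ∑[ w ∈ vs ] F u v w      ≡⟨ ∑-comm vs vs (λ v u → ∑[ w ∈ vs ] F u v w) ⟩
      M ∎
      where open ≡-Reasoning

    edges-R : edges R vs vs ≡ M
    edges-R = begin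
      edges R vs vs                                    ≡⟨ ∑-cong₂ vs vs (λ {u} {w} _ _ → F-R u w) ⟨
      ∑[ u ∈ vs ] ∑[ w ∈ vs ] ∑[ v ∈ vs ] F u v w      ≡⟨ ∑-cong vs (λ {u} _ → ∑-comm vs vs (λ w v → F u v w)) ⟩
      M ∎
      where open ≡-Reasoning

    edges-P : edges P vs vs ≡ M
    edges-P = sym (∑-cong₂ vs vs (λ {u} {v} _ _ → F-P u v))

    -- The threshold is the increment of a dense shattered pair, but the test refers to the
    -- potential alone. So it can be decided for each pair under the common refinement, whichever
    -- triple made the pair shatter.
    gains : (V → V → Bool) → List (V → Bool) → List V → List V → Bool
    gains E Ss A B = 32 * pot L (edges E A B) (length A * length B) + m * edges E A B
                       ≤ᵇ 32 * potential L E (cells Ss A) (cells Ss B)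

    shatter-gains : ∀ {E A B k} (s : Shatter E A B k) {Ss} → (∀ {S} → S ∈ sides (Shatter.rects s) → S ∈ Ss) →
                    length A * length B ≤ m * edges E A B → gains E Ss A B ≡ true
    shatter-gains {E} {A} {B} s {Ss} ⊆Ss dense = T-true (≤⇒≤ᵇ (Refine.potential-gain L E Ss A B s ⊆Ss dense))
      where
      T-true : ∀ {b} → T b → b ≡ true
      T-true {true} _ = refl

    Φ : List (List V) → ℕ
    Φ 𝒜 = potential L P 𝒜 𝒜 + (potential L Q 𝒜 𝒜 + potential L R 𝒜 𝒜)

    -- A pair that fails the test still loses nothing, by superadditivity.
    potential-step : ∀ E Ss 𝒜 → 32 * potential L E 𝒜 𝒜 + m * mass E (gains E Ss) 𝒜
                                ≤ 32 * potential L E (refine Ss 𝒜) (refine Ss 𝒜)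
    potential-step E Ss 𝒜 = begin
      32 * potential L E 𝒜 𝒜 + m * mass E (gains E Ss) 𝒜
        ≡⟨ cong₂ _+_ (∑∑-*ˡ 32 p) (∑∑-*ˡ m g) ⟨
      ∑[ A ∈ 𝒜 ] ∑[ B ∈ 𝒜 ] (32 * p A B) + ∑[ A ∈ 𝒜 ] ∑[ B ∈ 𝒜 ] (m * g A B)
        ≡⟨ ∑-+ 𝒜 _ _ ⟨
      ∑[ A ∈ 𝒜 ] (∑[ B ∈ 𝒜 ] (32 * p A B) + ∑[ B ∈ 𝒜 ] (m * g A B))
        ≡⟨ ∑-cong 𝒜 (λ {A} _ → ∑-+ 𝒜 (λ B → 32 * p A B) (λ B → m * g A B)) ⟨
      ∑[ A ∈ 𝒜 ] ∑[ B ∈ 𝒜 ] (32 * p A B + m * g A B)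
        ≤⟨ ∑-mono₂ 𝒜 𝒜 (λ {A} {B} _ _ → pair A B) ⟩
      ∑[ A ∈ 𝒜 ] ∑[ B ∈ 𝒜 ] (32 * potential L E (cells Ss A) (cells Ss B))
        ≡⟨ ∑∑-*ˡ 32 _ ⟩
      32 * ∑[ A ∈ 𝒜 ] ∑[ B ∈ 𝒜 ] potential L E (cells Ss A) (cells Ss B)
        ≡⟨ cong (32 *_) (potential-refine L E Ss 𝒜) ⟨
      32 * potential L E (refine Ss 𝒜) (refine Ss 𝒜) ∎
      where
      open ≤-Reasoning
      p g : List V → List V → ℕ
      p A B = pot L (edges E A B) (length A * length B)
      g A B = 𝟙 (gains E Ss A B) * edges E A B
      ∑∑-*ˡ : ∀ c f → ∑[ A ∈ 𝒜 ] ∑[ B ∈ 𝒜 ] (c * f A B) ≡ c * ∑[ A ∈ 𝒜 ] ∑[ B ∈ 𝒜 ] f A B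
      ∑∑-*ˡ c f = trans (∑-cong 𝒜 λ {A} _ → ∑-*ˡ 𝒜 c (f A)) (∑-*ˡ 𝒜 c _)
      pair : ∀ A B → 32 * p A B + m * g A B ≤ 32 * potential L E (cells Ss A) (cells Ss B)
      pair A B with gains E Ss A B in eq
      ... | true  = ≤-trans (≤-reflexive (cong (λ e → 32 * p A B + m * e) (+-identityʳ (edges E A B)))) (≤ᵇ-true eq)
      ... | false = ≤-trans (≤-reflexive (trans (cong (32 * p A B +_) (*-zeroʳ m)) (+-identityʳ _)))
                      (*-monoʳ-≤ 32 (Refine.potential-mono L E Ss A B))

    Φ≤ : ∀ {𝒜} → Covers 𝒜 vs → Φ 𝒜 ≤ 3 * (suc L * (m * M))
    Φ≤ {𝒜} cov = +-mono-≤ (one P edges-P) (+-mono-≤ (one Q edges-Q) (≤-trans (one R edges-R) (≤-reflexive (sym (+-identityʳ _)))))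
      where
      open ≤-Reasoning
      one : ∀ E → edges E vs vs ≡ M → potential L E 𝒜 𝒜 ≤ suc L * (m * M)
      one E eq = begin
        potential L E 𝒜 𝒜
          ≤⟨ ∑-mono₂ 𝒜 𝒜 (λ {A} {B} _ _ → ≤-trans (pot≤ L (edges E A B) _) (≤-reflexive (sym (*-assoc (suc L) m _)))) ⟩
        ∑[ A ∈ 𝒜 ] ∑[ B ∈ 𝒜 ] (suc L * m * edges E A B)
          ≡⟨ ∑-cong 𝒜 (λ {A} _ → ∑-*ˡ 𝒜 (suc L * m) (edges E A)) ⟩
        ∑[ A ∈ 𝒜 ] (suc L * m * ∑[ B ∈ 𝒜 ] edges E A B)
          ≡⟨ ∑-*ˡ 𝒜 (suc L * m) _ ⟩
        suc L * m * ∑[ A ∈ 𝒜 ] ∑[ B ∈ 𝒜 ] edges E A B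
          ≡⟨ cong (suc L * m *_) (trans (covers-edges cov (λ u v → 𝟙 (E u v))) eq) ⟩
        suc L * m * M
          ≡⟨ *-assoc (suc L) m M ⟩
        suc L * (m * M) ∎

    module Step (K : ℕ) (0<K : 0 < K) where

      private instance
        K≢0 : NonZero K
        K≢0 = >-nonZero 0<K
        K²≢0 : NonZero (K * K)
        K²≢0 = m*n≢0 K K

      -- The summand N² also makes pairs with a part much smaller than N / K negligible.
      negligible : (V → V → Bool) → List V → List V → Bool
      negligible E A B = edges E A B * (m * (K * K)) ≤ᵇ length A * length B * (K * K) + N * N

      module _ {E A B} (eq : negligible E A B ≡ false) where

        private
          large : length A * length B * (K * K) + N * N < edges E A B * (m * (K * K))
          large = ≤ᵇ-false eq

        dense : length A * length B ≤ m * edges E A B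
        dense = *-cancelʳ-≤ _ _ (K * K) (begin
          length A * length B * (K * K)   ≤⟨ m≤m+n _ (N * N) ⟩
          length A * length B * (K * K) + N * N ≤⟨ <⇒≤ large ⟩
          edges E A B * (m * (K * K))     ≡⟨ reorder (edges E A B) m (K * K) ⟩
          m * edges E A B * (K * K)       ∎)
          where
          open ≤-Reasoning
          reorder : ∀ e m k → e * (m * k) ≡ m * e * k
          reorder = solve-∀

        nonempty : 0 < length A × 0 < length B
        nonempty = positive (length A) (length B) (≤-trans (edge-exists (edges E A B) large) (edges≤ E A B))
          where
          edge-exists : ∀ e {x y} → x < e * y → 0 < e
          edge-exists (suc e) _ = s≤s z≤n
          positive : ∀ a b → 0 < a * b → 0 < a × 0 < b
          positive (suc a) (suc b) _ = s≤s z≤n , s≤s z≤n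
          positive (suc a) zero h = ⊥-elim (<-irrefl (sym (*-zeroʳ a)) h)

        N²≤ : N * N ≤ length A * length B * (m * (K * K))
        N²≤ = ≤-trans (m≤n+m (N * N) (length A * length B * (K * K)))
          (≤-trans (<⇒≤ large) (*-monoˡ-≤ (m * (K * K)) (edges≤ E A B)))

      data Outcome (Ss : List (V → Bool)) (A B C : List V) : Set where
        negligible-P : negligible P A B ≡ true → Outcome Ss A B C
        negligible-Q : negligible Q B C ≡ true → Outcome Ss A B C
        negligible-R : negligible R A C ≡ true → Outcome Ss A B C
        gains-P      : gains P Ss A B ≡ true → Outcome Ss A B C
        gains-Q      : gains Q Ss B C ≡ true → Outcome Ss A B C
        gains-R      : gains R Ss A C ≡ true → Outcome Ss A B C
        many         : N * N ≤ length A * length B * (m * (K * K)) →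
                       N * N ≤ length B * length C * (m * (K * K)) →
                       length A * (length B * length C) ≤ 2 * k₂ * k₃ * triangles P Q R A B C →
                       Outcome Ss A B C

      -- Quantifying over all supersets makes the separators of different triples compatible: one
      -- refinement by all of them serves every triple at once. The bound is two sides for each of
      -- at most 2 k₂ rectangles.
      Separators : List V → List V → List V → Set
      Separators A B C = ∃[ Ss ] (length Ss ≤ 4 * k₂ ×
                           (∀ {Ss′} → (∀ {S} → S ∈ Ss → S ∈ Ss′) → Outcome Ss′ A B C))

      trivial : ∀ {A B C} → (∀ {Ss} → Outcome Ss A B C) → Separators A B C
      trivial o = [] , z≤n , λ _ → o

      shattered : ∀ {A B C E X Y k} (s : Shatter E X Y k) → k ≤ 2 * k₂ →
                  (∀ {Ss} → (∀ {S} → S ∈ sides (Shatter.rects s) → S ∈ Ss) → Outcome Ss A B C) → Separators A B C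
      shattered s k≤ o = sides rects , bound , o
        where
        open Shatter s
        bound : length (sides rects) ≤ 4 * k₂
        bound = ≤-trans (≤-reflexive (length-sides rects))
          (≤-trans (*-monoʳ-≤ 2 (≤-trans few k≤)) (≤-reflexive (sym (*-assoc 2 2 k₂))))

      separators : ∀ A B C → Separators A B C
      separators A B C with negligible P A B in eqP
      ... | true = trivial (negligible-P eqP)
      ... | false with negligible Q B C in eqQ
      ...   | true = trivial (negligible-Q eqQ)
      ...   | false with negligible R A C in eqR
      ...     | true = trivial (negligible-R eqR)
      ...     | false = cases
        where
        module T = Triple P Q R m A B C
        0<A = proj₁ (nonempty {P} {A} {B} eqP)
        0<B = proj₂ (nonempty {P} {A} {B} eqP)
        0<C = proj₂ (nonempty {R} {A} {C} eqR)
        dense-P = dense {P} {A} {B} eqP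
        dense-Q = dense {Q} {B} {C} eqQ
        dense-R = dense {R} {A} {C} eqR
        1≤k₁ : 1 ≤ k₁
        1≤k₁ = >-nonZero⁻¹ k₁ {{m*n≢0 32 m}}
        k₁≤ : k₁ ≤ 2 * k₂
        k₁≤ = ≤-trans (≤-trans (≤-reflexive (sym (*-identityˡ k₁))) (*-monoˡ-≤ k₁ 1≤k₁)) (m≤m+n k₂ _)
        cases : Separators A B C
        cases with ≤-total (length A * (length B * length C)) (2 * k₂ * k₃ * triangles P Q R A B C)
        ... | inj₁ h = trivial (many (N²≤ {P} {A} {B} eqP) (N²≤ {Q} {B} {C} eqQ) h)
        ... | inj₂ few with majority C T.isolated
        ...   | inj₂ h = let s = T.shatter-Q 0<A 0<B 0<C dense-Q few h in
                         shattered s ≤-refl λ ⊆Ss → gains-Q (shatter-gains s ⊆Ss dense-Q)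
        ...   | inj₁ h with majority A T.rich
        ...     | inj₁ h′ = let s = T.shatter-P 0<A 0<B 0<C dense-P h h′ in
                            shattered s k₁≤ λ ⊆Ss → gains-P (shatter-gains s ⊆Ss dense-P)
        ...     | inj₂ h′ = let s = T.shatter-R 0<A 0<B 0<C dense-R h h′ in
                            shattered s (≤-trans 1≤k₁ k₁≤) λ ⊆Ss → gains-R (shatter-gains s ⊆Ss dense-R)

      many-triangles : ∀ {𝒜} → Covers 𝒜 vs → ∀ {A B C} → A ∈ 𝒜 → B ∈ 𝒜 → C ∈ 𝒜 → 0 < N →
        N * N ≤ length A * length B * (m * (K * K)) →
        N * N ≤ length B * length C * (m * (K * K)) →
        length A * (length B * length C) ≤ 2 * k₂ * k₃ * triangles P Q R A B C →
        N * (N * N) ≤ D K * t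
      many-triangles {𝒜} cov {A} {B} {C} A∈ B∈ C∈ 0<N hAB hBC h = begin
        N * (N * N)                       ≤⟨ *-mono-≤ A-large (*-mono-≤ B-large C-large) ⟩
        a * y * (b * y * (c * y))         ≡⟨ reorder a b c y ⟩
        y ^ 3 * (a * (b * c))             ≤⟨ *-monoʳ-≤ (y ^ 3) (≤-trans h (*-monoʳ-≤ (2 * k₂ * k₃) t≤)) ⟩
        y ^ 3 * (2 * k₂ * k₃ * t)         ≡⟨ *-assoc (y ^ 3) (2 * k₂ * k₃) t ⟨
        D K * t                           ∎
        where
        open ≤-Reasoning
        a = length A
        b = length B
        c = length C
        y = m * (K * K)
        a≤ = covers-length cov A∈
        b≤ = covers-length cov B∈
        instance
          N≢0 : NonZero N
          N≢0 = >-nonZero 0<N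
        swap : ∀ a b y → a * b * y ≡ b * (a * y)
        swap = solve-∀
        A-large : N ≤ a * y
        A-large = *-cancelˡ-≤ N (≤-trans hAB (≤-trans (≤-reflexive (swap a b y)) (*-monoˡ-≤ (a * y) b≤)))
        B-large : N ≤ b * y
        B-large = *-cancelˡ-≤ N (≤-trans hAB (≤-trans (≤-reflexive (*-assoc a b y)) (*-monoˡ-≤ (b * y) a≤)))
        C-large : N ≤ c * y
        C-large = *-cancelˡ-≤ N (≤-trans hBC (≤-trans (≤-reflexive (*-assoc b c y)) (*-monoˡ-≤ (c * y) b≤)))
        reorder : ∀ a b c y → a * y * (b * y * (c * y)) ≡ y * (y * (y * 1)) * (a * (b * c))
        reorder = solve-∀
        t≤ : triangles P Q R A B C ≤ t
        t≤ = ≤-trans (∑-mono₂ A B λ {u} {v} _ _ → covers-≤ cov (λ w → 𝟙 ((P u v ∧ R u w) ∧ Q v w)) C∈)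
               (≤-trans (∑-mono A λ {u} _ → covers-≤ cov (λ v → ∑[ w ∈ vs ] 𝟙 ((P u v ∧ R u w) ∧ Q v w)) B∈)
                        (covers-≤ cov (λ u → ∑[ v ∈ vs ] ∑[ w ∈ vs ] 𝟙 ((P u v ∧ R u w) ∧ Q v w)) A∈))

      -- The areas add up to N² and there are at most K² pairs, so each of the two summands in
      -- `negligible` contributes at most N² after division by K².
      negligible-mass : ∀ {𝒜} → Covers 𝒜 vs → length 𝒜 ≤ K → ∀ E → m * mass E (negligible E) 𝒜 ≤ 2 * (N * N)
      negligible-mass {𝒜} cov len E = *-cancelʳ-≤ _ _ (K * K) (begin
        m * mass E (negligible E) 𝒜 * (K * K)
          ≡⟨ reorder m (mass E (negligible E) 𝒜) (K * K) ⟩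
        mass E (negligible E) 𝒜 * (m * (K * K))
          ≡⟨ trans (∑-cong 𝒜 λ {A} _ → ∑-*ʳ 𝒜 (λ B → 𝟙 (negligible E A B) * edges E A B) (m * (K * K))) (∑-*ʳ 𝒜 _ (m * (K * K))) ⟨
        ∑[ A ∈ 𝒜 ] ∑[ B ∈ 𝒜 ] (𝟙 (negligible E A B) * edges E A B * (m * (K * K)))
          ≤⟨ ∑-mono₂ 𝒜 𝒜 (λ {A} {B} _ _ → ≤-trans (≤-reflexive (*-assoc (𝟙 (negligible E A B)) _ _)) (𝟙*≤ (negligible E A B) ≤ᵇ-true)) ⟩
        ∑[ A ∈ 𝒜 ] ∑[ B ∈ 𝒜 ] (length A * length B * (K * K) + N * N)
          ≡⟨ ∑-cong 𝒜 (λ {A} _ → trans (∑-+ 𝒜 _ _) (cong₂ _+_ (∑-*ʳ 𝒜 (λ B → length A * length B) (K * K)) (∑-const 𝒜 (N * N)))) ⟩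
        ∑[ A ∈ 𝒜 ] (∑[ B ∈ 𝒜 ] (length A * length B) * (K * K) + length 𝒜 * (N * N))
          ≡⟨ trans (∑-+ 𝒜 _ _) (cong₂ _+_ (∑-*ʳ 𝒜 _ (K * K)) (∑-const 𝒜 _)) ⟩
        ∑[ A ∈ 𝒜 ] ∑[ B ∈ 𝒜 ] (length A * length B) * (K * K) + length 𝒜 * (length 𝒜 * (N * N))
          ≡⟨ cong (λ x → x * (K * K) + length 𝒜 * (length 𝒜 * (N * N))) total ⟩
        N * N * (K * K) + length 𝒜 * (length 𝒜 * (N * N))
          ≤⟨ +-monoʳ-≤ (N * N * (K * K)) (*-mono-≤ len (*-monoˡ-≤ (N * N) len)) ⟩
        N * N * (K * K) + K * (K * (N * N))
          ≡⟨ double (N * N) K ⟩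
        2 * (N * N) * (K * K) ∎)
        where
        open ≤-Reasoning
        reorder : ∀ m e k → m * e * k ≡ e * (m * k)
        reorder = solve-∀
        double : ∀ n k → n * (k * k) + k * (k * n) ≡ 2 * n * (k * k)
        double = solve-∀
        total : ∑[ A ∈ 𝒜 ] ∑[ B ∈ 𝒜 ] (length A * length B) ≡ N * N
        total = trans (∑-cong₂ 𝒜 𝒜 λ {A} {B} _ _ → sym (∑²-1 A B))
          (trans (covers-edges cov (λ _ _ → 1)) (∑²-1 vs vs))

      -- Every triangle of the family is charged to a negligible or to a gaining pair; the outcome
      -- `many` would give the first alternative. The negligible pairs take at most half of M, and
      -- the rest gains m M / 64.
      improve : 0 < N → 12 * (N * N) ≤ m * M → ∀ {𝒜} → Covers 𝒜 vs → length 𝒜 ≤ K →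
        N * (N * N) ≤ D K * t ⊎
        ∃[ 𝒜′ ] (Covers 𝒜′ vs × length 𝒜′ ≤ K * 2 ^ (K * (K * (K * (4 * k₂)))) ×
                 64 * Φ 𝒜 + m * M ≤ 64 * Φ 𝒜′)
      improve 0<N far {𝒜} cov len with N * (N * N) ≤? D K * t
      ... | yes h = inj₁ h
      ... | no few = inj₂ (refine Ss 𝒜 , refine-covers {Ss = Ss} cov , length≤ , Φ-step)
        where
        open ≤-Reasoning
        triples : List (List V × List V × List V)
        triples = cartesianProduct 𝒜 (cartesianProduct 𝒜 𝒜)
        seps : List V × List V × List V → List (V → Bool)
        seps (A , B , C) = proj₁ (separators A B C)
        Ss : List (V → Bool)
        Ss = concatMap seps triples

        length-Ss : length Ss ≤ K * (K * (K * (4 * k₂)))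
        length-Ss = begin
          length Ss                                     ≡⟨ ∑-1 Ss ⟨
          ∑[ S ∈ Ss ] 1                                 ≡⟨ ∑-concatMap seps triples (λ _ → 1) ⟩
          ∑[ p ∈ triples ] ∑[ S ∈ seps p ] 1            ≤⟨ ∑-mono triples (λ {(A , B , C)} _ → ≤-trans (≤-reflexive (∑-1 (seps (A , B , C)))) (proj₁ (proj₂ (separators A B C)))) ⟩
          ∑[ p ∈ triples ] (4 * k₂)                     ≡⟨ ∑-cartesianProduct 𝒜 _ _ ⟩
          ∑[ A ∈ 𝒜 ] ∑[ p ∈ cartesianProduct 𝒜 𝒜 ] (4 * k₂)
                                                        ≡⟨ ∑-cong 𝒜 (λ _ → ∑-cartesianProduct 𝒜 𝒜 _) ⟩
          ∑[ A ∈ 𝒜 ] ∑[ B ∈ 𝒜 ] ∑[ C ∈ 𝒜 ] (4 * k₂)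
            ≤⟨ ∑-bound 𝒜 (λ _ → ∑-bound 𝒜 (λ _ → ≤-reflexive (∑-const 𝒜 _))) ⟩
          length 𝒜 * (length 𝒜 * (length 𝒜 * (4 * k₂)))
            ≤⟨ *-mono-≤ len (*-mono-≤ len (*-monoˡ-≤ (4 * k₂) len)) ⟩
          K * (K * (K * (4 * k₂))) ∎

        length≤ : length (refine Ss 𝒜) ≤ K * 2 ^ (K * (K * (K * (4 * k₂))))
        length≤ = ≤-trans (≤-reflexive (length-refine Ss 𝒜)) (*-mono-≤ len (^-monoʳ-≤ 2 length-Ss))

        outcome : ∀ {A B C} → A ∈ 𝒜 → B ∈ 𝒜 → C ∈ 𝒜 → Outcome Ss A B C
        outcome {A} {B} {C} A∈ B∈ C∈ = proj₂ (proj₂ (separators A B C))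
          (λ S∈ → ∈-concatMap (∈-cartesianProduct⁺ A∈ (∈-cartesianProduct⁺ B∈ C∈)) S∈)
          where
          ∈-concatMap : ∀ {ps p S} → p ∈ ps → S ∈ seps p → S ∈ concatMap seps ps
          ∈-concatMap (here refl) S∈ = ∈-++⁺ˡ S∈
          ∈-concatMap {q ∷ _} (there p∈) S∈ = ∈-++⁺ʳ (seps q) (∈-concatMap p∈ S∈)

        nP nQ nR gP gQ gR : ℕ
        nP = mass P (negligible P) 𝒜
        nQ = mass Q (negligible Q) 𝒜
        nR = mass R (negligible R) 𝒜
        gP = mass P (gains P Ss) 𝒜
        gQ = mass Q (gains Q Ss) 𝒜
        gR = mass R (gains R Ss) 𝒜

        cP cQ cR dP dQ dR Charge : List V → List V → List V → ℕ
        cP A B C = 𝟙 (negligible P A B) * weight A B C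
        cQ A B C = 𝟙 (negligible Q B C) * weight A B C
        cR A B C = 𝟙 (negligible R A C) * weight A B C
        dP A B C = 𝟙 (gains P Ss A B) * weight A B C
        dQ A B C = 𝟙 (gains Q Ss B C) * weight A B C
        dR A B C = 𝟙 (gains R Ss A C) * weight A B C
        Charge A B C = cP A B C + (cQ A B C + (cR A B C + (dP A B C + (dQ A B C + dR A B C))))

        charge : ∀ {A B C} → A ∈ 𝒜 → B ∈ 𝒜 → C ∈ 𝒜 → weight A B C ≤ Charge A B C
        charge {A} {B} {C} A∈ B∈ C∈ = go (outcome A∈ B∈ C∈)
          where
          f : ℕ
          f = weight A B C
          one : ∀ {b} → b ≡ true → f ≤ 𝟙 b * f
          one refl = m≤m+n f 0
          go : Outcome Ss A B C → f ≤ Charge A B C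
          go (negligible-P h) = ≤-trans (one h) (m≤m+n _ _)
          go (negligible-Q h) = ≤-trans (≤-trans (one h) (m≤m+n _ _)) (m≤n+m _ (𝟙 (negligible P A B) * f))
          go (negligible-R h) = ≤-trans (≤-trans (≤-trans (one h) (m≤m+n _ _))
            (m≤n+m _ (𝟙 (negligible Q B C) * f))) (m≤n+m _ (𝟙 (negligible P A B) * f))
          go (gains-P h) = ≤-trans (≤-trans (≤-trans (≤-trans (one h) (m≤m+n _ _))
            (m≤n+m _ (𝟙 (negligible R A C) * f))) (m≤n+m _ (𝟙 (negligible Q B C) * f))) (m≤n+m _ (𝟙 (negligible P A B) * f))
          go (gains-Q h) = ≤-trans (≤-trans (≤-trans (≤-trans (≤-trans (one h) (m≤m+n _ _)) (m≤n+m _ (𝟙 (gains P Ss A B) * f)))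
            (m≤n+m _ (𝟙 (negligible R A C) * f))) (m≤n+m _ (𝟙 (negligible Q B C) * f))) (m≤n+m _ (𝟙 (negligible P A B) * f))
          go (gains-R h) = ≤-trans (≤-trans (≤-trans (≤-trans (≤-trans (one h) (m≤n+m _ (𝟙 (gains Q Ss B C) * f))) (m≤n+m _ (𝟙 (gains P Ss A B) * f)))
            (m≤n+m _ (𝟙 (negligible R A C) * f))) (m≤n+m _ (𝟙 (negligible Q B C) * f))) (m≤n+m _ (𝟙 (negligible P A B) * f))
          go (many hAB hBC h) = ⊥-elim (few (many-triangles cov A∈ B∈ C∈ 0<N hAB hBC h))

        ∑∑∑ : (List V → List V → List V → ℕ) → ℕ
        ∑∑∑ f = ∑[ A ∈ 𝒜 ] ∑[ B ∈ 𝒜 ] ∑[ C ∈ 𝒜 ] f A B C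

        ∑∑∑-+ : ∀ f g → ∑∑∑ (λ A B C → f A B C + g A B C) ≡ ∑∑∑ f + ∑∑∑ g
        ∑∑∑-+ f g = trans (∑-cong 𝒜 λ {A} _ → trans (∑-cong 𝒜 λ {B} _ → ∑-+ 𝒜 (f A B) (g A B)) (∑-+ 𝒜 _ _)) (∑-+ 𝒜 _ _)

        M≤ : M ≤ nP + (nQ + (nR + (gP + (gQ + gR))))
        M≤ = begin
          M                         ≡⟨ weight-total cov ⟨
          ∑∑∑ weight                ≤⟨ ∑-mono 𝒜 (λ A∈ → ∑-mono 𝒜 λ B∈ → ∑-mono 𝒜 λ C∈ → charge A∈ B∈ C∈) ⟩
          ∑∑∑ Charge                ≡⟨ trans (∑∑∑-+ cP _) (cong₂ _+_ (mass-P cov (negligible P))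
                                      (trans (∑∑∑-+ cQ _) (cong₂ _+_ (mass-Q cov (negligible Q))
                                      (trans (∑∑∑-+ cR _) (cong₂ _+_ (mass-R cov (negligible R))
                                      (trans (∑∑∑-+ dP _) (cong₂ _+_ (mass-P cov (gains P Ss))
                                      (trans (∑∑∑-+ dQ dR) (cong₂ _+_ (mass-Q cov (gains Q Ss))
                                                                      (mass-R cov (gains R Ss)))))))))))  ⟩
          nP + (nQ + (nR + (gP + (gQ + gR)))) ∎

        -- Three relations with 2 N² each make 6 N², and twice that is the 12 N² of `far`.
        negligible≤ : m * (2 * (nP + (nQ + nR))) ≤ m * M
        negligible≤ = ≤-trans (≤-linear 0
            (+-mono-≤ (*-monoʳ-≤ 2 (negligible-mass cov len P))
            (+-mono-≤ (*-monoʳ-≤ 2 (negligible-mass cov len Q)) (*-monoʳ-≤ 2 (negligible-mass cov len R))))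
            (identity m nP nQ nR (N * N))) far
          where
          identity : ∀ m p q r n → m * (2 * (p + (q + r))) + (2 * (2 * n) + (2 * (2 * n) + 2 * (2 * n))) + 0
                     ≡ 12 * n + (2 * (m * p) + (2 * (m * q) + 2 * (m * r)))
          identity = solve-∀

        Φ-step : 64 * Φ 𝒜 + m * M ≤ 64 * Φ (refine Ss 𝒜)
        Φ-step = ≤-linear 0
          (+-mono-≤ (*-monoʳ-≤ (2 * m) M≤) (+-mono-≤ negligible≤
            (+-mono-≤ (*-monoʳ-≤ 2 (potential-step P Ss 𝒜))
            (+-mono-≤ (*-monoʳ-≤ 2 (potential-step Q Ss 𝒜)) (*-monoʳ-≤ 2 (potential-step R Ss 𝒜))))))
          (identity m M nP nQ nR gP gQ gR (potential L P 𝒜 𝒜) (potential L Q 𝒜 𝒜) (potential L R 𝒜 𝒜)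
            (potential L P (refine Ss 𝒜) (refine Ss 𝒜)) (potential L Q (refine Ss 𝒜) (refine Ss 𝒜)) (potential L R (refine Ss 𝒜) (refine Ss 𝒜)))
          where
          identity : ∀ m M nP nQ nR gP gQ gR p q r p′ q′ r′ →
            64 * (p + (q + r)) + m * M
              + (2 * m * (nP + (nQ + (nR + (gP + (gQ + gR))))) + (m * M
              + (2 * (32 * p′) + (2 * (32 * q′) + 2 * (32 * r′))))) + 0
            ≡ 64 * (p′ + (q′ + r′))
              + (2 * m * M + (m * (2 * (nP + (nQ + nR)))
              + (2 * (32 * p + m * gP) + (2 * (32 * q + m * gQ) + 2 * (32 * r + m * gR)))))
          identity = solve-∀

    module _
      (K : ℕ → ℕ) (0<K : 0 < K 0)
      (K-step : ∀ s → K s * 2 ^ (K s * (K s * (K s * (4 * k₂)))) ≤ K (suc s)) where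

      private
        K-mono : ∀ s → K s ≤ K (suc s)
        K-mono s = ≤-trans (m≤m*n (K s) (2 ^ (K s * (K s * (K s * (4 * k₂))))) {{m^n≢0 2 (K s * (K s * (K s * (4 * k₂))))}}) (K-step s)

        K-pos : ∀ s → 0 < K s
        K-pos zero    = 0<K
        K-pos (suc s) = <-≤-trans (K-pos s) (K-mono s)

        State : ℕ → Set
        State s = ∃[ 𝒜 ] (Covers 𝒜 vs × length 𝒜 ≤ K s × s * (m * M) ≤ 64 * Φ 𝒜)

      module _ (0<N : 0 < N) (far : 12 * (N * N) ≤ m * M) where

        private
          iterate : ∀ s → N * (N * N) ≤ D (K s) * t ⊎ State s
          iterate zero = inj₂ (vs ∷ [] , covers (λ f → +-identityʳ _) , 0<K , z≤n)
          iterate (suc s) with iterate s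
          ... | inj₁ h = inj₁ (≤-trans h (*-monoˡ-≤ t (*-monoˡ-≤ (2 * k₂ * k₃)
                           (^-monoˡ-≤ 3 (*-monoʳ-≤ m (*-mono-≤ (K-mono s) (K-mono s)))))))
          ... | inj₂ (𝒜 , cov , len , big) with Step.improve (K s) (K-pos s) 0<N far cov len
          ...   | inj₁ h = inj₁ (≤-trans h (*-monoˡ-≤ t (*-monoˡ-≤ (2 * k₂ * k₃)
                           (^-monoˡ-≤ 3 (*-monoʳ-≤ m (*-mono-≤ (K-mono s) (K-mono s)))))))
          ...   | inj₂ (𝒜′ , cov′ , len′ , big′) = inj₂ (𝒜′ , cov′ , ≤-trans len′ (K-step s) ,
                    ≤-trans (≤-trans (+-monoʳ-≤ (m * M) big) (≤-reflexive (+-comm (m * M) _))) big′)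

          0<mM : 0 < m * M
          0<mM = <-≤-trans (*-mono-< {0} {12} (s≤s z≤n) (*-mono-< 0<N 0<N)) far

        -- By `Φ≤`, 64 Φ never exceeds 64 · 3 · (L + 1) m M, and 64 · 3 = 192; one round more than
        -- 192 (L + 1) is impossible.
        removal : N * (N * N) ≤ D (K (suc (192 * suc L))) * t
        removal with iterate (suc (192 * suc L))
        ... | inj₁ h = h
        ... | inj₂ (𝒜 , cov , len , big) = ⊥-elim (<-irrefl refl (begin-strict
          192 * suc L * (m * M)              <⟨ +-monoˡ-< _ 0<mM ⟩
          suc (192 * suc L) * (m * M)        ≤⟨ big ⟩
          64 * Φ 𝒜                           ≤⟨ *-monoʳ-≤ 64 (Φ≤ cov) ⟩
          64 * (3 * (suc L * (m * M)))       ≡⟨ *-assoc 64 3 (suc L * (m * M)) ⟨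
          192 * (suc L * (m * M))            ≡⟨ *-assoc 192 (suc L) (m * M) ⟨
          192 * suc L * (m * M)              ∎))
          where open ≤-Reasoning

  -- Tower bounds for the number of parts.

  n<2^n : ∀ n → n < 2 ^ n
  n<2^n zero    = s≤s z≤n
  n<2^n (suc n) = ≤-trans (+-mono-≤ (≤-trans (s≤s z≤n) (n<2^n n)) (n<2^n n))
                          (≤-reflexive (cong (2 ^ n +_) (sym (+-identityʳ (2 ^ n)))))

  n<tower : ∀ n → n < tower n
  n<tower zero    = s≤s z≤n
  n<tower (suc n) = ≤-trans (s≤s (n<tower n)) (n<2^n (tower n))

  tower-mono : ∀ {m n} → m ≤ n → tower m ≤ tower n
  tower-mono {n = zero}  z≤n       = ≤-refl
  tower-mono {n = suc n} z≤n       = ≤-trans (s≤s z≤n) (n<tower (suc n))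
  tower-mono             (s≤s m≤n) = ^-monoʳ-≤ 2 (tower-mono m≤n)

  -- The induction cannot start below 7. The factor 16 leaves room for every power of x that occurs
  -- below, the largest being the tenth.
  16n≤2^n : ∀ n → 16 * (7 + n) ≤ 2 ^ (7 + n)
  16n≤2^n zero    = ≤ᵇ⇒≤ (16 * 7) (2 ^ 7) _
  16n≤2^n (suc n) = begin
    16 * (7 + suc n)                      ≤⟨ m≤m+n _ (16 * (6 + n)) ⟩
    16 * (7 + suc n) + 16 * (6 + n)       ≡⟨ identity n ⟩
    2 * (16 * (7 + n))                    ≤⟨ *-monoʳ-≤ 2 (16n≤2^n n) ⟩
    2 * 2 ^ (7 + n)                       ≡⟨⟩
    2 ^ suc (7 + n)                       ≡⟨ cong (2 ^_) (+-suc 7 n) ⟨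
    2 ^ (7 + suc n)                       ∎
    where
    open ≤-Reasoning
    identity : ∀ n → 16 * (7 + suc n) + 16 * (6 + n) ≡ 2 * (16 * (7 + n))
    identity = solve-∀

  16*≤2^ : ∀ {Y} → 7 ≤ Y → 16 * Y ≤ 2 ^ Y
  16*≤2^ {Y} 7≤Y = subst (λ n → 16 * n ≤ 2 ^ n) (m+[n∸m]≡n 7≤Y) (16n≤2^n (Y ∸ 7))

  tower-≥ : ∀ h → 2 ^ h ≤ tower (suc h)
  tower-≥ h = ^-monoʳ-≤ 2 (<⇒≤ (n<tower h))

  module _ {y : ℕ} (7≤y : 7 ≤ y) where

    private
      x : ℕ
      x = 2 ^ y

      2^[k*y]≤2^x : ∀ {k} → k ≤ 16 → 2 ^ (k * y) ≤ 2 ^ x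
      2^[k*y]≤2^x k≤16 = ^-monoʳ-≤ 2 (≤-trans (*-monoˡ-≤ y k≤16) (16*≤2^ 7≤y))

      x^k≤2^x : ∀ {k} → k ≤ 16 → x ^ k ≤ 2 ^ x
      x^k≤2^x {k} k≤16 = ≤-trans (≤-reflexive (trans (^-*-assoc 2 y k) (cong (2 ^_) (*-comm y k)))) (2^[k*y]≤2^x {k} k≤16)

    -- For x = 2^y a power x^k is 2^(k y), and k y ≤ 16 y ≤ x. So keeping the number of parts a
    -- power of two makes a refinement cost just two exponentials: the exponent is at most x + x⁴ ≤
    -- x⁵ ≤ 2^x.
    refinement-bound : ∀ {c} → c ≤ x → x * 2 ^ (x * (x * (x * c))) ≤ 2 ^ (2 ^ x)
    refinement-bound {c} c≤x = begin
      x * 2 ^ (x * (x * (x * c)))      ≤⟨ *-mono-≤ (<⇒≤ (n<2^n x)) (^-monoʳ-≤ 2 exponent) ⟩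
      2 ^ x * 2 ^ (x ^ 4)              ≡⟨ ^-distribˡ-+-* 2 x (x ^ 4) ⟨
      2 ^ (x + x ^ 4)                  ≤⟨ ^-monoʳ-≤ 2 (≤-trans sum≤ (x^k≤2^x {5} (≤ᵇ⇒≤ 5 16 _))) ⟩
      2 ^ (2 ^ x)                      ∎
      where
      open ≤-Reasoning
      exponent : x * (x * (x * c)) ≤ x ^ 4
      exponent = *-monoʳ-≤ x (*-monoʳ-≤ x (*-monoʳ-≤ x (≤-trans c≤x (≤-reflexive (sym (*-identityʳ x))))))
      2≤x : 2 ≤ x
      2≤x = ^-monoʳ-≤ 2 {1} (≤-trans (≤ᵇ⇒≤ 1 7 _) 7≤y)
      sum≤ : x + x ^ 4 ≤ x ^ 5
      sum≤ = begin
        x + x ^ 4          ≤⟨ +-monoˡ-≤ (x ^ 4) x≤x⁴ ⟩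
        x ^ 4 + x ^ 4      ≡⟨ cong (x ^ 4 +_) (+-identityʳ (x ^ 4)) ⟨
        2 * x ^ 4          ≤⟨ *-monoˡ-≤ (x ^ 4) 2≤x ⟩
        x ^ 5              ∎
        where
        x≤x⁴ : x ≤ x ^ 4
        x≤x⁴ = ≤-trans (≤-reflexive (sym (*-identityʳ x)))
                       (*-monoʳ-≤ x (m^n>0 x {{>-nonZero (≤-trans (s≤s z≤n) 2≤x)}} 3))

    count-bound : ∀ {m c} → m ≤ x → c ≤ x → (m * (x * x)) ^ 3 * c ≤ 2 ^ x
    count-bound {m} {c} m≤x c≤x = begin
      (m * (x * x)) ^ 3 * c     ≤⟨ *-mono-≤ (^-monoˡ-≤ 3 (*-monoˡ-≤ (x * x) m≤x)) c≤x ⟩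
      (x * (x * x)) ^ 3 * x     ≡⟨ identity x ⟩
      x ^ 10                    ≤⟨ x^k≤2^x {10} (≤ᵇ⇒≤ 10 16 _) ⟩
      2 ^ x                     ∎
      where
      open ≤-Reasoning
      identity : ∀ x → (x * (x * x)) * ((x * (x * x)) * ((x * (x * x)) * 1)) * x
               ≡ x * (x * (x * (x * (x * (x * (x * (x * (x * (x * 1)))))))))
      identity = solve-∀

  module Height (L : ℕ) where

    open Constants (2 ^ L)

    -- The largest constant is 2 k₂ k₃ = 2^27 m⁵ = 2^(5 L + 27). The `suc` is the exponential of
    -- `tower-≥`, and it exposes `K s` as a power of two.
    base : ℕ
    base = suc (5 * L + 27)

    -- Two levels per round pay for the two exponentials of `refinement-bound`.
    K : ℕ → ℕ
    K s = tower (2 * s + base)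

    private
      m : ℕ
      m = 2 ^ L

      m≡ : ∀ k → 2 ^ (k * L) ≡ m ^ k
      m≡ k = trans (cong (2 ^_) (*-comm k L)) (sym (^-*-assoc 2 L k))

      base≤ : 2 ^ (5 * L + 27) ≤ tower base
      base≤ = tower-≥ (5 * L + 27)

      constants≤ : 2 * k₂ * k₃ ≤ tower base
      constants≤ = ≤-trans (≤-reflexive (trans (identity m)
          (trans (cong (_* 2 ^ 27) (sym (m≡ 5))) (sym (^-distribˡ-+-* 2 (5 * L) 27))))) base≤
        where
        identity : ∀ m → 2 * (32 * m * (32 * m)) * (64 * m * (32 * m * (32 * m)))
                 ≡ m * (m * (m * (m * (m * 1)))) * 134217728
        identity = solve-∀

      k₂≤ : 4 * k₂ ≤ tower base
      k₂≤ = ≤-trans (≤-reflexive (trans (identity m)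
          (trans (cong (_* 2 ^ 12) (sym (m≡ 2))) (sym (^-distribˡ-+-* 2 (2 * L) 12)))))
          (≤-trans (^-monoʳ-≤ 2 (+-mono-≤ (*-monoˡ-≤ L (≤ᵇ⇒≤ 2 5 _)) (≤ᵇ⇒≤ 12 27 _))) base≤)
        where
        identity : ∀ m → 4 * (32 * m * (32 * m)) ≡ m * (m * 1) * 4096
        identity = solve-∀

      m≤ : m ≤ tower base
      m≤ = ≤-trans (^-monoʳ-≤ 2 (≤-trans (m≤m+n L (4 * L)) (m≤m+n (5 * L) 27))) base≤

      7≤ : ∀ s → 7 ≤ tower (2 * s + (5 * L + 27))
      7≤ s = ≤-trans (≤ᵇ⇒≤ 7 27 _) (≤-trans (≤-trans (m≤n+m 27 (5 * L)) (m≤n+m (5 * L + 27) (2 * s)))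
               (<⇒≤ (n<tower (2 * s + (5 * L + 27)))))

      K≡ : ∀ s → K s ≡ 2 ^ tower (2 * s + (5 * L + 27))
      K≡ s = cong tower (+-suc (2 * s) (5 * L + 27))

      base≤K : ∀ {n} s → n ≤ tower base → n ≤ 2 ^ tower (2 * s + (5 * L + 27))
      base≤K s h = ≤-trans h (≤-trans (tower-mono (m≤n+m base (2 * s))) (≤-reflexive (K≡ s)))

    K-positive : 0 < K 0
    K-positive = ≤-trans (s≤s z≤n) (n<tower base)

    K-step : ∀ s → K s * 2 ^ (K s * (K s * (K s * (4 * k₂)))) ≤ K (suc s)
    K-step s = subst₂ (λ x y → x * 2 ^ (x * (x * (x * (4 * k₂)))) ≤ y) (sym (K≡ s)) (sym K-suc)
      (refinement-bound (7≤ s) (base≤K s k₂≤))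
      where
      K-suc : K (suc s) ≡ 2 ^ (2 ^ (2 ^ tower (2 * s + (5 * L + 27))))
      K-suc = cong tower (identity s (5 * L + 27))
        where
        identity : ∀ s b → 2 * suc s + suc b ≡ suc (suc (suc (2 * s + b)))
        identity = solve-∀

    K-count : ∀ s → (m * (K s * K s)) ^ 3 * (2 * k₂ * k₃) ≤ tower (suc (2 * s + base))
    K-count s = subst (λ x → (m * (x * x)) ^ 3 * (2 * k₂ * k₃) ≤ 2 ^ x) (sym (K≡ s))
      (count-bound (7≤ s) (base≤K s m≤) (base≤K s constants≤))

  -- There are 192 (L + 1) + 1 rounds, and the outer `suc` is the exponential of `count-bound`.
  height : ℕ → ℕ
  height L = suc (2 * suc (192 * suc L) + Height.base L)

  triangle-removal : ∀ {V : Set} (vs : List V) (P Q R : V → V → Bool) (F : V → V → V → ℕ) →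
    (∀ u v → ∑ vs (λ w → F u v w) ≡ 𝟙 (P u v)) →
    (∀ v w → ∑ vs (λ u → F u v w) ≡ 𝟙 (Q v w)) →
    (∀ u w → ∑ vs (λ v → F u v w) ≡ 𝟙 (R u w)) →
    ∀ L → 0 < length vs →
    12 * (length vs * length vs) ≤ 2 ^ L * ∑[ u ∈ vs ] ∑[ v ∈ vs ] ∑[ w ∈ vs ] F u v w →
    length vs * (length vs * length vs) ≤ tower (height L) * triangles P Q R vs vs vs
  triangle-removal vs P Q R F F-P F-Q F-R L 0<N far =
    ≤-trans (Removal.removal vs P Q R F F-P F-Q F-R L (Height.K L) (Height.K-positive L) (Height.K-step L) 0<N far)
            (*-monoˡ-≤ (triangles P Q R vs vs vs) (Height.K-count L (suc (192 * suc L))))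

  -- Signed graphs, subgraphs and edge deletion.

  private variable
    N : ℕ

  _≡ᶠ_ : Fin N → Fin N → Bool
  u ≡ᶠ v = does (u Fin.≟ v)

  ∑-allFin-suc : ∀ n (f : Fin (suc n) → ℕ) → ∑ (allFin (suc n)) f ≡ f zero + ∑ (allFin n) (f ∘ suc)
  ∑-allFin-suc n f = cong (f zero +_) (trans (cong (λ xs → ∑ xs f) (sym (map-tabulate id suc))) (∑-map suc (allFin n) f))

  count-≡ᶠ : ∀ (v : Fin N) → ∑[ u ∈ allFin N ] 𝟙 (u ≡ᶠ v) ≡ 1
  count-≡ᶠ {suc N} zero = trans (∑-allFin-suc N (λ u → 𝟙 (u ≡ᶠ zero))) (cong suc (∑-0 (allFin N)))
  count-≡ᶠ {suc N} (suc v) = trans (∑-allFin-suc N (λ u → 𝟙 (u ≡ᶠ suc v))) (count-≡ᶠ v)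

  hasSign : Sign → Maybe Sign → Bool
  hasSign s l = does (Maybe.≡-dec Sign._≟_ l (just s))

  hasSign-just : ∀ s → hasSign s (just s) ≡ true
  hasSign-just s with s Sign.≟ s
  ... | yes _ = refl
  ... | no  h = ⊥-elim (h refl)

  hasSign-elim : ∀ s l → hasSign s l ≡ true → l ≡ just s
  hasSign-elim s l h with Maybe.≡-dec Sign._≟_ l (just s)
  hasSign-elim s l h  | yes eq = eq
  hasSign-elim s l () | no _

  infix 4 _⊑_

  _⊑_ : SignedGraph N → SignedGraph N → Set
  H ⊑ G = ∀ u v → label H u v ≡ nothing ⊎ label H u v ≡ label G u v

  ⊑-trans : ∀ {G H K : SignedGraph N} → K ⊑ H → H ⊑ G → K ⊑ G
  ⊑-trans K⊑H H⊑G u v with K⊑H u v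
  ... | inj₁ eq = inj₁ eq
  ... | inj₂ eq with H⊑G u v
  ...   | inj₁ eq′ = inj₁ (trans eq eq′)
  ...   | inj₂ eq′ = inj₂ (trans eq eq′)

  ⊑-nothing : ∀ {G H : SignedGraph N} → H ⊑ G → ∀ {u v} → label G u v ≡ nothing → label H u v ≡ nothing
  ⊑-nothing H⊑G {u} {v} eq with H⊑G u v
  ... | inj₁ eq′ = eq′
  ... | inj₂ eq′ = trans eq′ eq

  ⊑-just : ∀ {G H : SignedGraph N} → H ⊑ G → ∀ {u v s} → label H u v ≡ just s → label G u v ≡ just s
  ⊑-just H⊑G {u} {v} eq with H⊑G u v
  ... | inj₁ eq′ with () ← trans (sym eq) eq′
  ... | inj₂ eq′ = trans (sym eq′) eq

  sameEdge : (v w x y : Fin N) → Bool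
  sameEdge v w x y = ((x ≡ᶠ v) ∧ (y ≡ᶠ w)) ∨ ((x ≡ᶠ w) ∧ (y ≡ᶠ v))

  sameEdge-sym : ∀ (v w x y : Fin N) → sameEdge v w x y ≡ sameEdge v w y x
  sameEdge-sym v w x y = trans (∨-comm ((x ≡ᶠ v) ∧ (y ≡ᶠ w)) _)
    (cong₂ _∨_ (∧-comm (x ≡ᶠ w) _) (∧-comm (x ≡ᶠ v) _))

  ≡ᶠ-refl : ∀ (v : Fin N) → (v ≡ᶠ v) ≡ true
  ≡ᶠ-refl v with v Fin.≟ v
  ... | yes _ = refl
  ... | no  h = ⊥-elim (h refl)

  sameEdge-refl : ∀ (v w : Fin N) → sameEdge v w v w ≡ true
  sameEdge-refl v w rewrite ≡ᶠ-refl v | ≡ᶠ-refl w = refl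

  sameEdge-other : ∀ (v w x y : Fin N) → ¬ ((x ≡ v × y ≡ w) ⊎ (x ≡ w × y ≡ v)) → sameEdge v w x y ≡ false
  sameEdge-other v w x y h with x Fin.≟ v | y Fin.≟ w | x Fin.≟ w | y Fin.≟ v
  ... | yes p | yes q | _     | _     = ⊥-elim (h (inj₁ (p , q)))
  ... | yes _ | no _  | yes p | yes q = ⊥-elim (h (inj₂ (p , q)))
  ... | yes _ | no _  | yes _ | no _  = refl
  ... | yes _ | no _  | no _  | _     = refl
  ... | no _  | _     | yes p | yes q = ⊥-elim (h (inj₂ (p , q)))
  ... | no _  | _     | yes _ | no _  = refl
  ... | no _  | _     | no _  | _     = refl

  deleteEdge : SignedGraph N → Fin N → Fin N → SignedGraph N
  deleteEdge G v w .label x y = if sameEdge v w x y then nothing else label G x y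
  deleteEdge G v w .symm x y =
    cong₂ (λ b l → if b then nothing else l) (sameEdge-sym v w x y) (symm G x y)
  deleteEdge G v w .loopless x with sameEdge v w x x
  ... | true  = refl
  ... | false = loopless G x

  ⟶-trans : ∀ {G H K : SignedGraph N} {k l} → G ⟶[ k ] H → H ⟶[ l ] K → G ⟶[ k + l ] K
  ⟶-trans done       s = s
  ⟶-trans (step m r) s = step m (⟶-trans r s)

  -- A modification has to change the label, so a pair without an edge takes zero steps; hence
  -- `k ≤ 1` instead of an equation.
  remove : ∀ (G : SignedGraph N) v w →
           ∃[ k ] ∃[ H ] (k ≤ 1 × G ⟶[ k ] H × H ⊑ G × label H v w ≡ nothing)
  remove G v w with label G v w in eq
  ... | nothing = 0 , G , z≤n , done , (λ _ _ → inj₂ refl) , eq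
  ... | just s  = 1 , H , ≤-refl , step modification done , H⊑G , deleted
    where
    H : SignedGraph _
    H = deleteEdge G v w
    deleted : label H v w ≡ nothing
    deleted rewrite sameEdge-refl v w = refl
    H⊑G : H ⊑ G
    H⊑G x y with sameEdge v w x y
    ... | true  = inj₁ refl
    ... | false = inj₂ refl
    modification : EdgeModification G H
    modification = record
      { v = v
      ; w = w
      ; modified  = λ same → case-nothing (trans (sym eq) (trans same deleted))
      ; unchanged = λ x y h → sym (cong (λ b → if b then nothing else label G x y) (sameEdge-other v w x y h))
      }
      where
      case-nothing : ¬ (just s ≡ nothing)
      case-nothing ()

  -- Greedy packing of signed triangles.

  module Greedy (T : SignedTriangle) where

    Triangle : SignedGraph N → Fin N × Fin N × Fin N → Set
    Triangle G (u , v , w) = label G u v ≡ just (sign₁₂ T) × label G v w ≡ just (sign₂₃ T) × label G u w ≡ just (sign₁₃ T)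

    isTriangle : SignedGraph N → Fin N → Fin N → Fin N → Bool
    isTriangle G u v w = (hasSign (sign₁₂ T) (label G u v) ∧ hasSign (sign₁₃ T) (label G u w)) ∧ hasSign (sign₂₃ T) (label G v w)

    isTriangle-elim : ∀ (G : SignedGraph N) u v w → isTriangle G u v w ≡ true → Triangle G (u , v , w)
    isTriangle-elim G u v w h =
        hasSign-elim _ _ (∧-trueˡ (∧-trueˡ h))
      , hasSign-elim _ _ (∧-trueʳ {hasSign (sign₁₂ T) (label G u v) ∧ hasSign (sign₁₃ T) (label G u w)} h)
      , hasSign-elim _ _ (∧-trueʳ {hasSign (sign₁₂ T) (label G u v)} (∧-trueˡ h))

    isTriangle-intro : ∀ (G : SignedGraph N) {u v w} → Triangle G (u , v , w) → isTriangle G u v w ≡ true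
    isTriangle-intro G (e₁ , e₂ , e₃) rewrite e₁ | e₂ | e₃
      | hasSign-just (sign₁₂ T) | hasSign-just (sign₂₃ T) | hasSign-just (sign₁₃ T) = refl

    Triangle-⊑ : ∀ {G H : SignedGraph N} → H ⊑ G → ∀ {t} → Triangle H t → Triangle G t
    Triangle-⊑ {G = G} {H} H⊑G (e₁ , e₂ , e₃) =
      ⊑-just {G = G} {H} H⊑G e₁ , ⊑-just {G = G} {H} H⊑G e₂ , ⊑-just {G = G} {H} H⊑G e₃

    -- The family is kept as a function `F` on ordered triples. Bounding its marginals by indicators
    -- of edges of the right sign expresses both that it is edge-disjoint in each role and that it
    -- lies inside `G`.
    record Packing (G : SignedGraph N) (ts : List (Fin N × Fin N × Fin N)) : Set where
      field
        F         : Fin N → Fin N → Fin N → ℕ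
        F₁₂       : ∀ u v → ∑ (allFin N) (λ w → F u v w) ≤ 𝟙 (hasSign (sign₁₂ T) (label G u v))
        F₂₃       : ∀ v w → ∑ (allFin N) (λ u → F u v w) ≤ 𝟙 (hasSign (sign₂₃ T) (label G v w))
        F₁₃       : ∀ u w → ∑ (allFin N) (λ v → F u v w) ≤ 𝟙 (hasSign (sign₁₃ T) (label G u w))
        {k}       : ℕ
        {rest}    : SignedGraph N
        reach     : G ⟶[ k ] rest
        rest⊑     : rest ⊑ G
        destroyed : ∀ {t} → t ∈ ts → ¬ Triangle rest t
        cost      : k ≤ 3 * ∑[ u ∈ allFin N ] ∑[ v ∈ allFin N ] ∑[ w ∈ allFin N ] F u v w

    -- Deleting the edge frees one unit at the ordered pair (a , b), which the new triangle uses up;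
    -- elsewhere a label can only disappear. This keeps the marginals bounded along the induction.
    absorb : ∀ {G H : SignedGraph N} → H ⊑ G → ∀ {s a b} → label G a b ≡ just s → label H a b ≡ nothing →
             ∀ u v → 𝟙 (hasSign s (label H u v)) + 𝟙 (u ≡ᶠ a) * 𝟙 (v ≡ᶠ b) ≤ 𝟙 (hasSign s (label G u v))
    absorb {G = G} {H} H⊑G {s} {a} {b} inG notInH u v with u Fin.≟ a | v Fin.≟ b
    ... | yes refl | yes refl rewrite inG | notInH | hasSign-just s = ≤-refl
    ... | yes _    | no _     = kept
      where
      kept : 𝟙 (hasSign s (label H u v)) + 0 ≤ 𝟙 (hasSign s (label G u v))
      kept with H⊑G u v
      ... | inj₁ eq rewrite eq = z≤n
      ... | inj₂ eq rewrite eq = ≤-reflexive (+-identityʳ _)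
    ... | no _     | _        = kept
      where
      kept : 𝟙 (hasSign s (label H u v)) + 0 ≤ 𝟙 (hasSign s (label G u v))
      kept with H⊑G u v
      ... | inj₁ eq rewrite eq = z≤n
      ... | inj₂ eq rewrite eq = ≤-reflexive (+-identityʳ _)

    ∑-point : ∀ (n : ℕ) (w : Fin N) → ∑[ x ∈ allFin N ] (n * 𝟙 (x ≡ᶠ w)) ≡ n
    ∑-point {N} n w = trans (∑-*ˡ (allFin N) n (λ x → 𝟙 (x ≡ᶠ w))) (trans (cong (n *_) (count-≡ᶠ w)) (*-identityʳ n))

    greedy : ∀ (ts : List (Fin N × Fin N × Fin N)) (G : SignedGraph N) → Packing G ts
    greedy {N} [] G = record
      { F = λ _ _ _ → 0
      ; F₁₂ = λ _ _ → ≤-trans (≤-reflexive (∑-0 (allFin N))) z≤n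
      ; F₂₃ = λ _ _ → ≤-trans (≤-reflexive (∑-0 (allFin N))) z≤n
      ; F₁₃ = λ _ _ → ≤-trans (≤-reflexive (∑-0 (allFin N))) z≤n
      ; reach = done
      ; rest⊑ = λ _ _ → inj₂ refl
      ; destroyed = λ ()
      ; cost = z≤n
      }
    greedy {N} ((a , b , c) ∷ ts) G with isTriangle G a b c in eq
    ... | false = record
      { F = F ; F₁₂ = F₁₂ ; F₂₃ = F₂₃ ; F₁₃ = F₁₃ ; reach = reach ; rest⊑ = rest⊑ ; cost = cost
      -- A triple that is no triangle of `G` cannot become one, as the remaining graph is a
      -- subgraph.
      ; destroyed = λ { (here refl) t → not-both (trans (sym (isTriangle-intro G (Triangle-⊑ {G = G} {rest} rest⊑ t))) eq)
                      ; (there t∈) → destroyed t∈ }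
      }
      where
      open Packing (greedy ts G)
      not-both : ¬ (true ≡ false)
      not-both ()
    ... | true with remove G a b
    ...   | k₁ , G₁ , k₁≤ , r₁ , G₁⊑ , e₁ with remove G₁ b c
    ...     | k₂ , G₂ , k₂≤ , r₂ , G₂⊑ , e₂ with remove G₂ a c
    ...       | k₃ , G₃ , k₃≤ , r₃ , G₃⊑ , e₃ = record
      { F = F′
      ; F₁₂ = marginal₁₂
      ; F₂₃ = marginal₂₃
      ; F₁₃ = marginal₁₃
      ; reach = ⟶-trans (⟶-trans r₁ (⟶-trans r₂ r₃)) reach
      ; rest⊑ = ⊑-trans {G = G} {G₃} {rest} rest⊑ G₃⊑G
      ; destroyed = λ { (here refl) (t , _) → no-label (trans (sym t) (⊑-nothing {G = G₃} {rest} rest⊑ gone₁₂))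
                      ; (there t∈) → destroyed t∈ }
      ; cost = cost′
      }
      where
      open Packing (greedy ts G₃)
      triangle : Triangle G (a , b , c)
      triangle = isTriangle-elim G a b c eq
      no-label : ∀ {s : Sign} → ¬ (just s ≡ nothing)
      no-label ()
      G₃⊑G : G₃ ⊑ G
      G₃⊑G = ⊑-trans {G = G} {G₂} {G₃} G₃⊑ (⊑-trans {G = G} {G₁} {G₂} G₂⊑ G₁⊑)
      gone₁₂ : label G₃ a b ≡ nothing
      gone₁₂ = ⊑-nothing {G = G₂} {G₃} G₃⊑ (⊑-nothing {G = G₁} {G₂} G₂⊑ e₁)
      gone₂₃ : label G₃ b c ≡ nothing
      gone₂₃ = ⊑-nothing {G = G₂} {G₃} G₃⊑ e₂

      δ : Fin N → Fin N → Fin N → ℕ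
      δ u v w = 𝟙 (u ≡ᶠ a) * 𝟙 (v ≡ᶠ b) * 𝟙 (w ≡ᶠ c)
      F′ : Fin N → Fin N → Fin N → ℕ
      F′ u v w = F u v w + δ u v w

      marginal₁₂ : ∀ u v → ∑ (allFin N) (λ w → F′ u v w) ≤ 𝟙 (hasSign (sign₁₂ T) (label G u v))
      marginal₁₂ u v = ≤-trans (≤-reflexive (∑-+ (allFin N) (F u v) (δ u v)))
        (≤-trans (+-mono-≤ (F₁₂ u v) (≤-reflexive (∑-point (𝟙 (u ≡ᶠ a) * 𝟙 (v ≡ᶠ b)) c)))
                 (absorb {G = G} {G₃} G₃⊑G (proj₁ triangle) gone₁₂ u v))

      marginal₂₃ : ∀ v w → ∑ (allFin N) (λ u → F′ u v w) ≤ 𝟙 (hasSign (sign₂₃ T) (label G v w))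
      marginal₂₃ v w = ≤-trans (≤-reflexive (∑-+ (allFin N) (λ u → F u v w) (λ u → δ u v w)))
        (≤-trans (+-mono-≤ (F₂₃ v w) (≤-reflexive (trans
                   (∑-cong (allFin N) λ {u} _ → reorder (𝟙 (u ≡ᶠ a)) (𝟙 (v ≡ᶠ b)) (𝟙 (w ≡ᶠ c)))
                   (∑-point (𝟙 (v ≡ᶠ b) * 𝟙 (w ≡ᶠ c)) a))))
                 (absorb {G = G} {G₃} G₃⊑G (proj₁ (proj₂ triangle)) gone₂₃ v w))
        where
        reorder : ∀ x y z → x * y * z ≡ y * z * x
        reorder = solve-∀

      marginal₁₃ : ∀ u w → ∑ (allFin N) (λ v → F′ u v w) ≤ 𝟙 (hasSign (sign₁₃ T) (label G u w))
      marginal₁₃ u w = ≤-trans (≤-reflexive (∑-+ (allFin N) (λ v → F u v w) (λ v → δ u v w)))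
        (≤-trans (+-mono-≤ (F₁₃ u w) (≤-reflexive (trans
                   (∑-cong (allFin N) λ {v} _ → reorder (𝟙 (u ≡ᶠ a)) (𝟙 (v ≡ᶠ b)) (𝟙 (w ≡ᶠ c)))
                   (∑-point (𝟙 (u ≡ᶠ a) * 𝟙 (w ≡ᶠ c)) b))))
                 (absorb {G = G} {G₃} G₃⊑G (proj₂ (proj₂ triangle)) e₃ u w))
        where
        reorder : ∀ x y z → x * y * z ≡ x * z * y
        reorder = solve-∀

      size size′ : ℕ
      size  = ∑[ u ∈ allFin N ] ∑[ v ∈ allFin N ] ∑[ w ∈ allFin N ] F u v w
      size′ = ∑[ u ∈ allFin N ] ∑[ v ∈ allFin N ] ∑[ w ∈ allFin N ] F′ u v w

      size-suc : size′ ≡ size + 1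
      size-suc = begin
        size′
          ≡⟨ ∑-cong₂ (allFin N) (allFin N) (λ {u} {v} _ _ → trans (∑-+ (allFin N) (F u v) (δ u v))
               (cong (∑ (allFin N) (F u v) +_) (∑-point (𝟙 (u ≡ᶠ a) * 𝟙 (v ≡ᶠ b)) c))) ⟩
        ∑[ u ∈ allFin N ] ∑[ v ∈ allFin N ] (∑ (allFin N) (F u v) + 𝟙 (u ≡ᶠ a) * 𝟙 (v ≡ᶠ b))
          ≡⟨ ∑-cong (allFin N) (λ {u} _ → trans (∑-+ (allFin N) (λ v → ∑ (allFin N) (F u v)) (λ v → 𝟙 (u ≡ᶠ a) * 𝟙 (v ≡ᶠ b)))
               (cong (∑[ v ∈ allFin N ] ∑ (allFin N) (F u v) +_) (∑-point (𝟙 (u ≡ᶠ a)) b))) ⟩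
        ∑[ u ∈ allFin N ] (∑[ v ∈ allFin N ] ∑ (allFin N) (F u v) + 𝟙 (u ≡ᶠ a))
          ≡⟨ ∑-+ (allFin N) (λ u → ∑[ v ∈ allFin N ] ∑ (allFin N) (F u v)) (λ u → 𝟙 (u ≡ᶠ a)) ⟩
        size + ∑[ u ∈ allFin N ] 𝟙 (u ≡ᶠ a)
          ≡⟨ cong (size +_) (count-≡ᶠ a) ⟩
        size + 1 ∎
        where open ≡-Reasoning

      cost′ : k₁ + (k₂ + k₃) + k ≤ 3 * size′
      cost′ = ≤-trans (+-mono-≤ (+-mono-≤ k₁≤ (+-mono-≤ k₂≤ k₃≤)) cost)
        (≤-reflexive (trans (identity size) (cong (3 *_) (sym size-suc))))
        where
        identity : ∀ n → 3 + 3 * n ≡ 3 * (n + 1)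
        identity = solve-∀

    triangleCount : SignedGraph N → ℕ
    triangleCount {N} G = ∑[ u ∈ allFin N ] ∑[ v ∈ allFin N ] ∑[ w ∈ allFin N ] 𝟙 (isTriangle G u v w)

    -- Destroying all copies costs at most three modifications per packed triangle, so a far graph
    -- has a large packing. The triangles that removal then counts have their sides in the supports
    -- of the marginals, hence are copies of T.
    many-triangles : ∀ {N} (G : SignedGraph N) ℓ → 0 < N →
      (∀ {k H} → G ⟶[ k ] H → TriangleFree T H → N * N ≤ k * 2 ^ ℓ) →
      N * (N * N) ≤ tower (height (ℓ + 6)) * triangleCount G
    many-triangles {N} G ℓ 0<N far = ≤-trans
      (subst (λ n → n * (n * n) ≤ tower (height (ℓ + 6)) * triangles P Q R vs vs vs) length-vs
        (triangle-removal vs P Q R F (exact F₁₂) (exact F₂₃) (exact F₁₃) (ℓ + 6)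
          (subst (0 <_) (sym length-vs) 0<N)
          (subst (λ n → 12 * (n * n) ≤ 2 ^ (ℓ + 6) * size) (sym length-vs) packed)))
      (*-monoʳ-≤ (tower (height (ℓ + 6))) (∑-mono₂ vs vs λ {u} {v} _ _ → ∑-mono vs λ {w} _ →
        𝟙-mono (λ h → cong₂ _∧_ (cong₂ _∧_ (support F₁₂ (∧-trueˡ (∧-trueˡ h)))
                                            (support F₁₃ (∧-trueʳ {P u v} (∧-trueˡ h))))
                                (support F₂₃ (∧-trueʳ {P u v ∧ R u w} h)))))
      where
      vs : List (Fin N)
      vs = allFin N
      length-vs : length vs ≡ N
      length-vs = length-tabulate id
      open Packing (greedy (cartesianProduct vs (cartesianProduct vs vs)) G)
      size = ∑[ u ∈ vs ] ∑[ v ∈ vs ] ∑[ w ∈ vs ] F u v w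
      P Q R : Fin N → Fin N → Bool
      P u v = 1 ≤ᵇ ∑ vs (λ w → F u v w)
      Q v w = 1 ≤ᵇ ∑ vs (λ u → F u v w)
      R u w = 1 ≤ᵇ ∑ vs (λ v → F u v w)

      -- Marginals bounded by 1 coincide with their own indicators, the form that `triangle-removal`
      -- asks for.
      exact : ∀ {g : Fin N → Fin N → ℕ} {p : Fin N → Fin N → Bool} → (∀ u v → g u v ≤ 𝟙 (p u v)) →
              ∀ u v → g u v ≡ 𝟙 (1 ≤ᵇ g u v)
      exact {g} {p} g≤ u v with g u v | g≤ u v
      ... | zero        | _ = refl
      ... | suc zero    | _ = refl
      ... | suc (suc n) | h with s≤s () ← ≤-trans h (𝟙≤1 (p u v))

      support : ∀ {g : Fin N → Fin N → ℕ} {p : Fin N → Fin N → Bool} → (∀ u v → g u v ≤ 𝟙 (p u v)) →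
                ∀ {u v} → (1 ≤ᵇ g u v) ≡ true → p u v ≡ true
      support {g} {p} g≤ {u} {v} h with p u v | ≤-trans (≤ᵇ-true {1} {g u v} h) (g≤ u v)
      ... | true  | _ = refl
      ... | false | ()

      free : TriangleFree T rest
      free (u , v , w , t) = destroyed (∈-cartesianProduct⁺ (∈-allFin u) (∈-cartesianProduct⁺ (∈-allFin v) (∈-allFin w))) t

      -- 12 · 3 = 36 ≤ 64 = 2^6, the origin of `ℓ + 6`.
      packed : 12 * (N * N) ≤ 2 ^ (ℓ + 6) * size
      packed = begin
        12 * (N * N)                  ≤⟨ *-monoʳ-≤ 12 (far reach free) ⟩
        12 * (k * 2 ^ ℓ)              ≤⟨ *-monoʳ-≤ 12 (*-monoˡ-≤ (2 ^ ℓ) cost) ⟩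
        12 * (3 * size * 2 ^ ℓ)       ≤⟨ m≤m+n _ (28 * (size * 2 ^ ℓ)) ⟩
        12 * (3 * size * 2 ^ ℓ) + 28 * (size * 2 ^ ℓ) ≡⟨ identity size (2 ^ ℓ) ⟩
        2 ^ ℓ * 64 * size             ≡⟨ cong (_* size) (^-distribˡ-+-* 2 ℓ 6) ⟨
        2 ^ (ℓ + 6) * size            ∎
        where
        open ≤-Reasoning
        identity : ∀ s x → 12 * (3 * s * x) + 28 * (s * x) ≡ x * 64 * s
        identity = solve-∀

module Probability where

  open import Algebra.Bundles using (CommutativeRing)
  open import Algebra.Definitions.RawMonoid using () renaming (sum to sumᴹ)
  open import Data.Bool using (Bool; true; false; _∧_; if_then_else_)
  open import Data.Integer as ℤ using (ℤ; +_; -[1+_]; +[1+_]; ∣_∣)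
  import Data.Integer.DivMod as ℤ
  import Data.Integer.Properties as ℤ
  open import Data.List using (allFin)
  open import Data.Nat as ℕ using (ℕ; zero; suc; NonZero; s≤s; z≤n)
  open import Data.Nat.Induction using (<-rec)
  open import Data.Nat.Logarithm
    using (⌈log₂_⌉; ⌈log₂⌉-mono-≤; ⌈log₂2^n⌉≡n; ⌈log₂⌈n/2⌉⌉≡⌈log₂n⌉∸1)
  import Data.Nat.Properties as ℕ
  import Data.Nat.Tactic.RingSolver as ℕ-Solver
  open import Data.Rational
    using (ℚ; 0ℚ; 1ℚ; mkℚ; Positive; nonNegative; _≤_; _+_; _*_; _-_; -_; _/_; toℚᵘ; +-0-rawMonoid)
  open import Data.Rational.Properties
  open import Algebra.Properties.Semiring.Sum (CommutativeRing.semiring +-*-commutativeRing)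
    using (*-distribʳ-sum; ∑-distrib-+; sum-cong-≗)
  open import Data.Rational.Solver using (module +-*-Solver)
  import Data.Rational.Unnormalised as ℚᵘ
  open ℚᵘ using (mkℚᵘ; *≡*; *≤*)
  import Data.Rational.Unnormalised.Properties as ℚᵘ
  open import Data.Vec.Functional using (foldr)
  open Counting using (∑; 𝟙; 𝟙≤1; ∑-allFin-suc; hasSign; module Greedy)

  -- Rational averages and amplification by repetition.

  ι : ℕ → ℚ
  ι n = + n / 1

  ιᵘ : ∀ n → toℚᵘ (ι n) ℚᵘ.≃ mkℚᵘ (+ n) 0
  ιᵘ n = toℚᵘ-fromℚᵘ (mkℚᵘ (+ n) 0)

  ι-+ : ∀ m n → ι (m ℕ.+ n) ≡ ι m + ι n
  ι-+ m n = toℚᵘ-injective (begin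
    toℚᵘ (ι (m ℕ.+ n))                ≈⟨ ιᵘ (m ℕ.+ n) ⟩
    mkℚᵘ (+ (m ℕ.+ n)) 0              ≈⟨ *≡* (cong (ℤ._* + 1) (trans (ℤ.pos-+ m n) (sym (cong₂ ℤ._+_ (ℤ.*-identityʳ (+ m)) (ℤ.*-identityʳ (+ n)))))) ⟩
    mkℚᵘ (+ m) 0 ℚᵘ.+ mkℚᵘ (+ n) 0    ≈⟨ ℚᵘ.+-cong (ιᵘ m) (ιᵘ n) ⟨
    toℚᵘ (ι m) ℚᵘ.+ toℚᵘ (ι n)        ≈⟨ toℚᵘ-homo-+ (ι m) (ι n) ⟨
    toℚᵘ (ι m + ι n)                  ∎)
    where open ℚᵘ.≃-Reasoning

  ι-* : ∀ m n → ι (m ℕ.* n) ≡ ι m * ι n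
  ι-* m n = toℚᵘ-injective (begin
    toℚᵘ (ι (m ℕ.* n))                ≈⟨ ιᵘ (m ℕ.* n) ⟩
    mkℚᵘ (+ (m ℕ.* n)) 0              ≈⟨ *≡* (cong (ℤ._* + 1) (ℤ.pos-* m n)) ⟩
    mkℚᵘ (+ m) 0 ℚᵘ.* mkℚᵘ (+ n) 0    ≈⟨ ℚᵘ.*-cong (ιᵘ m) (ιᵘ n) ⟨
    toℚᵘ (ι m) ℚᵘ.* toℚᵘ (ι n)        ≈⟨ toℚᵘ-homo-* (ι m) (ι n) ⟨
    toℚᵘ (ι m * ι n)                  ∎)
    where open ℚᵘ.≃-Reasoning

  ι-mono : ∀ {m n} → m ℕ.≤ n → ι m ≤ ι n
  ι-mono {m} {n} m≤n = toℚᵘ-cancel-≤ (ℚᵘ.≤-respʳ-≃ (ℚᵘ.≃-sym (ιᵘ n)) (ℚᵘ.≤-respˡ-≃ (ℚᵘ.≃-sym (ιᵘ m))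
    (*≤* (ℤ.*-monoʳ-≤-nonNeg (+ 1) (ℤ.+≤+ m≤n)))))

  1/m*ιm : ∀ m .{{_ : NonZero m}} → (+ 1 / m) * ι m ≡ 1ℚ
  1/m*ιm (suc m) = toℚᵘ-injective (begin
    toℚᵘ ((+ 1 / suc m) * ι (suc m))             ≈⟨ toℚᵘ-homo-* (+ 1 / suc m) (ι (suc m)) ⟩
    toℚᵘ (+ 1 / suc m) ℚᵘ.* toℚᵘ (ι (suc m))     ≈⟨ ℚᵘ.*-cong (toℚᵘ-fromℚᵘ (mkℚᵘ (+ 1) m)) (ιᵘ (suc m)) ⟩
    mkℚᵘ (+ 1) m ℚᵘ.* mkℚᵘ (+ suc m) 0           ≈⟨ *≡* (trans (ℤ.*-identityʳ (+ 1 ℤ.* + suc m)) (cong (+ 1 ℤ.*_) (cong +_ (sym (ℕ.*-identityʳ (suc m)))))) ⟩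
    ℚᵘ.1ℚᵘ                                       ∎)
    where open ℚᵘ.≃-Reasoning

  avg : ∀ m .{{_ : NonZero m}} → (Fin m → ℚ) → ℚ
  avg m x = (+ 1 / m) * sumᴹ +-0-rawMonoid x

  avg-cong : ∀ m .{{_ : NonZero m}} {x y : Fin m → ℚ} → (∀ i → x i ≡ y i) → avg m x ≡ avg m y
  avg-cong m x≡y = cong ((+ 1 / m) *_) (sum-cong-≗ x≡y)

  sum-const : ∀ m c → sumᴹ +-0-rawMonoid {m} (λ _ → c) ≡ ι m * c
  sum-const zero    c = sym (*-zeroˡ c)
  sum-const (suc m) c = begin
    c + sumᴹ +-0-rawMonoid {m} (λ _ → c)   ≡⟨ cong₂ _+_ (sym (*-identityˡ c)) (sum-const m c) ⟩
    1ℚ * c + ι m * c                       ≡⟨ *-distribʳ-+ c 1ℚ (ι m) ⟨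
    (1ℚ + ι m) * c                         ≡⟨ cong (_* c) (ι-+ 1 m) ⟨
    ι (suc m) * c                          ∎
    where open ≡-Reasoning

  avg-const : ∀ m .{{_ : NonZero m}} c → avg m (λ _ → c) ≡ c
  avg-const m c = begin
    (+ 1 / m) * sumᴹ +-0-rawMonoid {m} (λ _ → c)  ≡⟨ cong ((+ 1 / m) *_) (sum-const m c) ⟩
    (+ 1 / m) * (ι m * c)                         ≡⟨ *-assoc (+ 1 / m) (ι m) c ⟨
    (+ 1 / m) * ι m * c                           ≡⟨ cong (_* c) (1/m*ιm m) ⟩
    1ℚ * c                                        ≡⟨ *-identityˡ c ⟩
    c                                             ∎
    where open ≡-Reasoning

  avg-*ʳ : ∀ m .{{_ : NonZero m}} x c → avg m x * c ≡ avg m (λ i → x i * c)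
  avg-*ʳ m x c = trans (*-assoc (+ 1 / m) (sumᴹ +-0-rawMonoid x) c) (cong ((+ 1 / m) *_) (*-distribʳ-sum c x))

  avg-+ : ∀ m .{{_ : NonZero m}} x y → avg m (λ i → x i + y i) ≡ avg m x + avg m y
  avg-+ m x y = trans (cong ((+ 1 / m) *_) (∑-distrib-+ x y)) (*-distribˡ-+ (+ 1 / m) (sumᴹ +-0-rawMonoid x) (sumᴹ +-0-rawMonoid y))

  avg-affine : ∀ m .{{_ : NonZero m}} x s r → avg m (λ i → x i * s + r) ≡ avg m x * s + r
  avg-affine m x s r = trans (avg-+ m (λ i → x i * s) (λ _ → r)) (cong₂ _+_ (sym (avg-*ʳ m x s)) (avg-const m r))

  sum-mono : ∀ {m} {x y : Fin m → ℚ} → (∀ i → x i ≤ y i) → sumᴹ +-0-rawMonoid x ≤ sumᴹ +-0-rawMonoid y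
  sum-mono {zero}  x≤y = ≤-refl
  sum-mono {suc m} x≤y = +-mono-≤ (x≤y zero) (sum-mono (x≤y ∘ suc))

  avg-mono : ∀ m .{{_ : NonZero m}} {x y : Fin m → ℚ} → (∀ i → x i ≤ y i) → avg m x ≤ avg m y
  avg-mono m x≤y = *-monoˡ-≤-nonNeg (+ 1 / m) {{normalize-nonNeg 1 m}} (sum-mono x≤y)

  avg-ι : ∀ m .{{_ : NonZero m}} (f : Fin m → ℕ) → avg m (ι ∘ f) * ι m ≡ ι (∑ (allFin m) f)
  avg-ι m f = begin
    (+ 1 / m) * sumᴹ +-0-rawMonoid (ι ∘ f) * ι m    ≡⟨ cong (λ q → (+ 1 / m) * q * ι m) (sum-ι m f) ⟩
    (+ 1 / m) * ι s * ι m                           ≡⟨ *-assoc (+ 1 / m) (ι s) (ι m) ⟩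
    (+ 1 / m) * (ι s * ι m)                         ≡⟨ cong ((+ 1 / m) *_) (*-comm (ι s) (ι m)) ⟩
    (+ 1 / m) * (ι m * ι s)                         ≡⟨ *-assoc (+ 1 / m) (ι m) (ι s) ⟨
    (+ 1 / m) * ι m * ι s                           ≡⟨ cong (_* ι s) (1/m*ιm m) ⟩
    1ℚ * ι s                                        ≡⟨ *-identityˡ (ι s) ⟩
    ι s                                             ∎
    where
    open ≡-Reasoning
    s : ℕ
    s = ∑ (allFin m) f
    sum-ι : ∀ m (f : Fin m → ℕ) → sumᴹ +-0-rawMonoid (ι ∘ f) ≡ ι (∑ (allFin m) f)
    sum-ι zero    f = refl
    sum-ι (suc m) f = trans (cong (λ q → ι (f zero) + q) (sum-ι m (f ∘ suc)))
      (trans (sym (ι-+ (f zero) (∑ (allFin m) (f ∘ suc)))) (cong ι (sym (∑-allFin-suc m f))))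

  -- After n rounds of detection probability p, (1 − p)^n · (1 + n p) ≤ 1.
  module Amplify
    (p : ℚ) (0≤p : 0ℚ ≤ p) (p≤1 : p ≤ 1ℚ)
    (r : ℕ → ℚ) (r-zero : r 0 ≡ 0ℚ) (r-suc : ∀ n → r (suc n) ≡ p * (1ℚ - r n) + r n) where

    open +-*-Solver

    private
      a : ℕ → ℚ
      a n = 1ℚ - r n

      a-suc : ∀ n → a (suc n) ≡ (1ℚ - p) * a n
      a-suc n = trans (cong (λ q → 1ℚ - q) (r-suc n))
        (solve 2 (λ p r → con 1ℚ :- (p :* (con 1ℚ :- r) :+ r) := (con 1ℚ :- p) :* (con 1ℚ :- r)) refl p (r n))

      0≤1-p : 0ℚ ≤ 1ℚ - p
      0≤1-p = subst (_≤ 1ℚ - p) (+-inverseʳ p) (+-monoˡ-≤ (- p) p≤1)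

      0≤* : ∀ {x y} → 0ℚ ≤ x → 0ℚ ≤ y → 0ℚ ≤ x * y
      0≤* {x} {y} 0≤x 0≤y = subst (_≤ x * y) (*-zeroˡ y) (*-monoʳ-≤-nonNeg y {{nonNegative 0≤y}} 0≤x)

      0≤a : ∀ n → 0ℚ ≤ a n
      0≤a zero    = subst (λ q → 0ℚ ≤ 1ℚ - q) (sym r-zero) (ι-mono {0} {1} z≤n)
      0≤a (suc n) = subst (0ℚ ≤_) (sym (a-suc n)) (0≤* 0≤1-p (0≤a n))

      decay : ∀ n → a n * (1ℚ + ι n * p) ≤ 1ℚ
      decay zero = ≤-reflexive (trans (cong (λ q → (1ℚ - q) * (1ℚ + 0ℚ * p)) r-zero)
        (solve 1 (λ p → (con 1ℚ :- con 0ℚ) :* (con 1ℚ :+ con 0ℚ :* p) := con 1ℚ) refl p))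
      decay (suc n) = begin
        a (suc n) * (1ℚ + ι (suc n) * p)
          ≡⟨ cong₂ (λ x y → x * (1ℚ + y * p)) (a-suc n) (ι-+ 1 n) ⟩
        (1ℚ - p) * a n * (1ℚ + (1ℚ + ι n) * p)
          ≡⟨ solve 3 (λ p x n → (con 1ℚ :- p) :* x :* (con 1ℚ :+ (con 1ℚ :+ n) :* p)
               := x :* (con 1ℚ :+ n :* p) :- x :* ((con 1ℚ :+ n) :* (p :* p))) refl p (a n) (ι n) ⟩
        a n * (1ℚ + ι n * p) - a n * ((1ℚ + ι n) * (p * p))
          ≤⟨ +-monoʳ-≤ (a n * (1ℚ + ι n * p)) (neg-antimono-≤ (0≤* (0≤a n) (0≤* 0≤1+n (0≤* 0≤p 0≤p)))) ⟩
        a n * (1ℚ + ι n * p) + 0ℚ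
          ≡⟨ +-identityʳ (a n * (1ℚ + ι n * p)) ⟩
        a n * (1ℚ + ι n * p)
          ≤⟨ decay n ⟩
        1ℚ ∎
        where
        open ≤-Reasoning
        0≤1+n : 0ℚ ≤ 1ℚ + ι n
        0≤1+n = subst (0ℚ ≤_) (ι-+ 1 n) (ι-mono {0} {suc n} z≤n)

    -- With 2 D rounds 1 + 2 D p ≥ 3, so all rounds miss with probability at most 1/3. This
    -- Bernoulli-type bound replaces the exponential and stays within ℚ.
    amplified : ∀ D → 1ℚ ≤ ι D * p → + 2 / 3 ≤ r (2 ℕ.* D)
    amplified D 1≤Dp = begin
      + 2 / 3                        ≡⟨⟩
      1ℚ - + 1 / 3                   ≤⟨ +-monoʳ-≤ 1ℚ (neg-antimono-≤ a≤⅓) ⟩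
      1ℚ - a (2 ℕ.* D)               ≡⟨ solve 1 (λ r → con 1ℚ :- (con 1ℚ :- r) := r) refl (r (2 ℕ.* D)) ⟩
      r (2 ℕ.* D)                    ∎
      where
      open ≤-Reasoning
      3≤ : ι 3 ≤ 1ℚ + ι (2 ℕ.* D) * p
      3≤ = begin
        ι 3                          ≡⟨⟩
        1ℚ + ι 2 * 1ℚ                ≤⟨ +-monoʳ-≤ 1ℚ (*-monoˡ-≤-nonNeg (ι 2) 1≤Dp) ⟩
        1ℚ + ι 2 * (ι D * p)         ≡⟨ cong (λ q → 1ℚ + q) (*-assoc (ι 2) (ι D) p) ⟨
        1ℚ + ι 2 * ι D * p           ≡⟨ cong (λ q → 1ℚ + q * p) (ι-* 2 D) ⟨
        1ℚ + ι (2 ℕ.* D) * p         ∎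
      a≤⅓ : a (2 ℕ.* D) ≤ + 1 / 3
      a≤⅓ = *-cancelʳ-≤-pos (ι 3) (begin
        a (2 ℕ.* D) * ι 3                        ≤⟨ *-monoˡ-≤-nonNeg (a (2 ℕ.* D)) {{nonNegative (0≤a (2 ℕ.* D))}} 3≤ ⟩
        a (2 ℕ.* D) * (1ℚ + ι (2 ℕ.* D) * p)     ≤⟨ decay (2 ℕ.* D) ⟩
        1ℚ                                       ≡⟨⟩
        + 1 / 3 * ι 3                            ∎)

  -- The sampling algorithm and its rejection probability.

  module Sampling (T : SignedTriangle) where

    open Greedy T

    matches : (a b c : Maybe Sign) → Bool
    matches a b c = (hasSign (sign₁₂ T) a ∧ hasSign (sign₁₃ T) c) ∧ hasSign (sign₂₃ T) b

    -- Rejection requires that a copy has been seen, which makes the test one-sided. Coinciding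
    -- nodes are harmless because the graph is loopless.
    sample : (N : ℕ) .{{_ : NonZero N}} → ℕ → Algorithm N
    sample N zero    = halt true
    sample N (suc n) =
      random N λ u → random N λ v → random N λ w →
      query u v λ a → query v w λ b → query u w λ c →
      if matches a b c then halt false else sample N n

    module _ {N : ℕ} .{{_ : NonZero N}} (G : SignedGraph N) where

      sample-queries : ∀ n → queries G (sample N n) ℕ.≤ n ℕ.* 3
      sample-queries zero    = z≤n
      sample-queries (suc n) = max≤ λ u → max≤ λ v → max≤ λ w → s≤s (s≤s (s≤s (round u v w)))
        where
        max≤ : ∀ {m c} {f : Fin m → ℕ} → (∀ i → f i ℕ.≤ c) → foldr ℕ._⊔_ 0 f ℕ.≤ c
        max≤ {zero}  f≤ = z≤n
        max≤ {suc m} f≤ = ℕ.⊔-lub (f≤ zero) (max≤ (f≤ ∘ suc))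
        -- `matches` applied to the three answers unfolds to `isTriangle G u v w`, so the case
        -- distinction can be made on the latter.
        round : ∀ u v w → queries G (if isTriangle G u v w then halt false else sample N n) ℕ.≤ n ℕ.* 3
        round u v w with isTriangle G u v w
        ... | true  = z≤n
        ... | false = sample-queries n

      sample-accepts : TriangleFree T G → ∀ n → Pr[_accepts] G (sample N n) ≡ 1ℚ
      sample-accepts free zero    = refl
      sample-accepts free (suc n) = all λ u → all λ v → all λ w → round u v w
        where
        all : {x : Fin N → ℚ} → (∀ i → x i ≡ 1ℚ) → avg N x ≡ 1ℚ
        all x≡ = trans (avg-cong N x≡) (avg-const N 1ℚ)
        round : ∀ u v w → Pr[_accepts] G (if isTriangle G u v w then halt false else sample N n) ≡ 1ℚ
        round u v w with isTriangle G u v w in eq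
        ... | true  = ⊥-elim (free (u , v , w , isTriangle-elim G u v w eq))
        ... | false = sample-accepts free n

      hit : Fin N → Fin N → Fin N → ℕ
      hit u v w = 𝟙 (isTriangle G u v w)

      p : ℚ
      p = avg N λ u → avg N λ v → avg N λ w → ι (hit u v w)

      rejection : ℕ → ℚ
      rejection n = Pr[_rejects] G (sample N n)

      -- The right-hand side is affine in the indicator of a hit, so it passes through the three
      -- averages one at a time.
      rejection-suc : ∀ n → rejection (suc n) ≡ p * (1ℚ - rejection n) + rejection n
      rejection-suc n = begin
        rejection (suc n)
          ≡⟨ avg-cong N (λ u → avg-cong N λ v → avg-cong N λ w → round u v w) ⟩
        avg N (λ u → avg N λ v → avg N λ w → ι (hit u v w) * s + r)
          ≡⟨ avg-cong N (λ u → avg-cong N λ v → avg-affine N (λ w → ι (hit u v w)) s r) ⟩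
        avg N (λ u → avg N λ v → avg N (λ w → ι (hit u v w)) * s + r)
          ≡⟨ avg-cong N (λ u → avg-affine N (λ v → avg N λ w → ι (hit u v w)) s r) ⟩
        avg N (λ u → avg N (λ v → avg N λ w → ι (hit u v w)) * s + r)
          ≡⟨ avg-affine N (λ u → avg N λ v → avg N λ w → ι (hit u v w)) s r ⟩
        p * s + r ∎
        where
        open ≡-Reasoning
        open +-*-Solver
        r s : ℚ
        r = rejection n
        s = 1ℚ - r
        round : ∀ u v w → Pr[_rejects] G (if isTriangle G u v w then halt false else sample N n) ≡ ι (hit u v w) * s + r
        round u v w with isTriangle G u v w
        ... | true  = solve 1 (λ r → con 1ℚ := con 1ℚ :* (con 1ℚ :- r) :+ r) refl r
        ... | false = solve 1 (λ r → r := con 0ℚ :* (con 1ℚ :- r) :+ r) refl r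

      0≤avg : ∀ {x : Fin N → ℚ} → (∀ i → 0ℚ ≤ x i) → 0ℚ ≤ avg N x
      0≤avg 0≤x = ≤-trans (≤-reflexive (sym (avg-const N 0ℚ))) (avg-mono N 0≤x)

      avg≤1 : ∀ {x : Fin N → ℚ} → (∀ i → x i ≤ 1ℚ) → avg N x ≤ 1ℚ
      avg≤1 x≤1 = ≤-trans (avg-mono N x≤1) (≤-reflexive (avg-const N 1ℚ))

      p-count : p * (ι N * (ι N * ι N)) ≡ ι (triangleCount G)
      p-count = begin
        p * (ι N * (ι N * ι N))
          ≡⟨ solve 2 (λ p n → p :* (n :* (n :* n)) := ((p :* n) :* n) :* n) refl p (ι N) ⟩
        p * ι N * ι N * ι N
          ≡⟨ cong (λ q → q * ι N * ι N) (avg-*ʳ N _ (ι N)) ⟩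
        avg N (λ u → avg N (λ v → avg N λ w → ι (hit u v w)) * ι N) * ι N * ι N
          ≡⟨ cong (_* ι N) (avg-*ʳ N _ (ι N)) ⟩
        avg N (λ u → avg N (λ v → avg N λ w → ι (hit u v w)) * ι N * ι N) * ι N
          ≡⟨ cong (_* ι N) (avg-cong N λ u → trans (cong (_* ι N) (avg-*ʳ N _ (ι N)))
               (trans (cong (_* ι N) (avg-cong N λ v → avg-ι N (hit u v))) (avg-ι N (λ v → ∑ (allFin N) (hit u v))))) ⟩
        avg N (λ u → ι (∑[ v ∈ allFin N ] ∑ (allFin N) (hit u v))) * ι N
          ≡⟨ avg-ι N (λ u → ∑[ v ∈ allFin N ] ∑ (allFin N) (hit u v)) ⟩
        ι (triangleCount G) ∎
        where
        open ≡-Reasoning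
        open +-*-Solver

      sample-rejects : ∀ D → N ℕ.* (N ℕ.* N) ℕ.≤ D ℕ.* triangleCount G → + 2 / 3 ≤ rejection (2 ℕ.* D)
      sample-rejects D many = Amplify.amplified p
        (0≤avg λ u → 0≤avg λ v → 0≤avg λ w → ι-mono {0} {hit u v w} z≤n)
        (avg≤1 λ u → avg≤1 λ v → avg≤1 λ w → ι-mono {hit u v w} {1} (𝟙≤1 (isTriangle G u v w)))
        rejection refl rejection-suc D 1≤Dp
        where
        open ≤-Reasoning
        N³ : ℕ
        N³ = N ℕ.* (N ℕ.* N)
        instance
          N²≢0 : NonZero (N ℕ.* N)
          N²≢0 = ℕ.m*n≢0 N N
          N³≢0 : NonZero N³
          N³≢0 = ℕ.m*n≢0 N (N ℕ.* N)
        1≤Dp : 1ℚ ≤ ι D * p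
        1≤Dp = *-cancelʳ-≤-pos (ι N³) {{normalize-pos N³ 1}} (begin
          1ℚ * ι N³                          ≡⟨ *-identityˡ (ι N³) ⟩
          ι N³                               ≤⟨ ι-mono many ⟩
          ι (D ℕ.* triangleCount G)          ≡⟨ ι-* D (triangleCount G) ⟩
          ι D * ι (triangleCount G)          ≡⟨ cong (ι D *_) p-count ⟨
          ι D * (p * (ι N * (ι N * ι N)))    ≡⟨ *-assoc (ι D) p (ι N * (ι N * ι N)) ⟨
          ι D * p * (ι N * (ι N * ι N))      ≡⟨ cong (λ q → ι D * p * q) (trans (ι-* N (N ℕ.* N)) (cong (ι N *_) (ι-* N N))) ⟨
          ι D * p * ι N³                     ∎)

  -- From the distance ε to a power of two.

  n≤2^⌈log₂n⌉ : ∀ n → n ℕ.≤ 2 ℕ.^ ⌈log₂ n ⌉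
  n≤2^⌈log₂n⌉ = <-rec (λ n → n ℕ.≤ 2 ℕ.^ ⌈log₂ n ⌉) go
    where
    open ℕ.≤-Reasoning
    go : ∀ n → (∀ {m} → m ℕ.< n → m ℕ.≤ 2 ℕ.^ ⌈log₂ m ⌉) → n ℕ.≤ 2 ℕ.^ ⌈log₂ n ⌉
    go 0 rec = z≤n
    go 1 rec = ℕ.m^n>0 2 ⌈log₂ 1 ⌉
    go n@(suc (suc n′)) rec = begin
      n                                    ≡⟨ ℕ.⌊n/2⌋+⌈n/2⌉≡n n ⟨
      ℕ.⌊ n /2⌋ ℕ.+ h                      ≤⟨ ℕ.+-mono-≤ (ℕ.⌊n/2⌋≤⌈n/2⌉ n) (ℕ.≤-reflexive (sym (ℕ.+-identityʳ h))) ⟩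
      2 ℕ.* h                              ≤⟨ ℕ.*-monoʳ-≤ 2 (rec (ℕ.⌈n/2⌉<n n′)) ⟩
      2 ℕ.^ suc ⌈log₂ h ⌉                  ≡⟨ cong (λ l → 2 ℕ.^ suc l) (⌈log₂⌈n/2⌉⌉≡⌈log₂n⌉∸1 n) ⟩
      2 ℕ.^ suc (⌈log₂ n ⌉ ℕ.∸ 1)          ≡⟨ cong (2 ℕ.^_) (ℕ.m+[n∸m]≡n {1} (subst (ℕ._≤ ⌈log₂ n ⌉) (⌈log₂2^n⌉≡n 1) (⌈log₂⌉-mono-≤ {2} {n} (s≤s (s≤s z≤n))))) ⟩
      2 ℕ.^ ⌈log₂ n ⌉                      ∎
      where
      h : ℕ
      h = ℕ.⌈ n /2⌉

  -- For ε = (a + 1) / (d + 1) the rounded reciprocal `q` satisfies d + 1 ≤ q (a + 1), and q ≤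
  -- 2^⌈log₂ q⌉; cross-multiplication removes ε.
  Far⇒ℕ : ∀ (ε : ℚ) .{{_ : Positive ε}} n k → ε * ι n ≤ ι k → n ℕ.≤ k ℕ.* 2 ℕ.^ ⌈log₂-1/ ε ⌉
  Far⇒ℕ ε@(mkℚ +[1+ a ] d c) n k h = ℕ.*-cancelˡ-≤ (suc a) (begin
    suc a ℕ.* n                          ≤⟨ cross ⟩
    k ℕ.* suc d                          ≤⟨ ℕ.*-monoʳ-≤ k d≤ ⟩
    k ℕ.* (q ℕ.* suc a)                  ≤⟨ ℕ.*-monoʳ-≤ k (ℕ.*-monoˡ-≤ (suc a) (n≤2^⌈log₂n⌉ q)) ⟩
    k ℕ.* (2 ℕ.^ ⌈log₂ q ⌉ ℕ.* suc a)    ≡⟨ reorder k (2 ℕ.^ ⌈log₂ q ⌉) (suc a) ⟩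
    suc a ℕ.* (k ℕ.* 2 ℕ.^ ⌈log₂ q ⌉)    ∎)
    where
    open ℕ.≤-Reasoning
    reorder : ∀ k x a → k ℕ.* (x ℕ.* a) ≡ a ℕ.* (k ℕ.* x)
    reorder = ℕ-Solver.solve-∀
    -- The ceiling of 1 / ε unfolds to the negated floor of -1 / ε, and `z` is that floor.
    z : ℤ
    z = -[1+ d ] ℤ./ +[1+ a ]
    q : ℕ
    q = ∣ ℤ.- z ∣
    d≤ : suc d ℕ.≤ q ℕ.* suc a
    d≤ = ℤ.drop‿+≤+ (ℤ.≤-trans
      (subst (+ suc d ℤ.≤_) (ℤ.neg-distribˡ-* z +[1+ a ]) (ℤ.neg-mono-≤ (ℤ.[n/d]*d≤n -[1+ d ] +[1+ a ])))
      (ℤ.≤-trans (ℤ.*-monoʳ-≤-nonNeg +[1+ a ] (i≤∣i∣ (ℤ.- z))) (ℤ.≤-reflexive (sym (ℤ.pos-* q (suc a))))))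
      where
      i≤∣i∣ : ∀ i → i ℤ.≤ + ∣ i ∣
      i≤∣i∣ (+ n)    = ℤ.≤-refl
      i≤∣i∣ -[1+ n ] = ℤ.-≤+
    cross : suc a ℕ.* n ℕ.≤ k ℕ.* suc d
    cross with ℚᵘ.≤-respʳ-≃ (ιᵘ k) (ℚᵘ.≤-respˡ-≃ (ℚᵘ.≃-trans (toℚᵘ-homo-* ε (ι n)) (ℚᵘ.*-congˡ {mkℚᵘ +[1+ a ] d} (ιᵘ n))) (toℚᵘ-mono-≤ h))
    ... | *≤* le = ℤ.drop‿+≤+ (subst₂ ℤ._≤_
      (trans (ℤ.*-identityʳ (+[1+ a ] ℤ.* + n)) (sym (ℤ.pos-* (suc a) n)))
      (trans (cong (λ x → + k ℤ.* + x) (ℕ.*-identityʳ (suc d))) (sym (ℤ.pos-* k (suc d)))) le)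

-- The tester and its query complexity.

open import Data.Nat
open import Data.Nat.Properties
open import Data.Nat.Tactic.RingSolver using (solve-∀)
import Data.Integer as ℤ
open import Data.Rational as ℚ using (ℚ; Positive)
open Counting using (height; n<tower; tower-mono; module Greedy)
open Probability using (Far⇒ℕ; module Sampling)

-- For ℓ = 0, which covers ε ≥ 1, the tower in the claimed complexity has height 0, so the additive
-- constant of the height has to go into the factor `tower c`. For ℓ ≥ 1 doubling `c` absorbs it.
tower-scale : ∀ c ℓ → tower (c * suc ℓ) ≤ tower c * tower (2 * c * ℓ)
tower-scale c zero    = ≤-reflexive (begin
  tower (c * 1)                ≡⟨ cong tower (*-identityʳ c) ⟩
  tower c                      ≡⟨ *-identityʳ (tower c) ⟨
  tower c * 1                  ≡⟨ cong (λ n → tower c * tower n) (*-zeroʳ (2 * c)) ⟨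
  tower c * tower (2 * c * 0)  ∎)
  where open ≡-Reasoning
tower-scale c (suc ℓ) = begin
  tower (c * suc (suc ℓ))              ≤⟨ tower-mono (≤-trans (m≤m+n _ (c * ℓ)) (≤-reflexive (identity c ℓ))) ⟩
  tower (2 * c * suc ℓ)                ≤⟨ m≤n*m _ (tower c) {{>-nonZero (≤-trans (s≤s z≤n) (n<tower c))}} ⟩
  tower c * tower (2 * c * suc ℓ)      ∎
  where
  open ≤-Reasoning
  identity : ∀ c ℓ → c * suc (suc ℓ) + c * ℓ ≡ 2 * c * suc ℓ
  identity = solve-∀

-- The height on the left is 389 ℓ + 2749.
height≤ : ∀ ℓ → height (ℓ + 6) ≤ 2749 * suc ℓ
height≤ ℓ = ≤-trans (m≤m+n _ (2360 * ℓ)) (≤-reflexive (identity ℓ))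
  where
  identity : ∀ ℓ → suc (2 * suc (192 * suc (ℓ + 6)) + suc (5 * (ℓ + 6) + 27)) + 2360 * ℓ ≡ 2749 * suc ℓ
  identity = solve-∀

sampling-tester : (T : SignedTriangle) → ∀ c → (∀ ℓ → height (ℓ + 6) ≤ c * suc ℓ) →
    Σ[ A ∈ Tester (TriangleFree T) ]
      (OneSided A ×
       (∃[ c ] QueryComplexityÕ A (λ ε → tower (c * ⌈log₂-1/ ε ⌉))))
-- Two rounds per unit of `bound` and three queries per round make the 6. The bound has no
-- logarithmic factor and does not depend on N, hence the exponent 0.
sampling-tester T c h≤ = tester , one-sided , 2 * c , 6 * tower c , 0 , complexity
  where
  open Sampling T
  open Greedy T using (many-triangles)

  bound : (ε : ℚ) .{{_ : Positive ε}} → ℕ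
  bound ε = tower (height (⌈log₂-1/ ε ⌉ + 6))

  one-sided : ∀ N .{{_ : NonZero N}} ε .{{_ : Positive ε}} (G : SignedGraph N) →
              TriangleFree T G → Pr[_accepts] G (sample N (2 * bound ε)) ≡ ℚ.1ℚ
  one-sided N ε G free = sample-accepts G free (2 * bound ε)

  tester : Tester (TriangleFree T)
  tester .algorithm N ε = sample N (2 * bound ε)
  tester .complete N ε G free =
    subst ((ℤ.+ 2 ℚ./ 3) ℚ.≤_) (sym (one-sided N ε G free)) (ℚ.*≤* (ℤ.+≤+ (s≤s (s≤s z≤n))))
  tester .sound N ε G far = sample-rejects G (bound ε)
    (many-triangles G ⌈log₂-1/ ε ⌉ (>-nonZero⁻¹ N)
      (λ {k} reach free → Far⇒ℕ ε (N * N) k (far reach free)))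

  complexity : ∀ N .{{_ : NonZero N}} ε .{{_ : Positive ε}} (G : SignedGraph N) →
    queries G (sample N (2 * bound ε)) ≤ 6 * tower c * tower (2 * c * ⌈log₂-1/ ε ⌉) * 1 * 1
  complexity N ε G = begin
    queries G (sample N (2 * bound ε))    ≤⟨ sample-queries G (2 * bound ε) ⟩
    2 * bound ε * 3                       ≤⟨ *-monoˡ-≤ 3 (*-monoʳ-≤ 2 (≤-trans (tower-mono (h≤ ℓ)) (tower-scale c ℓ))) ⟩
    2 * (tower c * t) * 3                   ≡⟨ identity (tower c) t ⟩
    6 * tower c * t * 1 * 1                 ∎
    where
    open ≤-Reasoning
    ℓ t : ℕ
    ℓ = ⌈log₂-1/ ε ⌉
    t = tower (2 * c * ℓ)
    identity : ∀ x y → 2 * (x * y) * 3 ≡ 6 * x * y * 1 * 1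
    identity = solve-∀

theorem1 : (T : SignedTriangle) →
    Σ[ A ∈ Tester (TriangleFree T) ]
    (OneSided A ×
    (∃[ c ] QueryComplexityÕ A (λ ε → tower (c * ⌈log₂-1/ ε ⌉))))
theorem1 T = sampling-tester T 2749 height≤
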